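{- Let $G$ be a finite abelian group, let $n\geq 1$, and let $S$ be a sequence of terms from $G$ with $|S|\geq n+|G|-1$ and $\mathsf h(S)\leq n$. Suppose that for every proper subgroup $H<G$ and every $\alpha\in G$, there are at least $|G/H|-1$ terms of $S$ (counted with multiplicity) lying outside the coset $\alpha+H$. Then $\Sigma_n(S)=G$ whenever \begin{itemize} \item[1.] $n\geq \exp(G)$, or \item[2.] $n\geq \exp(G)-1$, $G\cong H\oplus C_{\exp(G)}$, and either $|H|$ or $\exp(G)$ is prime, or \item[3.] $n\geq \frac1p|G|-1$ and $G$ is cyclic, where $p$ is the smallest prime divisor of $|G|$, or \item[4.] $n\geq 1$ and either $\exp(G)\leq 3$ or $|G|<10$. \end{itemize}
   Context: A sequence $S=g_1\cdot\ldots\cdot g_\ell$ of terms from $G$ is a finite unordered list with repetition allowed; $|S|=\ell$ is its length. For $g\in G$, $\mathsf v_g(S)$ is the multiplicity of $g$ in $S$, and $\mathsf h(S)=\max_g \mathsf v_g(S)$. For a subsequence $T\mid S$, $\sigma(T)$ is the sum of its terms, and $\Sigma_n(S)=\{\sigma(T): T\mid S,\ |T|=n\}$. $\exp(G)$ is the exponent of $G$ and $C_m$ a cyclic group of order $m$. -}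

module Defs where

open import Level using (Level; _⊔_) renaming (suc to lsuc)
open import Algebra.Bundles using (AbelianGroup)
open import Data.Nat using (ℕ; zero; suc; _+_; _*_; _∸_; _≤_; _<_; _<ᵇ_)
open import Data.Nat.Divisibility using (_∣_)
open import Data.Nat.Primality using (Prime)
open import Data.Fin using (Fin; toℕ)
open import Data.List using (List; []; _∷_; length; foldr; allFin)
open import Data.List.Relation.Binary.Sublist.Propositional using (_⊆_)
open import Data.Bool using (Bool; true; false; not; _∨_; _∧_; if_then_else_)
open import Data.Product using (Σ; ∃; _×_; _,_)
open import Data.Sum using (_⊎_)
open import Relation.Binary using (Decidable)
open import Relation.Binary.PropositionalEquality using (_≡_)
open import Relation.Nullary.Decidable using (⌊_⌋)

countL : ∀ {a} {A : Set a} → (A → Bool) → List A → ℕ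
countL p []       = 0
countL p (x ∷ xs) = (if p x then 1 else 0) + countL p xs

allL : ∀ {a} {A : Set a} → (A → Bool) → List A → Bool
allL p []       = true
allL p (x ∷ xs) = p x ∧ allL p xs

record FiniteAbelianGroup (c ℓ : Level) : Set (lsuc (c ⊔ ℓ)) where
  field
    grp      : AbelianGroup c ℓ
  open AbelianGroup grp public
  field
    _≟_      : Decidable _≈_
    size     : ℕ
    enum     : Fin size → Carrier
    enum-surj : ∀ g → ∃ λ i → enum i ≈ g
    enum-inj  : ∀ i j → enum i ≈ enum j → i ≡ j

module FAG {c ℓ : Level} (G : FiniteAbelianGroup c ℓ) where
  open FiniteAbelianGroup G

  _·_ : ℕ → Carrier → Carrier
  zero  · g = ε
  suc m · g = g ∙ (m · g)

  -- sequences over G: finite lists (order irrelevant for everything below)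
  Seq : Set c
  Seq = List Carrier

  σ : Seq → Carrier
  σ = foldr _∙_ ε

  v : Carrier → Seq → ℕ
  v g = countL (λ x → ⌊ x ≟ g ⌋)

  h≤ : Seq → ℕ → Set c
  h≤ S n = ∀ g → v g S ≤ n

  _∈Σ[_]_ : Carrier → ℕ → Seq → Set (c ⊔ ℓ)
  g ∈Σ[ n ] S = ∃ λ (T : Seq) → (T ⊆ S) × (length T ≡ n) × (σ T ≈ g)

  record Subgroup : Set (c ⊔ ℓ) where
    field
      mem     : Carrier → Bool
      mem-resp : ∀ {x y} → x ≈ y → mem x ≡ mem y
      mem-ε   : mem ε ≡ true
      mem-∙   : ∀ {x y} → mem x ≡ true → mem y ≡ true → mem (x ∙ y) ≡ true
      mem-⁻¹  : ∀ {x} → mem x ≡ true → mem (x ⁻¹) ≡ true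
  open Subgroup public

  Proper : Subgroup → Set c
  Proper H = ∃ λ g → mem H g ≡ false

  card : Subgroup → ℕ
  card H = countL (λ i → mem H (enum i)) (allFin size)

  -- |G/H| : number of cosets, counted via the first (in the enumeration)
  -- representative of each coset
  isFirstRep : Subgroup → Fin size → Bool
  isFirstRep H i =
    allL (λ j → not (toℕ j <ᵇ toℕ i) ∨ not (mem H (enum j ∙ enum i ⁻¹))) (allFin size)

  index : Subgroup → ℕ
  index H = countL (isFirstRep H) (allFin size)

  outside : Subgroup → Carrier → Seq → ℕ
  outside H α = countL (λ x → not (mem H (x ∙ α ⁻¹)))

  IsExponent : ℕ → Set (c ⊔ ℓ)
  IsExponent e = (1 ≤ e) × (∀ g → e · g ≈ ε)
               × (∀ m → 1 ≤ m → (∀ g → m · g ≈ ε) → e ≤ m)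

  HasOrder : Carrier → ℕ → Set ℓ
  HasOrder g e = (1 ≤ e) × (e · g ≈ ε) × (∀ m → 1 ≤ m → m · g ≈ ε → e ≤ m)

  IsCyclic : Set (c ⊔ ℓ)
  IsCyclic = ∃ λ g → ∀ x → ∃ λ k → x ≈ k · g

  -- G ≅ K ⊕ C_e, expressed as an internal direct sum of a subgroup K
  -- and the cyclic subgroup ⟨c⟩ of order e
  DirectSumWithCyclic : Subgroup → ℕ → Set (c ⊔ ℓ)
  DirectSumWithCyclic K e = ∃ λ (c₀ : Carrier) →
      HasOrder c₀ e
    × (∀ g → ∃ λ k → ∃ λ m → (mem K k ≡ true) × (g ≈ k ∙ (m · c₀)))
    × (∀ m → mem K (m · c₀) ≡ true → m · c₀ ≈ ε)

  IsSmallestPrimeDivisor : ℕ → ℕ → Set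
  IsSmallestPrimeDivisor p N = Prime p × (p ∣ N) × (∀ q → Prime q → q ∣ N → p ≤ q)

  Cond1 Cond4 : ℕ → ℕ → Set
  Cond2 Cond3 : ℕ → ℕ → Set (c ⊔ ℓ)
  Cond1 n e = e ≤ n
  Cond2 n e = (e ≤ n + 1)
            × ∃ λ (K : Subgroup) → DirectSumWithCyclic K e × (Prime (card K) ⊎ Prime e)
  Cond3 n e = IsCyclic × ∃ λ p → IsSmallestPrimeDivisor p size
            × ∃ λ q → (size ≡ q * p) × (q ≤ n + 1)
  Cond4 n e = 1 ≤ n × (e ≤ 3 ⊎ size < 10)

{-# OPTIONS --safe #-}
-- Suppose X = Σ_n(S) ≠ G, let K be its stabiliser, B the union of the K-cosets containing at least n terms of S,
-- and r the number of terms outside B.  The DeVos–Goddyn–Mohar theorem bounds |X| from below and, with |S| ≥ n + |G| - 1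
-- and h(S) ≤ n, gives |K| ≥ 2, n > r + 2 and n|B| > |G|; the hypothesis on cosets gives |B| ≥ 2|K|, so (n + 2)|K| ≤ |G|.
-- Let L be the subgroup generated by B - B.  By the coset hypothesis and Kneser's theorem every coset of L is reached by
-- a sum of t terms outside B with (t + 1)|L| ≤ |G|, so for some such t the iterated sumset (n - t)B is not a full coset of L.
-- An iterated sumset mB with m|B| > |L| that is not full has two consecutive multiples at which Kneser's bound is sharp.
-- Vosper's theorem, proved with Hamidoune's 2-atoms, then shows that, modulo its stabiliser, B generates a cyclic group or
-- fills all but few elements of the cosets of a proper subgroup that it meets.  For t > 0 the sizes
-- then contradict each other, and for t = 0 the quotient G/K has an element of order greater than n.  This refutes
-- conditions 1 and 2 (if exp(G) = n + 1 is prime, |G/K| ≡ 1 mod n contradicts the size bounds instead), while conditions 3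
-- and 4 contradict (n + 2)|K| ≤ |G|.
module Submission where

open import Defs
open import Algebra.Bundles using (AbelianGroup)
import Algebra.Properties.AbelianGroup as AbelianGroupProperties
import Algebra.Properties.CommutativeMonoid.Mult as CMult
import Algebra.Properties.Monoid.Mult as Mult
import Algebra.Properties.Semiring.Sum as Sum
open import Algebra.Structures using (IsAbelianGroup)
open import Data.Bool using (Bool; true; false; not; _∨_; if_then_else_) renaming (T to IsTrue)
import Data.Bool.Properties as Bool
open import Data.Empty using (⊥; ⊥-elim)
open import Data.Fin using (Fin; zero; suc; toℕ)
import Data.Fin.Permutation as Perm
open import Data.Fin.Properties using (any?; all?; _≟_)
open import Data.List using (List; []; _∷_; _++_; map; length; foldr; filter; allFin; tabulate; replicate)
open import Data.List.Membership.Propositional using () renaming (_∈_ to _∈ˡ_)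
open import Data.List.Membership.Propositional.Properties using (∈-filter⁻; ∈-allFin)
open import Data.List.Properties using (length-map; length-replicate)
open import Data.List.Relation.Binary.Sublist.Propositional using ([]; _∷_; _∷ʳ_; minimum; lookup) renaming (_⊆_ to _⊑_)
import Data.List.Relation.Binary.Sublist.Propositional.Properties as ⊑
open import Data.List.Relation.Unary.All using (All; []; _∷_)
open import Data.List.Relation.Unary.All.Properties using (++⁺)
open import Data.List.Relation.Unary.Any using (here; there)
open import Data.Nat using (ℕ; zero; suc; _+_; _*_; _∸_; _≤_; _<_; z≤n; s≤s; _⊓_; _<?_; _≤?_; _<ᵇ_; >-nonZero)
open import Data.Nat.Coprimality using (prime⇒coprime; coprime-Bézout)
open import Data.Nat.Divisibility using (divides; ∣-trans; ∣⇒≤; m∣m*n) renaming (_∣_ to _∣ⁿ_)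
open import Data.Nat.GCD using (module Bézout)
open import Data.Nat.Induction using (<-wellFounded)
open import Data.Nat.ListAction using (product) renaming (sum to sumL)
open import Data.Nat.Primality using (Prime; prime⇒irreducible; ¬prime[1])
open import Data.Nat.Primality.Factorisation using (factorise; PrimeFactorisation)
open import Data.Nat.Properties as ℕ hiding (_≟_)
open import Data.Nat.Tactic.RingSolver using (solve-∀)
open import Data.Product using (Σ; ∃; _×_; _,_; proj₁; proj₂)
open import Data.Sum using (_⊎_; inj₁; inj₂; [_,_]′; swap)
open import Data.Vec as Vec using (Vec; []; _∷_; zipWith)
open import Function using (_∘_)
open import Induction.WellFounded using (Acc; acc)
open import Level using (Level; 0ℓ)
open import Relation.Binary.PropositionalEquality as ≡ hiding ([_]; resp; J)
import Relation.Binary.Reflection as Reflection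
open import Relation.Nullary using (Dec; yes; no; ¬_; does)
open import Relation.Nullary.Decidable using (⌊_⌋; _×-dec_; _⊎-dec_; _→-dec_; ¬?; map′; decidable-stable; dec-true; dec-false)
open import Relation.Unary using (Decidable)

-- The quotient by a stabiliser is never formed. The sets to be compared are kept periodic, their
-- sizes are multiples of the order of the stabiliser, and "one element of the quotient" is read as
-- one coset.
--
-- The obstacle is that Σ_n(S) is not an iterated sumset. Fix β in B. A sum of n terms is n·β plus
-- corrections, each term s outside B offers the choice {0, s - β}, and every s that is used
-- displaces one of the n copies of B. So t exchanges leave only (n - t)B to fill L. The account
-- still balances, because an exchange is kept only if it gains |L| new elements: then (t + 1)|L| ≤
-- |G| < n|B| together with |B| ≤ |L| gives (n - t)|B| > |L|, and what is proved about iterated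
-- sumsets applies to n - t copies as it does to n.
--
-- Such a sumset can fail to fill L in two ways: B is almost periodic under a proper subgroup, or L
-- is cyclic modulo the stabiliser. Both are recorded by the same data, a proper subgroup Q of L
-- with a Kneser bound against |L| and an element of large order, so that the two need not be told
-- apart afterwards.

private module S = Sum +-*-semiring

-- To derive X ≤ Y from a linear combination A ≤ B of hypotheses it suffices to check the identity X + B + k = Y + A.
lin≤ : ∀ {X Y A B} k → A ≤ B → X + B + k ≡ Y + A → X ≤ Y
lin≤ {X} {Y} {A} {B} k A≤B eq = +-cancelʳ-≤ B X Y (begin
  X + B      ≤⟨ m≤m+n (X + B) k ⟩
  X + B + k  ≡⟨ eq ⟩
  Y + A      ≤⟨ +-monoʳ-≤ Y A≤B ⟩
  Y + B      ∎)
  where open ≤-Reasoning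

lin⊥ : ∀ {A B} k → A ≤ B → B + suc k ≡ A → ⊥
lin⊥ {A} {B} k A≤B eq = m+1+n≰m B (≤-trans (≤-reflexive eq) A≤B)

infixl 5 _⊕≤_
_⊕≤_ : ∀ {a b c d} → a ≤ b → c ≤ d → a + c ≤ b + d
_⊕≤_ = +-mono-≤

-- Finite sums over `Fin N`.

abstract
  sum : ∀ {N} → (Fin N → ℕ) → ℕ
  sum = S.sum

  sum-cong-≗ : ∀ {N} {f g : Fin N → ℕ} → (∀ x → f x ≡ g x) → sum f ≡ sum g
  sum-cong-≗ = S.sum-cong-≗

  ∑-distrib-+ : ∀ {N} (f g : Fin N → ℕ) → sum (λ x → f x + g x) ≡ sum f + sum g
  ∑-distrib-+ = S.∑-distrib-+

  ∑-comm : ∀ {M N} (f : Fin M → Fin N → ℕ) → sum (λ x → sum (f x)) ≡ sum (λ y → sum (λ x → f x y))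
  ∑-comm = S.∑-comm

  *-distribˡ-sum : ∀ {N} c (f : Fin N → ℕ) → c * sum f ≡ sum (λ x → c * f x)
  *-distribˡ-sum = S.*-distribˡ-sum

  sum-mono : ∀ {N} {f g : Fin N → ℕ} → (∀ x → f x ≤ g x) → sum f ≤ sum g
  sum-mono {zero}  f≤g = z≤n
  sum-mono {suc N} f≤g = +-mono-≤ (f≤g zero) (sum-mono (λ x → f≤g (suc x)))

  sum-const : ∀ N c → sum {N} (λ _ → c) ≡ N * c
  sum-const zero    c = refl
  sum-const (suc N) c = cong (c +_) (sum-const N c)

  sum-reindex : ∀ {N} (f : Fin N → ℕ) (π ρ : Fin N → Fin N) →
    (∀ x → π (ρ x) ≡ x) → (∀ x → ρ (π x) ≡ x) → sum (λ x → f (π x)) ≡ sum f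
  sum-reindex f π ρ πρ ρπ = sym (S.sum-permute f (Perm.permutation π ρ πρ ρπ))

  sum-term : ∀ {N} (f : Fin N → ℕ) x → f x ≤ sum f
  sum-term f zero    = m≤m+n _ _
  sum-term f (suc x) = ≤-trans (sum-term (λ y → f (suc y)) x) (m≤n+m _ _)

  sum-tabulate : ∀ {N} (f : Fin N → ℕ) → sum f ≡ foldr _+_ 0 (tabulate f)
  sum-tabulate {zero}  f = refl
  sum-tabulate {suc N} f = cong (f zero +_) (sum-tabulate (λ x → f (suc x)))

  sum-single : ∀ {N} (f : Fin N → ℕ) x → (∀ y → y ≢ x → f y ≡ 0) → sum f ≡ f x
  sum-single {suc N} f zero h = trans (cong (f zero +_)
    (trans (sum-cong-≗ (λ y → h (suc y) (λ ()))) (trans (sum-const N 0) (*-zeroʳ N)))) (+-identityʳ (f zero))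
  sum-single {suc N} f (suc x) h = cong₂ _+_ (h zero (λ ()))
    (sum-single (λ y → f (suc y)) x (λ y y≢x → h (suc y) (λ { refl → y≢x refl })))

-- Abelian groups carried by `Fin N`.

record FinAb (N : ℕ) : Set where
  infixl 7 _∙_
  infix  8 _⁻¹
  field
    _∙_ : Fin N → Fin N → Fin N
    ε   : Fin N
    _⁻¹ : Fin N → Fin N
    isAbelianGroup : IsAbelianGroup _≡_ _∙_ ε _⁻¹

  abelianGroup : AbelianGroup 0ℓ 0ℓ
  abelianGroup = record { isAbelianGroup = isAbelianGroup }

  open IsAbelianGroup isAbelianGroup public
    using (assoc; comm; identityˡ; identityʳ; inverseˡ; inverseʳ)
  open AbelianGroupProperties abelianGroup public
    using (⁻¹-involutive; ⁻¹-∙-comm; ε⁻¹≈ε)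
  open Mult (AbelianGroup.monoid abelianGroup) public
    using (×-homo-+; ×-assocˡ) renaming (_×_ to infixr 9 _·_)
  open CMult (AbelianGroup.commutativeMonoid abelianGroup) public
    using (×-distrib-+)

  ∙ˡ : ∀ {a b c} → b ≡ c → a ∙ b ≡ a ∙ c
  ∙ˡ {a} = cong (a ∙_)

  ∙ʳ : ∀ {a b c} → b ≡ c → b ∙ a ≡ c ∙ a
  ∙ʳ {a} = cong (_∙ a)

  infixl 6 _-_
  _-_ : Fin N → Fin N → Fin N
  x - y = x ∙ y ⁻¹

-- Abelian group identities by normalisation.

module GroupSolver {N : ℕ} (𝔾 : FinAb N) where
  open FinAb 𝔾

  infixl 7 _⊞_
  infixl 6 _⊟_
  data Expr (n : ℕ) : Set where
    var : Fin n → Expr n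
    _⊞_ : Expr n → Expr n → Expr n
    inv : Expr n → Expr n
    nul : Expr n

  _⊟_ : ∀ {n} → Expr n → Expr n → Expr n
  a ⊟ b = a ⊞ inv b

  Env : ℕ → Set
  Env n = Vec (Fin N) n

  ⟦_⟧ : ∀ {n} → Expr n → Env n → Fin N
  ⟦ var i ⟧ ρ = Vec.lookup ρ i
  ⟦ a ⊞ b ⟧ ρ = ⟦ a ⟧ ρ ∙ ⟦ b ⟧ ρ
  ⟦ inv a ⟧ ρ = (⟦ a ⟧ ρ) ⁻¹
  ⟦ nul ⟧   ρ = ε

  unit : ∀ {n} → Fin n → Vec ℕ n
  unit zero    = 1 ∷ Vec.replicate _ 0
  unit (suc i) = 0 ∷ unit i

  pos neg : ∀ {n} → Expr n → Vec ℕ n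
  pos (var i) = unit i
  pos (a ⊞ b) = zipWith _+_ (pos a) (pos b)
  pos (inv a) = neg a
  pos nul     = Vec.replicate _ 0
  neg (var i) = Vec.replicate _ 0
  neg (a ⊞ b) = zipWith _+_ (neg a) (neg b)
  neg (inv a) = pos a
  neg nul     = Vec.replicate _ 0

  lin : ∀ {n} → Vec ℕ n → Env n → Fin N
  lin []      []      = ε
  lin (k ∷ u) (x ∷ ρ) = k · x ∙ lin u ρ

  ∙-swap : ∀ a b c d → (a ∙ b) ∙ (c ∙ d) ≡ (a ∙ c) ∙ (b ∙ d)
  ∙-swap a b c d = begin
    (a ∙ b) ∙ (c ∙ d)  ≡⟨ assoc a b (c ∙ d) ⟩
    a ∙ (b ∙ (c ∙ d))  ≡⟨ cong (a ∙_) (sym (assoc b c d)) ⟩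
    a ∙ ((b ∙ c) ∙ d)  ≡⟨ cong (λ t → a ∙ (t ∙ d)) (comm b c) ⟩
    a ∙ ((c ∙ b) ∙ d)  ≡⟨ cong (a ∙_) (assoc c b d) ⟩
    a ∙ (c ∙ (b ∙ d))  ≡⟨ sym (assoc a c (b ∙ d)) ⟩
    (a ∙ c) ∙ (b ∙ d)  ∎
    where open ≡-Reasoning

  lin-+ : ∀ {n} (u v : Vec ℕ n) ρ → lin (zipWith _+_ u v) ρ ≡ lin u ρ ∙ lin v ρ
  lin-+ []      []      []      = sym (identityˡ ε)
  lin-+ (k ∷ u) (l ∷ v) (x ∷ ρ) =
    trans (cong₂ _∙_ (×-homo-+ x k l) (lin-+ u v ρ)) (∙-swap _ _ _ _)

  lin-0 : ∀ {n} (ρ : Env n) → lin (Vec.replicate n 0) ρ ≡ ε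
  lin-0 []      = refl
  lin-0 (x ∷ ρ) = trans (identityˡ _) (lin-0 ρ)

  lin-unit : ∀ {n} (i : Fin n) ρ → lin (unit i) ρ ≡ Vec.lookup ρ i
  lin-unit zero    (x ∷ ρ) = trans (cong₂ _∙_ (identityʳ x) (lin-0 ρ)) (identityʳ x)
  lin-unit (suc i) (x ∷ ρ) = trans (identityˡ _) (lin-unit i ρ)

  diff : ∀ {n} → Vec ℕ n → Vec ℕ n → Env n → Fin N
  diff u v ρ = lin u ρ - lin v ρ

  diff-+ : ∀ {n} (u v u′ v′ : Vec ℕ n) ρ →
    diff (zipWith _+_ u u′) (zipWith _+_ v v′) ρ ≡ diff u v ρ ∙ diff u′ v′ ρ
  diff-+ u v u′ v′ ρ = begin
    lin (zipWith _+_ u u′) ρ ∙ lin (zipWith _+_ v v′) ρ ⁻¹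
      ≡⟨ cong₂ (λ a b → a ∙ b ⁻¹) (lin-+ u u′ ρ) (lin-+ v v′ ρ) ⟩
    (lin u ρ ∙ lin u′ ρ) ∙ (lin v ρ ∙ lin v′ ρ) ⁻¹
      ≡⟨ cong (lin u ρ ∙ lin u′ ρ ∙_) (sym (⁻¹-∙-comm _ _)) ⟩
    (lin u ρ ∙ lin u′ ρ) ∙ (lin v ρ ⁻¹ ∙ lin v′ ρ ⁻¹)
      ≡⟨ ∙-swap _ _ _ _ ⟩
    diff u v ρ ∙ diff u′ v′ ρ ∎
    where open ≡-Reasoning

  -‿flip : ∀ a b → (a - b) ⁻¹ ≡ b - a
  -‿flip a b = trans (sym (⁻¹-∙-comm a (b ⁻¹))) (trans (cong (a ⁻¹ ∙_) (⁻¹-involutive b)) (comm _ _))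

  diff-correct : ∀ {n} (e : Expr n) ρ → diff (pos e) (neg e) ρ ≡ ⟦ e ⟧ ρ
  diff-correct (var i) ρ =
    trans (cong₂ (λ a b → a ∙ b ⁻¹) (lin-unit i ρ) (lin-0 ρ)) (trans (∙ˡ ε⁻¹≈ε) (identityʳ _))
  diff-correct (a ⊞ b) ρ =
    trans (diff-+ (pos a) (neg a) (pos b) (neg b) ρ) (cong₂ _∙_ (diff-correct a ρ) (diff-correct b ρ))
  diff-correct (inv a) ρ = trans (sym (-‿flip _ _)) (cong _⁻¹ (diff-correct a ρ))
  diff-correct nul     ρ =
    trans (cong₂ (λ a b → a ∙ b ⁻¹) (lin-0 ρ) (lin-0 ρ)) (inverseʳ ε)

  -- Integer coefficients are kept as pairs of naturals. Truncated subtraction in both directions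
  -- cancels the common part, so two sides with the same integer coefficients become identical and
  -- `refl` closes the goal.
  reduce : ∀ {n} → Vec ℕ n → Vec ℕ n → Vec ℕ n
  reduce = zipWith _∸_

  diff-reduce : ∀ {n} (u v : Vec ℕ n) ρ → diff (reduce u v) (reduce v u) ρ ≡ diff u v ρ
  diff-reduce []      []      []      = refl
  diff-reduce (k ∷ u) (l ∷ v) (x ∷ ρ) = begin
    (k ∸ l) · x ∙ lin (reduce u v) ρ - (l ∸ k) · x ∙ lin (reduce v u) ρ
      ≡⟨ ∙ˡ (sym (⁻¹-∙-comm _ _)) ⟩
    ((k ∸ l) · x ∙ lin (reduce u v) ρ) ∙ (((l ∸ k) · x) ⁻¹ ∙ (lin (reduce v u) ρ) ⁻¹)
      ≡⟨ ∙-swap _ _ _ _ ⟩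
    ((k ∸ l) · x - (l ∸ k) · x) ∙ diff (reduce u v) (reduce v u) ρ
      ≡⟨ cong₂ _∙_ (one k l) (diff-reduce u v ρ) ⟩
    (k · x - l · x) ∙ diff u v ρ
      ≡⟨ ∙-swap _ _ _ _ ⟩
    (k · x ∙ lin u ρ) ∙ ((l · x) ⁻¹ ∙ (lin v ρ) ⁻¹)
      ≡⟨ ∙ˡ (⁻¹-∙-comm _ _) ⟩
    k · x ∙ lin u ρ - l · x ∙ lin v ρ ∎
    where
    open ≡-Reasoning
    one : ∀ k l → (k ∸ l) · x - (l ∸ k) · x ≡ k · x - l · x
    one zero    zero    = refl
    one zero    (suc l) = refl
    one (suc k) zero    = refl
    one (suc k) (suc l) = begin
      (k ∸ l) · x - (l ∸ k) · x          ≡⟨ one k l ⟩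
      k · x - l · x                      ≡⟨ sym (identityˡ _) ⟩
      ε ∙ (k · x - l · x)                ≡⟨ ∙ʳ (sym (inverseʳ x)) ⟩
      (x - x) ∙ (k · x - l · x)          ≡⟨ ∙-swap _ _ _ _ ⟩
      (x ∙ k · x) ∙ (x ⁻¹ ∙ (l · x) ⁻¹)  ≡⟨ ∙ˡ (⁻¹-∙-comm _ _) ⟩
      x ∙ k · x - x ∙ l · x              ∎

  ⟦_⇓⟧ : ∀ {n} → Expr n → Env n → Fin N
  ⟦ e ⇓⟧ ρ = diff (reduce (pos e) (neg e)) (reduce (neg e) (pos e)) ρ

  correct : ∀ {n} (e : Expr n) ρ → ⟦ e ⇓⟧ ρ ≡ ⟦ e ⟧ ρ
  correct e ρ = trans (diff-reduce (pos e) (neg e) ρ) (diff-correct e ρ)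

  open Reflection (setoid (Fin N)) var ⟦_⟧ ⟦_⇓⟧ correct public
    using (_⊜_) renaming (solve to group)

-- Decidable subsets, sumsets, subgroups and periodicity.

module Sets {N : ℕ} (𝔾 : FinAb N) where
  open FinAb 𝔾 public
  open GroupSolver 𝔾 using (group; _⊜_; _⊞_; _⊟_; inv; nul) public

  G : Set
  G = Fin N

  record Sub : Set₁ where
    constructor sub
    field
      P   : G → Set
      dec : ∀ x → Dec (P x)
  open Sub public

  infix 4 _∈_ _∉_ _⊆_
  _∈_ _∉_ : G → Sub → Set
  x ∈ A = P A x
  x ∉ A = ¬ (x ∈ A)

  _⊆_ : Sub → Sub → Set
  A ⊆ B = ∀ {x} → x ∈ A → x ∈ B

  resp : ∀ A {x y} → x ≡ y → x ∈ A → y ∈ A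
  resp A = subst (P A)

  ⊆-dec : ∀ A B → Dec (∀ x → x ∈ A → x ∈ B)
  ⊆-dec A B = all? (λ x → dec A x →-dec dec B x)

  ⊈-witness : ∀ A B → ¬ (A ⊆ B) → ∃ λ x → x ∈ A × x ∉ B
  ⊈-witness A B A⊈B with any? (λ x → dec A x ×-dec ¬? (dec B x))
  ... | yes w = w
  ... | no ¬w = ⊥-elim (A⊈B (λ {x} x∈A → decidable-stable (dec B x) (λ x∉B → ¬w (x , x∈A , x∉B))))

  infixl 6 _∪_ _∩_ _∖_
  infixl 7 _⊕_ _⊹_
  -- Membership in `A ⊕ B` quantifies over the first summand only, the second being forced to
  -- `x - a`; a single bounded search decides it.
  _∪_ _∩_ _∖_ _⊕_ : Sub → Sub → Sub
  A ∪ B = sub (λ x → x ∈ A ⊎ x ∈ B) (λ x → dec A x ⊎-dec dec B x)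
  A ∩ B = sub (λ x → x ∈ A × x ∈ B) (λ x → dec A x ×-dec dec B x)
  A ∖ B = sub (λ x → x ∈ A × x ∉ B) (λ x → dec A x ×-dec ¬? (dec B x))
  A ⊕ B = sub (λ x → ∃ λ a → a ∈ A × x - a ∈ B) (λ x → any? (λ a → dec A a ×-dec dec B (x - a)))

  _⊹_ : Sub → G → Sub
  A ⊹ g = sub (λ x → x - g ∈ A) (λ x → dec A (x - g))

  ⊖_ : Sub → Sub
  ⊖ A = sub (λ x → x ⁻¹ ∈ A) (λ x → dec A (x ⁻¹))

  sg : G → Sub
  sg g = sub (_≡ g) (_≟ g)

  χ : Sub → G → ℕ
  χ A x = if does (dec A x) then 1 else 0

  ∣_∣ : Sub → ℕ
  ∣ A ∣ = sum (χ A)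

  χ-in : ∀ A {x} → x ∈ A → χ A x ≡ 1
  χ-in A {x} x∈A = cong (if_then 1 else 0) (dec-true (dec A x) x∈A)

  χ-out : ∀ A {x} → x ∉ A → χ A x ≡ 0
  χ-out A {x} x∉A = cong (if_then 1 else 0) (dec-false (dec A x) x∉A)

  χ≤1 : ∀ A x → χ A x ≤ 1
  χ≤1 A x with dec A x
  ... | yes _ = s≤s z≤n
  ... | no  _ = z≤n

  χ-mono : ∀ A B {x y} → (x ∈ A → y ∈ B) → χ A x ≤ χ B y
  χ-mono A B {x} {y} f with dec A x
  ... | no  _   = z≤n
  ... | yes x∈A = ≤-reflexive (sym (χ-in B (f x∈A)))

  card-mono : ∀ A B → A ⊆ B → ∣ A ∣ ≤ ∣ B ∣
  card-mono A B A⊆B = sum-mono (λ x → χ-mono A B A⊆B)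

  card-cong : ∀ A B → A ⊆ B → B ⊆ A → ∣ A ∣ ≡ ∣ B ∣
  card-cong A B A⊆B B⊆A = ≤-antisym (card-mono A B A⊆B) (card-mono B A B⊆A)

  card-∪∩ : ∀ A B → ∣ A ∪ B ∣ + ∣ A ∩ B ∣ ≡ ∣ A ∣ + ∣ B ∣
  card-∪∩ A B = begin
    ∣ A ∪ B ∣ + ∣ A ∩ B ∣                ≡⟨ sym (∑-distrib-+ (χ (A ∪ B)) (χ (A ∩ B))) ⟩
    sum (λ x → χ (A ∪ B) x + χ (A ∩ B) x) ≡⟨ sum-cong-≗ pt ⟩
    sum (λ x → χ A x + χ B x)             ≡⟨ ∑-distrib-+ (χ A) (χ B) ⟩
    ∣ A ∣ + ∣ B ∣                         ∎
    where
    open ≡-Reasoning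
    pt : ∀ x → χ (A ∪ B) x + χ (A ∩ B) x ≡ χ A x + χ B x
    pt x with dec A x | dec B x
    ... | yes _ | yes _ = refl
    ... | yes _ | no  _ = refl
    ... | no  _ | yes _ = refl
    ... | no  _ | no  _ = refl

  card-∖∩ : ∀ A B → ∣ A ∖ B ∣ + ∣ A ∩ B ∣ ≡ ∣ A ∣
  card-∖∩ A B = trans (sym (∑-distrib-+ (χ (A ∖ B)) (χ (A ∩ B)))) (sum-cong-≗ pt)
    where
    pt : ∀ x → χ (A ∖ B) x + χ (A ∩ B) x ≡ χ A x
    pt x with dec A x | dec B x
    ... | yes _ | yes _ = refl
    ... | yes _ | no  _ = refl
    ... | no  _ | yes _ = refl
    ... | no  _ | no  _ = refl

  card>0 : ∀ A {x} → x ∈ A → 1 ≤ ∣ A ∣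
  card>0 A {x} x∈A = ≤-trans (≤-reflexive (sym (χ-in A x∈A))) (sum-term (χ A) x)

  card-inhabited : ∀ A → 1 ≤ ∣ A ∣ → ∃ λ x → x ∈ A
  card-inhabited A p with any? (dec A)
  ... | yes w = w
  ... | no ¬w = ⊥-elim (n≮0 (≤-trans p (≤-trans (sum-mono (λ x → ≤-reflexive (χ-out A (λ q → ¬w (x , q)))))
                   (≤-reflexive (trans (sum-const N 0) (*-zeroʳ N))))))

  Disjoint : Sub → Sub → Set
  Disjoint A B = ∀ {x} → x ∈ A → x ∈ B → ⊥

  card-disjoint : ∀ A B D → Disjoint A B → A ⊆ D → B ⊆ D → ∣ A ∣ + ∣ B ∣ ≤ ∣ D ∣
  card-disjoint A B D dis A⊆D B⊆D = begin
    ∣ A ∣ + ∣ B ∣               ≡⟨ sym (∑-distrib-+ (χ A) (χ B)) ⟩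
    sum (λ x → χ A x + χ B x)   ≤⟨ sum-mono pt ⟩
    ∣ D ∣                       ∎
    where
    open ≤-Reasoning
    pt : ∀ x → χ A x + χ B x ≤ χ D x
    pt x with dec A x | dec B x
    ... | yes p | yes q = ⊥-elim (dis p q)
    ... | yes p | no  _ = ≤-reflexive (sym (χ-in D (A⊆D p)))
    ... | no  _ | yes q = ≤-reflexive (sym (χ-in D (B⊆D q)))
    ... | no  _ | no  _ = z≤n

  card-∪≤ : ∀ A B D → (∀ {x} → x ∈ D → x ∈ A ⊎ x ∈ B) → ∣ D ∣ ≤ ∣ A ∣ + ∣ B ∣
  card-∪≤ A B D cover = begin
    ∣ D ∣                  ≤⟨ card-mono D (A ∪ B) cover ⟩
    ∣ A ∪ B ∣              ≤⟨ m≤m+n _ _ ⟩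
    ∣ A ∪ B ∣ + ∣ A ∩ B ∣  ≡⟨ card-∪∩ A B ⟩
    ∣ A ∣ + ∣ B ∣          ∎
    where open ≤-Reasoning

  card-strict : ∀ A B {x} → A ⊆ B → x ∈ B → x ∉ A → ∣ A ∣ < ∣ B ∣
  card-strict A B {x} A⊆B x∈B x∉A = begin
    1 + ∣ A ∣           ≤⟨ +-monoˡ-≤ ∣ A ∣ (card>0 (sg x) refl) ⟩
    ∣ sg x ∣ + ∣ A ∣    ≤⟨ card-disjoint (sg x) A B (λ { refl q → x∉A q }) (λ { refl → x∈B }) A⊆B ⟩
    ∣ B ∣               ∎
    where open ≤-Reasoning

  card-⊇ : ∀ A B → A ⊆ B → ∣ B ∣ ≤ ∣ A ∣ → B ⊆ A
  card-⊇ A B A⊆B B≤A {x} x∈B =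
    decidable-stable (dec A x) (λ x∉A → n≮n _ (≤-trans (card-strict A B A⊆B x∈B x∉A) B≤A))

  pigeonhole : ∀ A B D → A ⊆ D → B ⊆ D → ∣ D ∣ < ∣ A ∣ + ∣ B ∣ → ∃ λ x → x ∈ A × x ∈ B
  pigeonhole A B D A⊆D B⊆D lt with any? (λ x → dec A x ×-dec dec B x)
  ... | yes w = w
  ... | no ¬w = ⊥-elim (n≮n _ (≤-trans lt (card-disjoint A B D (λ p q → ¬w (_ , p , q)) A⊆D B⊆D)))

  card≤N : ∀ A → ∣ A ∣ ≤ N
  card≤N A = ≤-trans (sum-mono (χ≤1 A)) (≤-reflexive (trans (sum-const N 1) (*-identityʳ N)))

  full : Sub
  full = sub (λ x → x ≡ x) (λ x → yes refl)

  card-full : ∣ full ∣ ≡ N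
  card-full = trans (sum-const N 1) (*-identityʳ N)

  x-g∙g : ∀ x g → (x - g) ∙ g ≡ x
  x-g∙g = group 2 (λ x g → (x ⊟ g) ⊞ g ⊜ x) refl

  x∙g-g : ∀ x g → x ∙ g - g ≡ x
  x∙g-g = group 2 (λ x g → x ⊞ g ⊟ g ⊜ x) refl

  sum-shift : ∀ (f : G → ℕ) g → sum (λ x → f (x - g)) ≡ sum f
  sum-shift f g = sum-reindex f (_- g) (_∙ g) (λ x → x∙g-g x g) (λ x → x-g∙g x g)

  sum-flip : ∀ (f : G → ℕ) g → sum (λ x → f (g - x)) ≡ sum f
  sum-flip f g = sum-reindex f (g -_) (g -_) flip flip
    where
    flip : ∀ x → g - (g - x) ≡ x
    flip = group 2 (λ g x → g ⊟ (g ⊟ x) ⊜ x) refl g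

  card-⊹ : ∀ A g → ∣ A ⊹ g ∣ ≡ ∣ A ∣
  card-⊹ A g = sum-shift (χ A) g

  card-⊖ : ∀ A → ∣ ⊖ A ∣ ≡ ∣ A ∣
  card-⊖ A = sum-reindex (χ A) _⁻¹ _⁻¹ ⁻¹-involutive ⁻¹-involutive

  ⊹-in : ∀ A g {x} → x ∈ A → x ∙ g ∈ A ⊹ g
  ⊹-in A g {x} = resp A (sym (x∙g-g x g))

  ⊕-in : ∀ A B {a b x} → a ∈ A → b ∈ B → a ∙ b ≡ x → x ∈ A ⊕ B
  ⊕-in A B {a} {b} a∈A b∈B refl = a , a∈A , resp B (lem a b) b∈B
    where
    lem : ∀ a b → b ≡ a ∙ b - a
    lem = group 2 (λ a b → b ⊜ a ⊞ b ⊟ a) refl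

  ⊕-out : ∀ A B {x} → x ∈ A ⊕ B → ∃ λ a → ∃ λ b → a ∈ A × b ∈ B × a ∙ b ≡ x
  ⊕-out A B {x} (a , a∈A , q) = a , x - a , a∈A , q , lem a x
    where
    lem : ∀ a x → a ∙ (x - a) ≡ x
    lem = group 2 (λ a x → a ⊞ (x ⊟ a) ⊜ x) refl

  ⊕-mono : ∀ A B C D → A ⊆ C → B ⊆ D → A ⊕ B ⊆ C ⊕ D
  ⊕-mono A B C D f g (a , p , q) = a , f p , g q

  ⊕-comm : ∀ A B → A ⊕ B ⊆ B ⊕ A
  ⊕-comm A B x∈ with ⊕-out A B x∈
  ... | a , b , p , q , eq = ⊕-in B A q p (trans (comm b a) eq)

  ⊕-assoc : ∀ A B C → (A ⊕ B) ⊕ C ⊆ A ⊕ (B ⊕ C)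
  ⊕-assoc A B C x∈ with ⊕-out (A ⊕ B) C x∈
  ... | y , c , p , q , eq with ⊕-out A B p
  ... | a , b , r , s , refl = ⊕-in A (B ⊕ C) r (⊕-in B C s q refl) (trans (sym (assoc a b c)) eq)

  ⊕-assoc⁻ : ∀ A B C → A ⊕ (B ⊕ C) ⊆ (A ⊕ B) ⊕ C
  ⊕-assoc⁻ A B C x∈ with ⊕-out A (B ⊕ C) x∈
  ... | a , y , p , q , eq with ⊕-out B C q
  ... | b , c , r , s , refl = ⊕-in (A ⊕ B) C (⊕-in A B p r refl) s (trans (assoc a b c) eq)

  record Sg : Set₁ where
    field
      set : Sub
      ε∈  : ε ∈ set
      ∙∈  : ∀ {x y} → x ∈ set → y ∈ set → x ∙ y ∈ set
      ⁻¹∈ : ∀ {x} → x ∈ set → x ⁻¹ ∈ set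

    -∈ : ∀ {x y} → x ∈ set → y ∈ set → x - y ∈ set
    -∈ p q = ∙∈ p (⁻¹∈ q)

    flip∈ : ∀ {x y} → x - y ∈ set → y - x ∈ set
    flip∈ {x} {y} p = resp set (lem x y) (⁻¹∈ p)
      where
      lem : ∀ x y → (x - y) ⁻¹ ≡ y - x
      lem = group 2 (λ x y → inv (x ⊟ y) ⊜ y ⊟ x) refl

    trans∈ : ∀ {x y z} → x - y ∈ set → y - z ∈ set → x - z ∈ set
    trans∈ {x} {y} {z} p q = resp set (lem x y z) (∙∈ p q)
      where
      lem : ∀ x y z → (x - y) ∙ (y - z) ≡ x - z
      lem = group 3 (λ x y z → (x ⊟ y) ⊞ (y ⊟ z) ⊜ x ⊟ z) refl

    refl∈ : ∀ {x} → x - x ∈ set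
    refl∈ {x} = resp set (sym (inverseʳ x)) ε∈

    add∈ : ∀ {x y x′ y′} → x - y ∈ set → x′ - y′ ∈ set → (x ∙ x′) - (y ∙ y′) ∈ set
    add∈ {x} {y} {x′} {y′} p q = resp set (lem x y x′ y′) (∙∈ p q)
      where
      lem : ∀ x y x′ y′ → (x - y) ∙ (x′ - y′) ≡ x ∙ x′ - y ∙ y′
      lem = group 4 (λ x y x′ y′ → (x ⊟ y) ⊞ (x′ ⊟ y′) ⊜ x ⊞ x′ ⊟ y ⊞ y′) refl

    ·∈ : ∀ {x} i → x ∈ set → i · x ∈ set
    ·∈ zero    p = ε∈
    ·∈ (suc i) p = ∙∈ p (·∈ i p)
  open Sg public

  -- In a finite group closure under the operation already gives inverses: A + x ⊆ A forces A + x = A.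
  mkSg : (A : Sub) → ε ∈ A → (∀ {x y} → x ∈ A → y ∈ A → x ∙ y ∈ A) → Sg
  mkSg A ε∈A ∙∈A = record
    { set = A
    ; ε∈  = ε∈A
    ; ∙∈  = ∙∈A
    ; ⁻¹∈ = λ {x} x∈A → resp A (identityˡ (x ⁻¹))
        (card-⊇ (A ⊹ x) A (λ {y} q → resp A (x-g∙g y x) (∙∈A q x∈A)) (≤-reflexive (sym (card-⊹ A x))) ε∈A)
    }

  Per : Sg → Sub → Set
  Per H A = ∀ {x h} → x ∈ A → h ∈ set H → x ∙ h ∈ A

  per-~ : ∀ H A → Per H A → ∀ {x y} → x ∈ A → y - x ∈ set H → y ∈ A
  per-~ H A pA {x} {y} x∈A q = resp A (lem x y) (pA x∈A q)
    where
    lem : ∀ x y → x ∙ (y - x) ≡ y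
    lem = group 2 (λ x y → x ⊞ (y ⊟ x) ⊜ y) refl

  stab : Sub → Sg
  stab C = mkSg (sub (λ h → ∀ x → x ∈ C → x ∙ h ∈ C) (λ h → all? (λ x → dec C x →-dec dec C (x ∙ h))))
    (λ x p → resp C (sym (identityʳ x)) p)
    (λ {g} {h} p q x r → resp C (assoc x g h) (q (x ∙ g) (p x r)))

  stab-per : ∀ C → Per (stab C) C
  stab-per C x∈C h∈ = h∈ _ x∈C

  per-stab : ∀ H C → Per H C → set H ⊆ set (stab C)
  per-stab H C pC h∈H x x∈C = pC x∈C h∈H

  not-per : ∀ H C → ¬ (set H ⊆ set (stab C)) → ∃ λ x → ∃ λ h → x ∈ C × h ∈ set H × x ∙ h ∉ C
  not-per H C ¬p with ⊈-witness (set H) (set (stab C)) ¬p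
  ... | h , h∈H , ¬q with ⊈-witness C (sub (λ x → x ∙ h ∈ C) (λ x → dec C (x ∙ h))) (λ f → ¬q (λ x → f))
  ... | x , x∈C , r = x , h , x∈C , h∈H , r

  per-⊕ : ∀ H A → Per H (A ⊕ set H)
  per-⊕ H A {x} {h} x∈ h∈ with ⊕-out A (set H) x∈
  ... | a , k , p , q , refl = ⊕-in A (set H) p (∙∈ H q h∈) (sym (assoc a k h))

  ⊆-⊕ : ∀ H A → A ⊆ A ⊕ set H
  ⊆-⊕ H A {x} p = ⊕-in A (set H) p (ε∈ H) (identityʳ x)

  per-⊕-⊆ : ∀ H A → Per H A → A ⊕ set H ⊆ A
  per-⊕-⊆ H A pA x∈ with ⊕-out A (set H) x∈
  ... | a , k , p , q , refl = pA p q

  per-sum : ∀ H A B → Per H B → Per H (A ⊕ B)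
  per-sum H A B pB {x} {h} x∈ h∈ with ⊕-out A B x∈
  ... | a , b , p , q , refl = ⊕-in A B p (pB q h∈) (sym (assoc a b h))

  per-sumˡ : ∀ H A B → Per H A → Per H (A ⊕ B)
  per-sumˡ H A B pA {x} {h} x∈ h∈ = ⊕-comm B A (per-sum H B A pA (⊕-comm A B x∈) h∈)

  per-∪ : ∀ H A B → Per H A → Per H B → Per H (A ∪ B)
  per-∪ H A B pA pB (inj₁ p) q = inj₁ (pA p q)
  per-∪ H A B pA pB (inj₂ p) q = inj₂ (pB p q)

  per-∩ : ∀ H A B → Per H A → Per H B → Per H (A ∩ B)
  per-∩ H A B pA pB (p , p′) q = pA p q , pB p′ q

  per-∖ : ∀ H A B → Per H A → Per H B → Per H (A ∖ B)
  per-∖ H A B pA pB {x} {h} (p , p′) q =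
    pA p q , λ r → p′ (resp B (x∙g-g x h) (pB r (⁻¹∈ H q)))

  per-⊹ : ∀ H A g → Per H A → Per H (A ⊹ g)
  per-⊹ H A g pA {x} {h} p q = resp A (lem x g h) (pA p q)
    where
    lem : ∀ x g h → (x - g) ∙ h ≡ x ∙ h - g
    lem = group 3 (λ x g h → (x ⊟ g) ⊞ h ⊜ x ⊞ h ⊟ g) refl

  per-⊖ : ∀ H A → Per H A → Per H (⊖ A)
  per-⊖ H A pA {x} {h} p q = resp A (⁻¹-∙-comm x h) (pA p (⁻¹∈ H q))

  per-weaken : ∀ H K A → set H ⊆ set K → Per K A → Per H A
  per-weaken H K A H⊆K pA p q = pA p (H⊆K q)

  per-self : ∀ H K → set H ⊆ set K → Per H (set K)
  per-self H K H⊆K p q = ∙∈ K p (H⊆K q)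

  card-⊆-⊕ : ∀ H A → ∣ A ∣ ≤ ∣ A ⊕ set H ∣
  card-⊆-⊕ H A = card-mono A (A ⊕ set H) (⊆-⊕ H A)

  cos : Sg → G → Sub
  cos H g = set H ⊹ g

  per-cos : ∀ H g → Per H (cos H g)
  per-cos H g = per-⊹ H (set H) g (∙∈ H)

  cos-⊆ : ∀ H A {x} → Per H A → x ∈ A → cos H x ⊆ A
  cos-⊆ H A pA x∈A q = per-~ H A pA x∈A q

  card-per : ∀ H A {x} → Per H A → x ∈ A → ∣ set H ∣ ≤ ∣ A ∣
  card-per H A {x} pA x∈A = ≤-trans (≤-reflexive (sym (card-⊹ (set H) x))) (card-mono (cos H x) A (cos-⊆ H A pA x∈A))

  cos-disjoint : ∀ H {x y} → x - y ∉ set H → Disjoint (cos H x) (cos H y)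
  cos-disjoint H x≁y p q = x≁y (trans∈ H (flip∈ H p) q)

  card-two : ∀ H A {x y} → Per H A → x ∈ A → y ∈ A → x - y ∉ set H → ∣ set H ∣ + ∣ set H ∣ ≤ ∣ A ∣
  card-two H A {x} {y} pA x∈A y∈A x≁y = ≤-trans
    (≤-reflexive (sym (cong₂ _+_ (card-⊹ (set H) x) (card-⊹ (set H) y))))
    (card-disjoint (cos H x) (cos H y) A (cos-disjoint H x≁y) (cos-⊆ H A pA x∈A) (cos-⊆ H A pA y∈A))

  -- Cosets are peeled off one at a time. Stated for any periodic set and not only for subgroups,
  -- this replaces counting in the quotient by `H`.
  lagrange : ∀ H A → Per H A → ∃ λ k → ∣ A ∣ ≡ k * ∣ set H ∣
  lagrange H A pA = go A pA (<-wellFounded ∣ A ∣)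
    where
    go : ∀ A → Per H A → Acc _<_ ∣ A ∣ → ∃ λ k → ∣ A ∣ ≡ k * ∣ set H ∣
    go A pA (acc rec) with any? (dec A)
    ... | no ¬w = 0 , n≤0⇒n≡0 (≮⇒≥ (λ p → ¬w (card-inhabited A p)))
    ... | yes (x , x∈A) with go (A ∖ cos H x) (per-∖ H A (cos H x) pA (per-cos H x))
            (rec (card-strict (A ∖ cos H x) A {x} proj₁ x∈A (λ q → proj₂ q (refl∈ H))))
    ...   | k , eq = suc k , (begin
      ∣ A ∣                                  ≡⟨ sym (card-∖∩ A (cos H x)) ⟩
      ∣ A ∖ cos H x ∣ + ∣ A ∩ cos H x ∣      ≡⟨ cong₂ _+_ eq (trans (card-cong (A ∩ cos H x) (cos H x) proj₂
                                                  (λ q → cos-⊆ H A pA x∈A q , q)) (card-⊹ (set H) x)) ⟩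
      k * ∣ set H ∣ + ∣ set H ∣              ≡⟨ +-comm (k * ∣ set H ∣) _ ⟩
      suc k * ∣ set H ∣                      ∎)
      where open ≡-Reasoning

  Sg>0 : ∀ H → 1 ≤ ∣ set H ∣
  Sg>0 H = card>0 (set H) (ε∈ H)

  _∩ˢ_ : Sg → Sg → Sg
  H ∩ˢ K = mkSg (set H ∩ set K) (ε∈ H , ε∈ K) (λ { (p , q) (p′ , q′) → ∙∈ H p p′ , ∙∈ K q q′ })

  ⨁ : List Sub → Sub
  ⨁ []       = sg ε
  ⨁ (A ∷ As) = A ⊕ ⨁ As

  iter : ℕ → Sub → Sub
  iter j B = ⨁ (replicate j B)

  iter-grow : ∀ B → ε ∈ B → ∀ j → iter j B ⊆ iter (suc j) B
  iter-grow B ε∈B j {x} p = ⊕-in B (iter j B) ε∈B p (identityˡ x)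

  iter-ε : ∀ B → ε ∈ B → ∀ j → ε ∈ iter j B
  iter-ε B ε∈B zero    = refl
  iter-ε B ε∈B (suc j) = iter-grow B ε∈B j (iter-ε B ε∈B j)

  iter-⊆ : ∀ H B → B ⊆ set H → ∀ j → iter j B ⊆ set H
  iter-⊆ H B B⊆H zero    refl = ε∈ H
  iter-⊆ H B B⊆H (suc j) p with ⊕-out B (iter j B) p
  ... | b , y , q , r , refl = ∙∈ H (B⊆H q) (iter-⊆ H B B⊆H j r)

  -- Every strict step of the increasing chain of multiples adds an element, so the deficit to `N`
  -- decreases.
  iter-stable : ∀ B → ε ∈ B → ∃ λ j → iter (suc j) B ⊆ iter j B
  iter-stable B ε∈B = go 0 (<-wellFounded _)
    where
    go : ∀ j → Acc _<_ (N ∸ ∣ iter j B ∣) → ∃ λ j → iter (suc j) B ⊆ iter j B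
    go j (acc rec) with ⊆-dec (iter (suc j) B) (iter j B)
    ... | yes p = j , λ {x} → p x
    ... | no ¬p with ⊈-witness (iter (suc j) B) (iter j B) (λ f → ¬p (λ x → f))
    ...   | x , q , r = go (suc j) (rec (∸-monoʳ-< (card-strict (iter j B) (iter (suc j) B) (iter-grow B ε∈B j) q r)
                          (card≤N (iter (suc j) B))))

  abstract
    -- Since `B` contains `ε`, its multiples form a chain, and adding elements of `B` to a stable
    -- member does not leave it; closure under addition follows by induction on the number of
    -- summands.
    gen : ∀ B → ε ∈ B → Sg
    gen B ε∈B with iter-stable B ε∈B
    ... | j , st = mkSg (iter j B) (iter-ε B ε∈B j) (λ {x} {y} → cl j {x} {y})
      where
      cl : ∀ i {x y} → x ∈ iter i B → y ∈ iter j B → x ∙ y ∈ iter j B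
      cl zero    {y = y} refl q = resp (iter j B) (sym (identityˡ y)) q
      cl (suc i) {y = y} p    q with ⊕-out B (iter i B) p
      ... | b , z , r , s , refl = st (⊕-in B (iter j B) r (cl i s q) (sym (assoc b z y)))

    gen-⊇ : ∀ B (ε∈B : ε ∈ B) → B ⊆ set (gen B ε∈B)
    gen-⊇ B ε∈B {x} p with iter-stable B ε∈B
    ... | j , st = st (⊕-in B (iter j B) p (iter-ε B ε∈B j) (identityʳ x))

    gen-ind : ∀ B (ε∈B : ε ∈ B) (Q : G → Set) → Q ε → (∀ {b y} → b ∈ B → Q y → Q (b ∙ y)) →
      ∀ {x} → x ∈ set (gen B ε∈B) → Q x
    gen-ind B ε∈B Q Qε Q∙ p with iter-stable B ε∈B
    ... | j , st = go j p
      where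
      go : ∀ i {x} → x ∈ iter i B → Q x
      go zero    refl = Qε
      go (suc i) p with ⊕-out B (iter i B) p
      ... | b , z , r , s , refl = Q∙ r (go i s)

  gen-least : ∀ B (ε∈B : ε ∈ B) H → B ⊆ set H → set (gen B ε∈B) ⊆ set H
  gen-least B ε∈B H B⊆H = gen-ind B ε∈B (P (set H)) (ε∈ H) (λ p q → ∙∈ H (B⊆H p) q)

-- Kneser's theorem by unions of periodic sets.

module Kneser {N : ℕ} (𝔾 : FinAb N) where
  open Sets 𝔾

  -- Double counting of pairs by their sum `y`: the first summands that occur for one `y` differ by
  -- elements of `I`, so there are at most |I| of them.
  rep-count : ∀ A B I → (∀ {y a a′} → a ∈ A → y - a ∈ B → a′ ∈ A → y - a′ ∈ B → a - a′ ∈ I) →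
    ∣ A ∣ * ∣ B ∣ ≤ ∣ A ⊕ B ∣ * ∣ I ∣
  rep-count A B I fib = begin
    ∣ A ∣ * ∣ B ∣                              ≡⟨ *-comm ∣ A ∣ ∣ B ∣ ⟩
    ∣ B ∣ * ∣ A ∣                              ≡⟨ *-distribˡ-sum ∣ B ∣ (χ A) ⟩
    sum (λ a → ∣ B ∣ * χ A a)                  ≡⟨ sum-cong-≗ (λ a → trans (*-comm ∣ B ∣ (χ A a))
                                                   (cong (χ A a *_) (sym (sum-shift (χ B) a)))) ⟩
    sum (λ a → χ A a * sum (λ y → χ B (y - a))) ≡⟨ sum-cong-≗ (λ a → *-distribˡ-sum (χ A a) (λ y → χ B (y - a))) ⟩
    sum (λ a → sum (λ y → r y a))              ≡⟨ ∑-comm (λ a y → r y a) ⟩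
    sum (λ y → sum (λ a → r y a))              ≤⟨ sum-mono fibre ⟩
    sum (λ y → ∣ I ∣ * χ (A ⊕ B) y)            ≡⟨ sym (*-distribˡ-sum ∣ I ∣ (χ (A ⊕ B))) ⟩
    ∣ I ∣ * ∣ A ⊕ B ∣                          ≡⟨ *-comm ∣ I ∣ ∣ A ⊕ B ∣ ⟩
    ∣ A ⊕ B ∣ * ∣ I ∣                          ∎
    where
    open ≤-Reasoning
    r : G → G → ℕ
    r y a = χ A a * χ B (y - a)
    fibre : ∀ y → sum (λ a → r y a) ≤ ∣ I ∣ * χ (A ⊕ B) y
    fibre y with dec (A ⊕ B) y
    ... | no y∉ = ≤-trans (sum-mono pt) (≤-trans (≤-reflexive (trans (sum-const N 0) (*-zeroʳ N))) z≤n)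
      where
      pt : ∀ a → r y a ≤ 0
      pt a with dec A a | dec B (y - a)
      ... | no _   | _     = z≤n
      ... | yes _  | no _  = z≤n
      ... | yes p  | yes q = ⊥-elim (y∉ (a , p , q))
    ... | yes (a₀ , p₀ , q₀) = ≤-trans (sum-mono pt)
            (≤-trans (≤-reflexive (sum-shift (χ I) a₀)) (≤-reflexive (sym (*-identityʳ ∣ I ∣))))
      where
      pt : ∀ a → r y a ≤ χ I (a - a₀)
      pt a with dec A a | dec B (y - a)
      ... | no _   | _     = z≤n
      ... | yes _  | no _  = z≤n
      ... | yes p  | yes q = ≤-reflexive (sym (χ-in I (fib p q p₀ q₀)))

  -- The product equals (i + α + β)i + αβ. In units of i: a rectangle with sides p and q has at
  -- least p + q - 1 cells.
  grid-cancel : ∀ i α β d → 1 ≤ i → (i + α) * (i + β) ≤ d * i → i + α + β ≤ d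
  grid-cancel i α β d 1≤i h = *-cancelʳ-≤ (i + α + β) d i {{>-nonZero 1≤i}}
    (≤-trans (m≤m+n _ (α * β)) (≤-trans (≤-reflexive (eq i α β)) h))
    where
    eq : ∀ i α β → (i + α + β) * i + α * β ≡ (i + α) * (i + β)
    eq = solve-∀

  -- If `a′` and `b′` are both nonzero, `grid-cancel` for the two rectangles makes d₁ + d₂ too large
  -- for the two strict bounds. A vanishing `b′` is impossible as well, and a vanishing `a′` yields
  -- the conclusion at once.
  grid-arith : ∀ a b a′ b′ i d₁ d₂ → 1 ≤ i → a * b ≤ d₂ * i → a′ * b′ ≤ d₁ * i → i ≤ a → i ≤ b →
    a′ ≡ 0 ⊎ i ≤ a′ → b′ ≡ 0 ⊎ i ≤ b′ → d₂ + i < b + b′ → d₁ + i < a + a′ → a + a′ < b + b′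
  grid-arith a b .0 b′ i d₁ d₂ 1≤i h₁ h₂ i≤a i≤b (inj₁ refl) _ l₂ l₁ =
    ≤-<-trans (≤-reflexive (+-identityʳ a)) (≤-<-trans a≤d₂ (≤-<-trans (m≤m+n d₂ i) l₂))
    where
    a≤d₂ : a ≤ d₂
    a≤d₂ = *-cancelʳ-≤ a d₂ i {{>-nonZero 1≤i}} (≤-trans (*-monoʳ-≤ a i≤b) h₁)
  grid-arith a b a′ .0 i d₁ d₂ 1≤i h₁ h₂ i≤a i≤b (inj₂ _) (inj₁ refl) l₂ l₁ =
    ⊥-elim (n≮n b (≤-<-trans b≤d₂ (≤-<-trans (m≤m+n d₂ i) (≤-trans l₂ (≤-reflexive (+-identityʳ b))))))
    where
    b≤d₂ : b ≤ d₂
    b≤d₂ = *-cancelʳ-≤ b d₂ i {{>-nonZero 1≤i}} (≤-trans (≤-reflexive (*-comm b i)) (≤-trans (*-monoˡ-≤ b i≤a) h₁))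
  grid-arith a b a′ b′ i d₁ d₂ 1≤i h₁ h₂ i≤a i≤b (inj₂ i≤a′) (inj₂ i≤b′) l₂ l₁
    with m≤n⇒∃[o]m+o≡n i≤a | m≤n⇒∃[o]m+o≡n i≤b | m≤n⇒∃[o]m+o≡n i≤a′ | m≤n⇒∃[o]m+o≡n i≤b′
  ... | α , refl | β , refl | α′ , refl | β′ , refl =
    ⊥-elim (lin⊥ 1 (grid-cancel i α β d₂ 1≤i h₁ ⊕≤ grid-cancel i α′ β′ d₁ 1≤i h₂ ⊕≤ l₂ ⊕≤ l₁) (eq i α β α′ β′ d₁ d₂))
    where
    eq : ∀ i α β α′ β′ d₁ d₂ → d₂ + d₁ + (i + β + (i + β′)) + (i + α + (i + α′)) + 2 ≡
      (i + α + β) + (i + α′ + β′) + suc (d₂ + i) + suc (d₁ + i)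
    eq = solve-∀

  -- In the coset x + H₁ + H₂ the cosets of `I` form a grid: `C₁` is a union of rows, indexed by
  -- `H₂`, and `C₂` a union of columns, indexed by `H₁`. `A` holds the rows missed by `C₁` and `B`
  -- the columns inside `C₂`, so A + B lands in `C₂` outside `C₁`; the complementary rows `A′` and
  -- columns `B′` land in `C₁` outside `C₂`.
  module Grid (H₁ H₂ : Sg) (C₁ C₂ : Sub) (per₁ : Per H₁ C₁) (per₂ : Per H₂ C₂) {x : G} (x∈₂ : x ∈ C₂) (x∉₁ : x ∉ C₁) where
    I : Sg
    I = H₁ ∩ˢ H₂

    out₁ in₂ A B A′ B′ : Sub
    out₁ = sub (λ h → x ∙ h ∉ C₁) (λ h → ¬? (dec C₁ (x ∙ h)))
    in₂  = sub (λ h → x ∙ h ∈ C₂) (λ h → dec C₂ (x ∙ h))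
    A  = set H₂ ∩ out₁
    B  = set H₁ ∩ in₂
    A′ = set H₂ ∖ out₁
    B′ = set H₁ ∖ in₂

    per-out₁ : Per H₁ out₁
    per-out₁ {y} {h} p q r = p (resp C₁ (lem x y h) (per₁ r (⁻¹∈ H₁ q)))
      where
      lem : ∀ x y h → x ∙ (y ∙ h) ∙ h ⁻¹ ≡ x ∙ y
      lem = group 3 (λ x y h → x ⊞ (y ⊞ h) ⊞ inv h ⊜ x ⊞ y) refl

    per-in₂ : Per H₂ in₂
    per-in₂ {y} {h} p q = resp C₂ (assoc x y h) (per₂ p q)

    i≤ : ∀ S {y} → Per I S → y ∈ S → ∣ set I ∣ ≤ ∣ S ∣
    i≤ S = card-per I S

    0-or : ∀ S → Per I S → ∣ S ∣ ≡ 0 ⊎ ∣ set I ∣ ≤ ∣ S ∣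
    0-or S pS with any? (dec S)
    ... | yes (y , y∈S) = inj₂ (card-per I S pS y∈S)
    ... | no ¬w = inj₁ (n≤0⇒n≡0 (≮⇒≥ (λ p → ¬w (card-inhabited S p))))

    perA : Per I A
    perA (p , p′) (q , q′) = ∙∈ H₂ p q′ , per-out₁ p′ q

    perB : Per I B
    perB (p , p′) (q , q′) = ∙∈ H₁ p q , per-in₂ p′ q′

    perA′ : Per I A′
    perA′ = per-∖ I (set H₂) out₁ (λ p q → ∙∈ H₂ p (proj₂ q)) (per-weaken I H₁ out₁ proj₁ per-out₁)

    perB′ : Per I B′
    perB′ = per-∖ I (set H₁) in₂ (λ p q → ∙∈ H₁ p (proj₁ q)) (per-weaken I H₂ in₂ proj₂ per-in₂)

    fib : ∀ S T → S ⊆ set H₂ → T ⊆ set H₁ →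
      ∀ {y a a′} → a ∈ S → y - a ∈ T → a′ ∈ S → y - a′ ∈ T → a - a′ ∈ set I
    fib S T f g {y} {a} {a′} p q p′ q′ =
      resp (set H₁) (lem y a a′) (-∈ H₁ (g q′) (g q)) , -∈ H₂ (f p) (f p′)
      where
      lem : ∀ y a a′ → (y - a′) - (y - a) ≡ a - a′
      lem = group 3 (λ y a a′ → (y ⊟ a′) ⊟ (y ⊟ a) ⊜ a ⊟ a′) refl

    sub₂ : (A ⊕ B) ⊹ x ⊆ C₂ ∖ C₁
    sub₂ {z} p with ⊕-out A B p
    ... | a , b , (a∈₂ , a∉) , (b∈₁ , b∈) , eq =
      resp C₂ (trans (lem′ x a b) (trans (∙ˡ eq) (lem x z))) (per₂ b∈ a∈₂) ,
      λ r → per-out₁ {a} {b} a∉ b∈₁ (resp C₁ (sym (trans (∙ˡ eq) (lem x z))) r)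
      where
      lem : ∀ x z → x ∙ (z - x) ≡ z
      lem = group 2 (λ x z → x ⊞ (z ⊟ x) ⊜ z) refl
      lem′ : ∀ x a b → x ∙ b ∙ a ≡ x ∙ (a ∙ b)
      lem′ = group 3 (λ x a b → x ⊞ b ⊞ a ⊜ x ⊞ (a ⊞ b)) refl

    sub₁ : (A′ ⊕ B′) ⊹ x ⊆ C₁ ∖ C₂
    sub₁ {z} p with ⊕-out A′ B′ p
    ... | a , b , (a∈₂ , a∉) , (b∈₁ , b∉) , eq =
      resp C₁ (trans (assoc x a b) (trans (∙ˡ eq) (lem x z))) (per₁ (decidable-stable (dec C₁ (x ∙ a)) a∉) b∈₁) ,
      λ r → b∉ (resp C₂ (lem′ x a b) (per₂ (resp C₂ (sym (trans (∙ˡ eq) (lem x z))) r) (⁻¹∈ H₂ a∈₂)))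
      where
      lem : ∀ x z → x ∙ (z - x) ≡ z
      lem = group 2 (λ x z → x ⊞ (z ⊟ x) ⊜ z) refl
      lem′ : ∀ x a b → x ∙ (a ∙ b) ∙ a ⁻¹ ≡ x ∙ b
      lem′ = group 3 (λ x a b → x ⊞ (a ⊞ b) ⊞ inv a ⊜ x ⊞ b) refl

    count : ∀ S T C → S ⊆ set H₂ → T ⊆ set H₁ → (S ⊕ T) ⊹ x ⊆ C → ∣ S ∣ * ∣ T ∣ ≤ ∣ C ∣ * ∣ set I ∣
    count S T C f g h = ≤-trans (rep-count S T (set I) (fib S T f g)) (*-monoˡ-≤ ∣ set I ∣
      (≤-trans (≤-reflexive (sym (card-⊹ (S ⊕ T) x))) (card-mono ((S ⊕ T) ⊹ x) C h)))

    ε∈A : ε ∈ A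
    ε∈A = ε∈ H₂ , λ r → x∉₁ (resp C₁ (identityʳ x) r)

    ε∈B : ε ∈ B
    ε∈B = ε∈ H₁ , resp C₂ (sym (identityʳ x)) x∈₂

    splitA : ∣ A ∣ + ∣ A′ ∣ ≡ ∣ set H₂ ∣
    splitA = trans (+-comm ∣ A ∣ ∣ A′ ∣) (card-∖∩ (set H₂) out₁)

    splitB : ∣ B ∣ + ∣ B′ ∣ ≡ ∣ set H₁ ∣
    splitB = trans (+-comm ∣ B ∣ ∣ B′ ∣) (card-∖∩ (set H₁) in₂)

    -- Two incomparable sets admit this comparison from either side, with opposite conclusions; that
    -- clash is the heart of `∪-good`.
    compare : ∣ C₂ ∖ C₁ ∣ + ∣ set I ∣ < ∣ set H₁ ∣ → ∣ C₁ ∖ C₂ ∣ + ∣ set I ∣ < ∣ set H₂ ∣ → ∣ set H₂ ∣ < ∣ set H₁ ∣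
    compare l₂ l₁ = subst₂ _<_ splitA splitB
      (grid-arith (∣ A ∣) (∣ B ∣) (∣ A′ ∣) (∣ B′ ∣) (∣ set I ∣) (∣ C₁ ∖ C₂ ∣) (∣ C₂ ∖ C₁ ∣) (Sg>0 I)
        (count A B (C₂ ∖ C₁) proj₁ proj₁ sub₂) (count A′ B′ (C₁ ∖ C₂) proj₁ proj₁ sub₁)
        (i≤ A perA ε∈A) (i≤ B perB ε∈B) (0-or A′ perA′) (0-or B′ perB′)
        (<-≤-trans l₂ (≤-reflexive (sym splitB))) (<-≤-trans l₁ (≤-reflexive (sym splitA))))

  -- `H` is any group of periods and not the exact stabiliser, so a union only has to exhibit a
  -- common group of periods.
  Good : ℕ → Sub → Set₁
  Good k C = Σ Sg λ H → Per H C × k ≤ ∣ C ∣ + ∣ set H ∣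

  ∪-absorb : ∀ k C₁ C₂ → C₁ ⊆ C₂ → Good k C₂ → Good k (C₁ ∪ C₂)
  ∪-absorb k C₁ C₂ f (H , p , q) = H ,
    (λ { (inj₁ r) s → inj₂ (p (f r) s) ; (inj₂ r) s → inj₂ (p r s) }) ,
    ≤-trans q (+-monoˡ-≤ _ (card-mono C₂ (C₁ ∪ C₂) inj₂))

  -- If the union with periods `H₁ ∩ˢ H₂` falls short of k, both differences are small, because each
  -- of the two sets reaches k with its own subgroup. `compare` then gives |H₂| < |H₁| and also |H₁|
  -- < |H₂|.
  ∪-good : ∀ k C₁ C₂ → Good k C₁ → Good k C₂ → Good k (C₁ ∪ C₂)
  ∪-good k C₁ C₂ g₁@(H₁ , p₁ , q₁) g₂@(H₂ , p₂ , q₂) with ⊆-dec C₁ C₂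
  ... | yes f = ∪-absorb k C₁ C₂ (λ {x} → f x) g₂
  ... | no ¬f with ⊆-dec C₂ C₁
  ...   | yes f with ∪-absorb k C₂ C₁ (λ {x} → f x) g₁
  ...     | H , p , q = H , (λ { (inj₁ r) s → swap (p (inj₂ r) s) ; (inj₂ r) s → swap (p (inj₁ r) s) }) ,
            ≤-trans q (+-monoˡ-≤ _ (card-mono (C₂ ∪ C₁) (C₁ ∪ C₂) swap))
  ∪-good k C₁ C₂ g₁@(H₁ , p₁ , q₁) g₂@(H₂ , p₂ , q₂) | no ¬f | no ¬f′ with k ≤? ∣ C₁ ∪ C₂ ∣ + ∣ set (H₁ ∩ˢ H₂) ∣
  ... | yes p = (H₁ ∩ˢ H₂) ,
        per-∪ (H₁ ∩ˢ H₂) C₁ C₂ (per-weaken (H₁ ∩ˢ H₂) H₁ C₁ proj₁ p₁) (per-weaken (H₁ ∩ˢ H₂) H₂ C₂ proj₂ p₂) , p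
  ... | no ¬p with ⊈-witness C₁ C₂ (λ f → ¬f (λ x → f)) | ⊈-witness C₂ C₁ (λ f → ¬f′ (λ x → f))
  ...   | y , y∈ , y∉ | x , x∈ , x∉ = ⊥-elim (<-asym
    (Grid.compare H₁ H₂ C₁ C₂ p₁ p₂ x∈ x∉ l₂ l₁)
    (Grid.compare H₂ H₁ C₂ C₁ p₂ p₁ y∈ y∉ (subst (λ t → ∣ C₁ ∖ C₂ ∣ + t < ∣ set H₂ ∣) i≡ l₁) (subst (λ t → ∣ C₂ ∖ C₁ ∣ + t < ∣ set H₁ ∣) i≡ l₂)))
    where
    i≡ : ∣ set (H₁ ∩ˢ H₂) ∣ ≡ ∣ set (H₂ ∩ˢ H₁) ∣
    i≡ = card-cong (set (H₁ ∩ˢ H₂)) (set (H₂ ∩ˢ H₁)) (λ { (a , b) → b , a }) (λ { (a , b) → b , a })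
    ar : ∀ c c₁ d i h k → c₁ + d ≤ c → k ≤ c₁ + h → c + i < k → d + i < h
    ar c c₁ d i h k h₁ h₂ h₃ = lin≤ 0 (h₁ ⊕≤ h₂ ⊕≤ h₃) (eq c c₁ d i h k)
      where
      eq : ∀ c c₁ d i h k → suc (d + i) + (c + (c₁ + h) + k) + 0 ≡ h + (c₁ + d + k + suc (c + i))
      eq = solve-∀
    l₂ : ∣ C₂ ∖ C₁ ∣ + ∣ set (H₁ ∩ˢ H₂) ∣ < ∣ set H₁ ∣
    l₂ = ar (∣ C₁ ∪ C₂ ∣) (∣ C₁ ∣) (∣ C₂ ∖ C₁ ∣) (∣ set (H₁ ∩ˢ H₂) ∣) (∣ set H₁ ∣) k
      (card-disjoint C₁ (C₂ ∖ C₁) (C₁ ∪ C₂) (λ p q → proj₂ q p) inj₁ (λ p → inj₂ (proj₁ p))) q₁ (≰⇒> ¬p)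
    l₁ : ∣ C₁ ∖ C₂ ∣ + ∣ set (H₁ ∩ˢ H₂) ∣ < ∣ set H₂ ∣
    l₁ = ar (∣ C₁ ∪ C₂ ∣) (∣ C₂ ∣) (∣ C₁ ∖ C₂ ∣) (∣ set (H₁ ∩ˢ H₂) ∣) (∣ set H₂ ∣) k
      (card-disjoint C₂ (C₁ ∖ C₂) (C₁ ∪ C₂) (λ p q → proj₂ q p) inj₂ (λ p → inj₁ (proj₁ p))) q₂ (≰⇒> ¬p)

  -- Dyson's transform, by induction on |B|: it keeps |A| + |B|, stays inside A + B and keeps the
  -- pair a₀, b₀. When no transform shrinks `B`, all of B - b₀ stabilises `A`, and A + b₀ is good.
  dyson : ∀ A B {a₀ b₀} → a₀ ∈ A → b₀ ∈ B → Acc _<_ ∣ B ∣ →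
    Σ Sub λ C → (C ⊆ A ⊕ B) × a₀ ∙ b₀ ∈ C × Good (∣ A ∣ + ∣ B ∣) C
  dyson A B {a₀} {b₀} a₀∈ b₀∈ (acc rec)
    with any? (λ a → dec A a ×-dec any? (λ b → dec B b ×-dec ¬? (dec A (b ∙ (a - b₀)))))
  ... | no ¬w = A ⊹ b₀ , (λ {x} p → ⊕-in A B p b₀∈ (x-g∙g x b₀)) , ⊹-in A b₀ a₀∈ ,
        stab A , per-⊹ (stab A) A b₀ (stab-per A) ,
        +-mono-≤ (≤-reflexive (sym (card-⊹ A b₀))) (≤-trans (≤-reflexive (sym (card-⊹ B (b₀ ⁻¹))))
          (card-mono (B ⊹ (b₀ ⁻¹)) (set (stab A)) closed))
    where
    closed : B ⊹ (b₀ ⁻¹) ⊆ set (stab A)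
    closed {h} p a a∈ = resp A (lem a b₀ h) (decidable-stable (dec A _) (λ q → ¬w (a , a∈ , _ , p , q)))
      where
      lem : ∀ a b₀ h → (h - b₀ ⁻¹) ∙ (a - b₀) ≡ a ∙ h
      lem = group 3 (λ a b₀ h → (h ⊟ inv b₀) ⊞ (a ⊟ b₀) ⊜ a ⊞ h) refl
  ... | yes (a , a∈ , b , b∈ , b∉) = conclude (dyson A₁ B₁ (inj₁ a₀∈) b₀∈₁ (rec (card-strict B₁ B {b} proj₁ b∈ (λ r → b∉ (proj₂ r)))))
    where
    -- With e = a - b₀ the point b₀ survives in `B₁`, because b₀ + e = a lies in `A`, while b drops
    -- out.
    e : G
    e = a - b₀
    pre A₁ B₁ : Sub
    pre = sub (λ x → x ∙ e ∈ A) (λ x → dec A (x ∙ e))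
    A₁  = A ∪ (B ⊹ e)
    B₁  = B ∩ pre
    b₀∈₁ : b₀ ∈ B₁
    b₀∈₁ = b₀∈ , resp A (lem a b₀) a∈
      where
      lem : ∀ a b₀ → a ≡ b₀ ∙ (a - b₀)
      lem = group 2 (λ a b₀ → a ⊜ b₀ ⊞ (a ⊟ b₀)) refl
    cards : ∣ A₁ ∣ + ∣ B₁ ∣ ≡ ∣ A ∣ + ∣ B ∣
    cards = begin
      ∣ A₁ ∣ + ∣ B₁ ∣                ≡⟨ cong (∣ A₁ ∣ +_) (trans (sym (card-⊹ B₁ e))
                                         (card-cong (B₁ ⊹ e) (A ∩ (B ⊹ e))
                                           (λ {x} → λ { (p , q) → resp A (x-g∙g x e) q , p })
                                           (λ {x} → λ { (p , q) → q , resp A (sym (x-g∙g x e)) p }))) ⟩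
      ∣ A₁ ∣ + ∣ A ∩ (B ⊹ e) ∣       ≡⟨ card-∪∩ A (B ⊹ e) ⟩
      ∣ A ∣ + ∣ B ⊹ e ∣              ≡⟨ cong (∣ A ∣ +_) (card-⊹ B e) ⟩
      ∣ A ∣ + ∣ B ∣                  ∎
      where open ≡-Reasoning
    incl : A₁ ⊕ B₁ ⊆ A ⊕ B
    incl x∈ with ⊕-out A₁ B₁ x∈
    ... | y , z , inj₁ p , (q , r) , refl = ⊕-in A B p q refl
    ... | y , z , inj₂ p , (q , r) , refl = ⊕-in A B r p (lem y z e)
      where
      lem : ∀ y z e → z ∙ e ∙ (y - e) ≡ y ∙ z
      lem = group 3 (λ y z e → z ⊞ e ⊞ (y ⊟ e) ⊜ y ⊞ z) refl
    conclude : (Σ Sub λ C → (C ⊆ A₁ ⊕ B₁) × a₀ ∙ b₀ ∈ C × Good (∣ A₁ ∣ + ∣ B₁ ∣) C) →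
      Σ Sub λ C → (C ⊆ A ⊕ B) × a₀ ∙ b₀ ∈ C × Good (∣ A ∣ + ∣ B ∣) C
    conclude (C , C⊆ , c∈ , g) = C , (λ p → incl (C⊆ p)) , c∈ , subst (λ k → Good k C) cards g

  -- `dyson` puts every point of A + B into a good subset of A + B. Joining such subsets one by one
  -- keeps goodness and exhausts the sumset.
  kneser-good : ∀ A B {a₀ b₀} → a₀ ∈ A → b₀ ∈ B → Good (∣ A ∣ + ∣ B ∣) (A ⊕ B)
  kneser-good A B a₀∈ b₀∈ with dyson A B a₀∈ b₀∈ (<-wellFounded _)
  ... | C₀ , C₀⊆ , _ , g₀ = go C₀ C₀⊆ g₀ (<-wellFounded _)
    where
    k = ∣ A ∣ + ∣ B ∣
    go : ∀ C → C ⊆ A ⊕ B → Good k C → Acc _<_ (∣ A ⊕ B ∣ ∸ ∣ C ∣) → Good k (A ⊕ B)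
    go C C⊆ g@(H , p , q) (acc rec) with ⊆-dec (A ⊕ B) C
    ... | yes f = H , (λ r s → C⊆ (p (f _ r) s)) , ≤-trans q (+-monoˡ-≤ _ (card-mono C (A ⊕ B) C⊆))
    ... | no ¬f with ⊈-witness (A ⊕ B) C (λ f → ¬f (λ x → f))
    ...   | x , x∈ , x∉ with ⊕-out A B x∈
    ...     | a , b , a∈ , b∈ , refl with dyson A B a∈ b∈ (<-wellFounded _)
    ...       | D , D⊆ , x∈D , gD = go (C ∪ D) (λ { (inj₁ r) → C⊆ r ; (inj₂ r) → D⊆ r }) (∪-good k C D g gD)
                (rec (∸-monoʳ-< (card-strict C (C ∪ D) inj₁ (inj₂ x∈D) x∉)
                  (card-mono (C ∪ D) (A ⊕ B) (λ { (inj₁ r) → C⊆ r ; (inj₂ r) → D⊆ r }))))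

  -- `H` and `stab C` have the same elements, without an equation between records; the same `H` can
  -- then be carried along while the set changes.
  record IsStab (H : Sg) (C : Sub) : Set where
    field
      per   : Per H C
      least : set (stab C) ⊆ set H
  open IsStab public

  stab-isStab : ∀ C → IsStab (stab C) C
  stab-isStab C = record { per = stab-per C ; least = λ p → p }

  stab-mono : ∀ C D → C ⊆ D → D ⊆ C → set (stab C) ⊆ set (stab D)
  stab-mono C D f g p x x∈ = f (p x (g x∈))

  isStab-cong : ∀ H C D → C ⊆ D → D ⊆ C → IsStab H C → IsStab H D
  isStab-cong H C D f g s = record
    { per   = λ p q → f (per s (g p) q)
    ; least = λ {x} p → least s {x} (stab-mono D C g f {x} p) }

  -- Thickening both summands by the stabiliser does not change the sumset, and any group of periods
  -- found for it lies in `H`.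
  kneser : ∀ A B H {a₀ b₀} → a₀ ∈ A → b₀ ∈ B → IsStab H (A ⊕ B) →
    ∣ A ⊕ set H ∣ + ∣ B ⊕ set H ∣ ≤ ∣ A ⊕ B ∣ + ∣ set H ∣
  kneser A B H a₀∈ b₀∈ s with kneser-good (A ⊕ set H) (B ⊕ set H) (⊆-⊕ H A a₀∈) (⊆-⊕ H B b₀∈)
  ... | K , pK , q = ≤-trans q (+-mono-≤ (card-mono AB (A ⊕ B) shrink) (card-mono (set K) (set H)
          (λ {h} h∈ → least s {h} (λ x x∈ → shrink (pK (expand x∈) h∈)))))
    where
    AB = (A ⊕ set H) ⊕ (B ⊕ set H)
    expand : A ⊕ B ⊆ AB
    expand = ⊕-mono A B (A ⊕ set H) (B ⊕ set H) (⊆-⊕ H A) (⊆-⊕ H B)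
    shrink : AB ⊆ A ⊕ B
    shrink x∈ with ⊕-out (A ⊕ set H) (B ⊕ set H) x∈
    ... | y , z , p , p′ , refl with ⊕-out A (set H) p | ⊕-out B (set H) p′
    ... | a , h , a∈ , h∈ , refl | b , h′ , b∈ , h′∈ , refl =
      resp (A ⊕ B) (lem a h b h′) (per s (⊕-in A B a∈ b∈ refl) (∙∈ H h∈ h′∈))
      where
      lem : ∀ a h b h′ → a ∙ b ∙ (h ∙ h′) ≡ a ∙ h ∙ (b ∙ h′)
      lem = group 4 (λ a h b h′ → a ⊞ b ⊞ (h ⊞ h′) ⊜ a ⊞ h ⊞ (b ⊞ h′)) refl

  Inhabited : Sub → Set
  Inhabited A = ∃ λ x → x ∈ A

  ⨁-inhabited : ∀ As → All Inhabited As → Inhabited (⨁ As)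
  ⨁-inhabited []       []              = ε , refl
  ⨁-inhabited (A ∷ As) ((a , a∈) ∷ ps) with ⨁-inhabited As ps
  ... | y , y∈ = a ∙ y , ⊕-in A (⨁ As) a∈ y∈ refl

  -- The extra summand `W` keeps `H` fixed along the list. The tail plus `W` may have a smaller
  -- stabiliser, but the tail plus `H` has stabiliser `H`, since adding `A` turns its periods into
  -- periods of the full sum. The induction goes on with `W` replaced by `H`.
  kneser-⨁ : ∀ As W H → All Inhabited As → IsStab H (⨁ As ⊕ set W) →
    sumL (map (λ A → ∣ A ⊕ set H ∣) As) + ∣ set H ∣ ≤ ∣ ⨁ As ⊕ set W ∣ + length As * ∣ set H ∣
  kneser-⨁ [] W H [] s = ≤-trans (card-per H (sg ε ⊕ set W) (per s) (⊕-in (sg ε) (set W) refl (ε∈ W) (identityʳ ε)))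
    (≤-reflexive (sym (+-identityʳ _)))
  kneser-⨁ (A ∷ As) W H ((a , a∈) ∷ ps) s with ⨁-inhabited As ps
  ... | y , y∈ = lin≤ 0 (ih ⊕≤ kn ⊕≤ D″≤) (ar (∣ A ⊕ set H ∣) (sumL (map (λ A → ∣ A ⊕ set H ∣) As)) (∣ set H ∣)
                   (∣ ⨁ (A ∷ As) ⊕ set W ∣) (length As * ∣ set H ∣) (∣ D″ ∣) (∣ D ⊕ set H ∣))
    where
    ar : ∀ a l h d n e f → a + l + h + (e + n + (d + h) + f) + 0 ≡ d + (h + n) + (l + h + (a + f) + e)
    ar = solve-∀
    D D″ : Sub
    D  = ⨁ As ⊕ set W
    D″ = ⨁ As ⊕ set H
    s₁ : IsStab H (A ⊕ D)
    s₁ = isStab-cong H (⨁ (A ∷ As) ⊕ set W) (A ⊕ D) (⊕-assoc A (⨁ As) (set W)) (⊕-assoc⁻ A (⨁ As) (set W)) s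
    y∈D : y ∈ D
    y∈D = ⊆-⊕ W (⨁ As) y∈
    kn : ∣ A ⊕ set H ∣ + ∣ D ⊕ set H ∣ ≤ ∣ ⨁ (A ∷ As) ⊕ set W ∣ + ∣ set H ∣
    kn = ≤-trans (kneser A D H a∈ y∈D s₁) (+-monoˡ-≤ _ (card-mono (A ⊕ D) (⨁ (A ∷ As) ⊕ set W) (⊕-assoc⁻ A (⨁ As) (set W))))
    D″≤ : ∣ D″ ∣ ≤ ∣ D ⊕ set H ∣
    D″≤ = card-mono D″ (D ⊕ set H) (⊕-mono (⨁ As) (set H) D (set H) (⊆-⊕ W (⨁ As)) (λ p → p))
    s₂ : IsStab H D″
    s₂ = record { per = per-⊕ H (⨁ As) ; least = λ {h} h∈ → least s₁ {h} (λ x x∈ → st h h∈ x x∈) }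
      where
      st : ∀ h → h ∈ set (stab D″) → ∀ x → x ∈ A ⊕ D → x ∙ h ∈ A ⊕ D
      st h h∈ x x∈ with ⊕-out A D x∈
      ... | a′ , d , a′∈ , d∈ , refl with ⊕-out (⨁ As) (set W) d∈
      ... | t , w , t∈ , w∈ , refl with ⊕-out (⨁ As) (set H) (h∈ t (⊆-⊕ H (⨁ As) t∈))
      ... | t′ , k , t′∈ , k∈ , eq = resp (A ⊕ D) (trans (lem a′ t′ w k) (trans (∙ʳ (∙ˡ eq)) (lem′ a′ t h w)))
                  (per s₁ (⊕-in A D a′∈ (⊕-in (⨁ As) (set W) t′∈ w∈ refl) refl) k∈)
        where
        lem : ∀ a t w k → a ∙ (t ∙ w) ∙ k ≡ a ∙ (t ∙ k) ∙ w
        lem = group 4 (λ a t w k → a ⊞ (t ⊞ w) ⊞ k ⊜ a ⊞ (t ⊞ k) ⊞ w) refl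
        lem′ : ∀ a t h w → a ∙ (t ∙ h) ∙ w ≡ a ∙ (t ∙ w) ∙ h
        lem′ = group 4 (λ a t h w → a ⊞ (t ⊞ h) ⊞ w ⊜ a ⊞ (t ⊞ w) ⊞ h) refl
    ih : sumL (map (λ A → ∣ A ⊕ set H ∣) As) + ∣ set H ∣ ≤ ∣ D″ ∣ + length As * ∣ set H ∣
    ih = kneser-⨁ As H H ps s₂

-- Sums of subsequences, and systems of sequences.

module SubsequenceSums {N : ℕ} (𝔾 : FinAb N) where
  open Sets 𝔾
  open Kneser 𝔾

  Seq : Set
  Seq = List G

  σ : Seq → G
  σ = foldr _∙_ ε

  v : Sg → G → Seq → ℕ
  v H g []      = 0
  v H g (s ∷ S) = χ (set H) (s - g) + v H g S

  v-mono : ∀ H K {g g′} → set H ⊆ set K → g - g′ ∈ set K → ∀ S → v H g S ≤ v K g′ S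
  v-mono H K f p []      = z≤n
  v-mono H K f p (s ∷ S) = +-mono-≤ (χ-mono (set H) (set K) (λ q → trans∈ K (f q) p)) (v-mono H K f p S)

  v-cong : ∀ H {g g′} → g - g′ ∈ set H → ∀ S → v H g S ≡ v H g′ S
  v-cong H p S = ≤-antisym (v-mono H H (λ q → q) p S) (v-mono H H (λ q → q) (flip∈ H p) S)

  v≤length : ∀ H g S → v H g S ≤ length S
  v≤length H g []      = z≤n
  v≤length H g (s ∷ S) = +-mono-≤ (χ≤1 (set H) (s - g)) (v≤length H g S)

  v-⊑ : ∀ H g {S T} → T ⊑ S → v H g T ≤ v H g S
  v-⊑ H g []         = z≤n
  v-⊑ H g (y ∷ʳ p)   = ≤-trans (v-⊑ H g p) (m≤n+m _ _)
  v-⊑ H g (refl ∷ p) = +-monoʳ-≤ _ (v-⊑ H g p)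

  v-keep : ∀ H g {Q : G → Set} (Q? : Decidable Q) → (∀ s → s - g ∈ set H → Q s) → ∀ S → v H g S ≤ v H g (filter Q? S)
  v-keep H g Q? f []      = z≤n
  v-keep H g Q? f (s ∷ S) with Q? s
  ... | yes _ = +-monoʳ-≤ _ (v-keep H g Q? f S)
  ... | no ¬q = ≤-trans (≤-reflexive (cong (_+ v H g S) (χ-out (set H) (λ r → ¬q (f s r))))) (v-keep H g Q? f S)

  -- Each term is seen from all |H| representatives of its coset.
  sum-v : ∀ H S → sum (λ g → v H g S) ≡ ∣ set H ∣ * length S
  sum-v H []      = trans (sum-const N 0) (trans (*-zeroʳ N) (sym (*-zeroʳ ∣ set H ∣)))
  sum-v H (s ∷ S) = begin
    sum (λ g → χ (set H) (s - g) + v H g S)          ≡⟨ ∑-distrib-+ (λ g → χ (set H) (s - g)) (λ g → v H g S) ⟩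
    sum (λ g → χ (set H) (s - g)) + sum (λ g → v H g S) ≡⟨ cong₂ _+_ (sum-flip (χ (set H)) s) (sum-v H S) ⟩
    ∣ set H ∣ + ∣ set H ∣ * length S                 ≡⟨ sym (*-suc ∣ set H ∣ (length S)) ⟩
    ∣ set H ∣ * suc (length S)                       ∎
    where open ≡-Reasoning

  SubSum : ℕ → Seq → G → Set
  SubSum m S x = ∃ λ T → (T ⊑ S) × length T ≡ m × σ T ≡ x

  subSum? : ∀ m S x → Dec (SubSum m S x)
  subSum? zero    S       x = map′ (λ { refl → [] , minimum S , refl , refl }) (λ { ([] , _ , _ , eq) → eq }) (ε ≟ x)
  subSum? (suc m) []      x = no λ { (_ , [] , () , _) }
  subSum? (suc m) (s ∷ S) x with subSum? (suc m) S x | subSum? m S (x - s)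
  ... | yes (T , p , q , r) | _ = yes (T , s ∷ʳ p , q , r)
  ... | no _ | yes (T , p , q , r) = yes (s ∷ T , refl ∷ p , cong suc q , trans (∙ˡ r) (lem s x))
    where
    lem : ∀ s x → s ∙ (x - s) ≡ x
    lem = group 2 (λ s x → s ⊞ (x ⊟ s) ⊜ x) refl
  ... | no ¬a | no ¬b = no λ
    { (T , (.s ∷ʳ p) , q , r) → ¬a (T , p , q , r)
    ; (.s ∷ T , (refl ∷ p) , q , r) → ¬b (T , p , suc-injective q , trans (lem s (σ T)) (∙ʳ r)) }
    where
    lem : ∀ s t → t ≡ s ∙ t - s
    lem = group 2 (λ s t → t ⊜ s ⊞ t ⊟ s) refl

  Σs : ℕ → Seq → Sub
  Σs m S = sub (SubSum m S) (subSum? m S)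

  data Split : Seq → Seq → Seq → Set where
    []    : Split [] [] []
    left  : ∀ {s S A B} → Split S A B → Split (s ∷ S) (s ∷ A) B
    right : ∀ {s S A B} → Split S A B → Split (s ∷ S) A (s ∷ B)

  split-v : ∀ H g {S A B} → Split S A B → v H g S ≡ v H g A + v H g B
  split-v H g []                = refl
  split-v H g (left {s} p)      = trans (cong (χ (set H) (s - g) +_) (split-v H g p)) (sym (+-assoc (χ (set H) (s - g)) _ _))
  split-v H g (right {s} {A = A} {B} p) = trans (cong (c +_) (split-v H g p)) (eq c (v H g A) (v H g B))
    where
    c = χ (set H) (s - g)
    eq : ∀ a b c → a + (b + c) ≡ b + (a + c)
    eq = solve-∀

  split-length : ∀ {S A B} → Split S A B → length S ≡ length A + length B
  split-length []        = refl
  split-length (left p)  = cong suc (split-length p)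
  split-length (right p) = trans (cong suc (split-length p)) (sym (+-suc _ _))

  split-σ : ∀ {S A B} → Split S A B → σ S ≡ σ A ∙ σ B
  split-σ []                      = sym (identityˡ ε)
  split-σ (left {s} p)            = trans (∙ˡ (split-σ p)) (sym (assoc s _ _))
  split-σ (right {s} {A = A} {B} p) = trans (∙ˡ (split-σ p)) (eq s (σ A) (σ B))
    where
    eq : ∀ a b c → a ∙ (b ∙ c) ≡ b ∙ (a ∙ c)
    eq = group 3 (λ a b c → a ⊞ (b ⊞ c) ⊜ b ⊞ (a ⊞ c)) refl

  split-refl : ∀ S → Split S [] S
  split-refl []      = []
  split-refl (s ∷ S) = right (split-refl S)

  split-merge : ∀ {S A B T U} → Split S A B → T ⊑ A → U ⊑ B → ∃ λ V → (V ⊑ S) × Split V T U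
  split-merge []        []         []         = [] , [] , []
  split-merge (left p)  (_ ∷ʳ q)   r          with split-merge p q r
  ... | V , a , b = V , _ ∷ʳ a , b
  split-merge (left p)  (refl ∷ q) r          with split-merge p q r
  ... | V , a , b = _ ∷ V , refl ∷ a , left b
  split-merge (right p) q          (_ ∷ʳ r)   with split-merge p q r
  ... | V , a , b = V , _ ∷ʳ a , b
  split-merge (right p) q          (refl ∷ r) with split-merge p q r
  ... | V , a , b = _ ∷ V , refl ∷ a , right b

  split-Σs : ∀ {S A B} → Split S A B → ∀ m n → Σs m A ⊕ Σs n B ⊆ Σs (m + n) S
  split-Σs {S} {A} {B} sp m n p with ⊕-out (Σs m A) (Σs n B) p
  ... | _ , _ , (T , T⊑ , refl , refl) , (U , U⊑ , refl , refl) , refl with split-merge sp T⊑ U⊑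
  ... | V , V⊑ , sp′ = V , V⊑ , split-length sp′ , split-σ sp′

  split-filter : ∀ {Q : G → Set} (Q? : Decidable Q) S → Split S (filter Q? S) (filter (¬? ∘ Q?) S)
  split-filter Q? []      = []
  split-filter Q? (s ∷ S) with Q? s
  ... | yes _ = left (split-filter Q? S)
  ... | no  _ = right (split-filter Q? S)

  -- A system asks for m terms from each of its sequences. The bound is proved for systems because
  -- both refining and localising turn one sequence into several.
  Sys : Set
  Sys = List (Seq × ℕ)

  X : Sys → Sub
  X Φ = ⨁ (map (λ { (S , m) → Σs m S }) Φ)

  -- `μ` counts the possible cuts. It drops whenever a sequence is divided into two nonempty ones,
  -- and it is the induction measure for the DeVos-Goddyn-Mohar bound.
  tot μ : Sys → ℕ
  tot []            = 0
  tot ((S , m) ∷ Φ) = m + tot Φ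
  μ []            = 0
  μ ((S , m) ∷ Φ) = (length S ∸ 1) + μ Φ

  pw : Sg → G → Sys → ℕ
  pw H g []            = 0
  pw H g ((S , m) ∷ Φ) = m ⊓ v H g S + pw H g Φ

  -- wt H Φ = |H| Σᵢ Σ_{Q ∈ G/H} min(mᵢ, v_Q(Sᵢ)): summing over elements instead of cosets avoids quotient groups.
  wt : Sg → Sys → ℕ
  wt H Φ = sum (λ g → pw H g Φ)

  Feasible : Sys → Set
  Feasible = All (λ { (S , m) → m ≤ length S })

  pw-mono : ∀ H K g → set H ⊆ set K → ∀ Φ → pw H g Φ ≤ pw K g Φ
  pw-mono H K g f []            = z≤n
  pw-mono H K g f ((S , m) ∷ Φ) = +-mono-≤ (⊓-monoʳ-≤ m (v-mono H K f (refl∈ K) S)) (pw-mono H K g f Φ)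

  wt-mono : ∀ H K → set H ⊆ set K → ∀ Φ → wt H Φ ≤ wt K Φ
  wt-mono H K f Φ = sum-mono (λ g → pw-mono H K g f Φ)

  -- When every m is at most 1 the DeVos–Goddyn–Mohar bound is Kneser's theorem.

  Flat : Sys → Set
  Flat = All (λ { (S , m) → m ≤ 1 })

  v-witness : ∀ H g S → 1 ≤ v H g S → ∃ λ s → (s ∷ [] ⊑ S) × s - g ∈ set H
  v-witness H g (s ∷ S) p with dec (set H) (s - g)
  ... | yes q = s , refl ∷ minimum S , q
  ... | no  _ with v-witness H g S p
  ...   | t , a , b = t , s ∷ʳ a , b

  flat-part : ∀ H S m → m ≤ 1 → sum (λ g → m ⊓ v H g S) + ∣ set H ∣ ≤ ∣ Σs m S ⊕ set H ∣ + m * ∣ set H ∣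
  flat-part H S zero _ = ≤-trans
    (+-mono-≤ {x = sum {N} (λ _ → 0)} (≤-reflexive (trans (sum-const N 0) (*-zeroʳ N)))
      (card-mono (set H) (Σs 0 S ⊕ set H)
        (λ {x} p → ⊕-in (Σs 0 S) (set H) ([] , minimum S , refl , refl) p (identityˡ x))))
    (≤-reflexive (+-comm 0 _))
  flat-part H S (suc zero) _ = +-mono-≤ (sum-mono pt) (≤-reflexive (sym (+-identityʳ ∣ set H ∣)))
    where
    pt : ∀ g → 1 ⊓ v H g S ≤ χ (Σs 1 S ⊕ set H) g
    pt g with 1 ≤? v H g S
    ... | no ¬p = ≤-trans (m⊓n≤n 1 (v H g S)) (≤-trans (≤-pred (≰⇒> ¬p)) z≤n)
    ... | yes p with v-witness H g S p
    ...   | s , s⊑ , q = ≤-trans (m⊓n≤m 1 (v H g S)) (≤-reflexive (sym (χ-in (Σs 1 S ⊕ set H)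
              (⊕-in (Σs 1 S) (set H) (s ∷ [] , s⊑ , refl , identityʳ s) (flip∈ H q) (lem s g)))))
      where
      lem : ∀ s g → s ∙ (g - s) ≡ g
      lem = group 2 (λ s g → s ⊞ (g ⊟ s) ⊜ g) refl
  flat-part H S (suc (suc m)) (s≤s ())

  sets : Sys → List Sub
  sets = map (λ { (S , m) → Σs m S })

  flat-wt : ∀ H Φ → Flat Φ →
    wt H Φ + length (sets Φ) * ∣ set H ∣ ≤ sumL (map (λ A → ∣ A ⊕ set H ∣) (sets Φ)) + tot Φ * ∣ set H ∣
  flat-wt H [] [] = ≤-trans (≤-reflexive (+-identityʳ _)) (≤-reflexive (trans (sum-const N 0) (*-zeroʳ N)))
  flat-wt H ((S , m) ∷ Φ) (q ∷ qs) = ≤-trans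
    (≤-reflexive (cong (_+ (∣ set H ∣ + length (sets Φ) * ∣ set H ∣)) (∑-distrib-+ (λ g → m ⊓ v H g S) (λ g → pw H g Φ))))
    (lin≤ 0 (flat-part H S m q ⊕≤ flat-wt H Φ qs)
      (eq (sum (λ g → m ⊓ v H g S)) (wt H Φ) (∣ set H ∣) (length (sets Φ) * ∣ set H ∣) (∣ Σs m S ⊕ set H ∣)
        (sumL (map (λ A → ∣ A ⊕ set H ∣) (sets Φ))) m (tot Φ)))
    where
    eq : ∀ a w h l c s m t → a + w + (h + l) + (c + m * h + (s + t * h)) + 0 ≡ c + s + (m + t) * h + (a + h + (w + l))
    eq = solve-∀

  Σs-inhabited : ∀ m S → m ≤ length S → Inhabited (Σs m S)
  Σs-inhabited zero    S       p       = ε , [] , minimum S , refl , refl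
  Σs-inhabited (suc m) (s ∷ S) (s≤s p) with Σs-inhabited m S p
  ... | x , T , a , b , c = s ∙ x , s ∷ T , refl ∷ a , cong suc b , ∙ˡ c

  sets-inhabited : ∀ Φ → Feasible Φ → All Inhabited (sets Φ)
  sets-inhabited []            []       = []
  sets-inhabited ((S , m) ∷ Φ) (p ∷ ps) = Σs-inhabited m S p ∷ sets-inhabited Φ ps

  -- The DeVos-Goddyn-Mohar inequality |X| ≥ |H|(1 - n + Σ min) with n = `tot Φ`, rearranged to
  -- avoid subtraction.
  Bound : Sys → Sg → Sg → Set
  Bound Φ W H = wt H Φ + ∣ set H ∣ ≤ ∣ X Φ ⊕ set W ∣ + tot Φ * ∣ set H ∣

  flat-bound : ∀ Φ W H → Feasible Φ → Flat Φ → IsStab H (X Φ ⊕ set W) → Bound Φ W H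
  flat-bound Φ W H fs fl s = lin≤ 0 (kneser-⨁ (sets Φ) W H (sets-inhabited Φ fs) s ⊕≤ flat-wt H Φ fl)
    (eq (wt H Φ) (∣ set H ∣) (∣ X Φ ⊕ set W ∣) (tot Φ * ∣ set H ∣) (length (sets Φ) * ∣ set H ∣) (sumL (map (λ A → ∣ A ⊕ set H ∣) (sets Φ))))
    where
    eq : ∀ w h x t l s → w + h + (x + l + (s + t)) + 0 ≡ x + t + (s + h + (w + l))
    eq = solve-∀

-- Refining a system, and localising it in cosets.

module Localisation {N : ℕ} (𝔾 : FinAb N) where
  open Sets 𝔾
  open Kneser 𝔾
  open SubsequenceSums 𝔾

  -- Data for replacing (S, k + 1) by (A, 1) and (R, k). `lower` keeps the weight at `W` from
  -- dropping; `upper`, at coarser subgroups, bounds what a class met by `A` can lose, as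
  -- `min-refined` requires.
  record Pick (W : Sg) (S : Seq) (k : ℕ) : Set₁ where
    field
      A R    : Seq
      split  : Split S A R
      upper  : ∀ H g → set W ⊆ set H → 1 ≤ v H g A → suc k ⊓ (v H g A + v H g R) ≤ 1 + k ⊓ v H g R
      lower  : ∀ g → suc k ⊓ (v W g A + v W g R) ≤ 1 ⊓ v W g A + k ⊓ v W g R
      A-size : 1 ≤ length A
      R-size : k ≤ length R

  record Heavy (W : Sg) (S : Seq) (k : ℕ) : Set₁ where
    field
      A R   : Seq
      split : Split S A R
      light : ∀ g → v W g S ≤ k → v W g A ≡ 0
      heavy : ∀ g → k < v W g S → v W g A ≡ 1
      many  : ∀ H g → set W ⊆ set H → 1 ≤ v H g A → k ≤ v H g R

  -- A term is selected when exactly k terms of its class follow it, so each class with more than k terms is hit once.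
  pick-heavy : ∀ W S k → Heavy W S k
  pick-heavy W [] k = record
    { A = [] ; R = [] ; split = [] ; light = λ _ _ → refl ; heavy = λ _ () ; many = λ _ _ _ () }
  pick-heavy W (s ∷ S) k with pick-heavy W S k | v W s S ℕ.≟ k
  ... | record { A = A ; R = R ; split = sp ; light = li ; heavy = he ; many = ma } | yes eq = record
    { A = s ∷ A ; R = R ; split = left sp ; light = li′ ; heavy = he′ ; many = ma′ }
    where
    li′ : ∀ g → v W g (s ∷ S) ≤ k → v W g (s ∷ A) ≡ 0
    li′ g p with dec (set W) (s - g)
    ... | no  _ = li g p
    ... | yes q = ⊥-elim (n≮n k (≤-trans (s≤s (≤-reflexive (trans (sym eq) (v-cong W q S)))) p))
    he′ : ∀ g → k < v W g (s ∷ S) → v W g (s ∷ A) ≡ 1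
    he′ g p with dec (set W) (s - g)
    ... | no  _ = he g p
    ... | yes q = cong suc (li g (≤-reflexive (trans (sym (v-cong W q S)) eq)))
    ma′ : ∀ H g → set W ⊆ set H → 1 ≤ v H g (s ∷ A) → k ≤ v H g R
    ma′ H g f p with dec (set H) (s - g)
    ... | no  _ = ma H g f p
    ... | yes q = ≤-trans (≤-reflexive (trans (sym eq) (trans (split-v W s sp)
                    (cong (_+ v W s R) (li s (≤-reflexive eq)))))) (v-mono W H f q R)
  ... | record { A = A ; R = R ; split = sp ; light = li ; heavy = he ; many = ma } | no neq = record
    { A = A ; R = s ∷ R ; split = right sp ; light = li′ ; heavy = he′
    ; many = λ H g f p → ≤-trans (ma H g f p) (m≤n+m _ _) }
    where
    li′ : ∀ g → v W g (s ∷ S) ≤ k → v W g A ≡ 0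
    li′ g p = li g (≤-trans (m≤n+m _ (χ (set W) (s - g))) p)
    he′ : ∀ g → k < v W g (s ∷ S) → v W g A ≡ 1
    he′ g p with dec (set W) (s - g)
    ... | no  _ = he g p
    ... | yes q = he g (≤∧≢⇒< (≤-pred p) (λ eq → neq (trans (v-cong W q S) (sym eq))))

  split-[] : ∀ {S R} → Split S [] R → S ≡ R
  split-[] []        = refl
  split-[] (right p) = cong (_ ∷_) (split-[] p)

  -- If some class has more than k terms, one term of each such class is taken. Otherwise a single
  -- term will do, because every minimum is then the multiplicity itself.
  pick : ∀ W S k → suc k ≤ length S → Pick W S k
  pick W S k k<S with pick-heavy W S k
  ... | record { A = a ∷ A ; R = R ; split = sp ; light = li ; heavy = he ; many = ma } = record
    { A = a ∷ A ; R = R ; split = sp ; upper = up ; lower = lo ; A-size = s≤s z≤n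
    ; R-size = ≤-trans (ma W a (λ p → p) (≤-trans (≤-reflexive (sym (χ-in (set W) (refl∈ W)))) (m≤m+n _ _))) (v≤length W a R) }
    where
    up : ∀ H g → set W ⊆ set H → 1 ≤ v H g (a ∷ A) → suc k ⊓ (v H g (a ∷ A) + v H g R) ≤ 1 + k ⊓ v H g R
    up H g f p = ≤-trans (m⊓n≤m (suc k) _) (s≤s (≤-reflexive (sym (m≤n⇒m⊓n≡m (ma H g f p)))))
    lo : ∀ g → suc k ⊓ (v W g (a ∷ A) + v W g R) ≤ 1 ⊓ v W g (a ∷ A) + k ⊓ v W g R
    lo g with v W g S ≤? k
    ... | yes p rewrite li g p = ≤-trans (m⊓n≤n (suc k) _)
            (≤-reflexive (sym (m≥n⇒m⊓n≡n (≤-trans (≤-reflexive (sym (trans (split-v W g sp) (cong (_+ v W g R) (li g p))))) p))))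
    ... | no ¬p = ≤-trans (up W g (λ q → q) (≤-reflexive (sym (he g (≰⇒> ¬p)))))
            (≤-reflexive (cong (λ t → 1 ⊓ t + k ⊓ v W g R) (sym (he g (≰⇒> ¬p)))))
  pick W (s ∷ S) k (s≤s k≤S) | record { A = [] ; heavy = he } = record
    { A = s ∷ [] ; R = S ; split = left (split-refl S) ; upper = up ; lower = lo ; A-size = s≤s z≤n ; R-size = k≤S }
    where
    all-light : ∀ g → v W g (s ∷ S) ≤ k
    all-light g = ≮⇒≥ (λ p → 0≢1+n (he g p))
    up : ∀ H g → set W ⊆ set H → 1 ≤ v H g (s ∷ []) → suc k ⊓ (v H g (s ∷ []) + v H g S) ≤ 1 + k ⊓ v H g S
    up H g f p = ⊓-monoʳ-≤ (suc k) (+-monoˡ-≤ (v H g S) (v≤length H g (s ∷ [])))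
    lo : ∀ g → suc k ⊓ (v W g (s ∷ []) + v W g S) ≤ 1 ⊓ v W g (s ∷ []) + k ⊓ v W g S
    lo g with dec (set W) (s - g) | all-light g
    ... | yes _ | p = ≤-refl
    ... | no  _ | p = ≤-trans (m⊓n≤n (suc k) (v W g S)) (≤-reflexive (sym (m≥n⇒m⊓n≡n p)))

  filter⁺ : ∀ {Q : G → Set} (Q? : Decidable Q) {S T} → T ⊑ S → filter Q? T ⊑ filter Q? S
  filter⁺ Q? = ⊑.filter⁺ Q? Q? (λ { refl q → q })

  data Refine (W : Sg) : Sys → Sys → Set₁ where
    here  : ∀ {S k Φ} (p : Pick W S (suc k)) → Refine W ((S , suc (suc k)) ∷ Φ) ((Pick.A p , 1) ∷ (Pick.R p , suc k) ∷ Φ)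
    there : ∀ {q Φ Ψ} → Refine W Φ Ψ → Refine W (q ∷ Φ) (q ∷ Ψ)

  refine : ∀ W Φ → Feasible Φ → Flat Φ ⊎ Σ Sys (Refine W Φ)
  refine W []            []       = inj₁ []
  refine W ((S , zero) ∷ Φ) (p ∷ ps) with refine W Φ ps
  ... | inj₁ f       = inj₁ (z≤n ∷ f)
  ... | inj₂ (Ψ , r) = inj₂ (_ , there r)
  refine W ((S , suc zero) ∷ Φ) (p ∷ ps) with refine W Φ ps
  ... | inj₁ f       = inj₁ (s≤s z≤n ∷ f)
  ... | inj₂ (Ψ , r) = inj₂ (_ , there r)
  refine W ((S , suc (suc k)) ∷ Φ) (p ∷ ps) = inj₂ (_ , here (pick W S (suc k) p))

  refine-tot : ∀ {W Φ Ψ} → Refine W Φ Ψ → tot Ψ ≡ tot Φ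
  refine-tot (here p)             = refl
  refine-tot (there {S , m} r)    = cong (m +_) (refine-tot r)

  refine-feasible : ∀ {W Φ Ψ} → Refine W Φ Ψ → Feasible Φ → Feasible Ψ
  refine-feasible (here p)  (_ ∷ fs) = Pick.A-size p ∷ Pick.R-size p ∷ fs
  refine-feasible (there r) (f ∷ fs) = f ∷ refine-feasible r fs

  refine-X : ∀ {W Φ Ψ} → Refine W Φ Ψ → X Ψ ⊆ X Φ
  refine-X (here {S} {k} {Φ} p) q with ⊕-assoc⁻ (Σs 1 (Pick.A p)) (Σs (suc k) (Pick.R p)) (X Φ) q
  ... | r = ⊕-mono (Σs 1 (Pick.A p) ⊕ Σs (suc k) (Pick.R p)) (X Φ) (Σs (suc (suc k)) S) (X Φ)
              (λ {x} → split-Σs (Pick.split p) 1 (suc k) {x}) (λ z → z) r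
  refine-X (there {S , m} {Φ} {Ψ} r) q = ⊕-mono (Σs m S) (X Ψ) (Σs m S) (X Φ) (λ z → z) (refine-X r) q

  ∸1-strict : ∀ a b → 1 ≤ a → 1 ≤ b → (a ∸ 1) + (b ∸ 1) < (a + b) ∸ 1
  ∸1-strict (suc a) (suc b) _ _ = ≤-reflexive (sym (+-suc a b))

  ∸1-weak : ∀ a b → (a ∸ 1) + (b ∸ 1) ≤ (a + b) ∸ 1
  ∸1-weak zero    b       = ≤-refl
  ∸1-weak (suc a) zero    = ≤-refl
  ∸1-weak (suc a) (suc b) = +-monoʳ-≤ a (n≤1+n b)

  refine-μ : ∀ {W Φ Ψ} → Refine W Φ Ψ → μ Ψ < μ Φ
  refine-μ (here {S} {k} {Φ} p) = ≤-trans
    (≤-reflexive (cong suc (sym (+-assoc (length (Pick.A p) ∸ 1) (length (Pick.R p) ∸ 1) (μ Φ)))))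
    (+-monoˡ-≤ (μ Φ) (≤-trans (∸1-strict (length (Pick.A p)) (length (Pick.R p)) (Pick.A-size p) (≤-trans (s≤s z≤n) (Pick.R-size p)))
      (≤-reflexive (cong (_∸ 1) (sym (split-length (Pick.split p)))))))
  refine-μ (there {S , m} r) = +-monoʳ-< (length S ∸ 1) (refine-μ r)

  refine-pw : ∀ {W Φ Ψ} → Refine W Φ Ψ → ∀ g → pw W g Φ ≤ pw W g Ψ
  refine-pw {W} (here {S} {k} {Φ} p) g = ≤-trans
    (+-monoˡ-≤ (pw W g Φ) (≤-trans (≤-reflexive (cong (suc (suc k) ⊓_) (split-v W g (Pick.split p)))) (Pick.lower p g)))
    (≤-reflexive (+-assoc (1 ⊓ v W g (Pick.A p)) _ _))
  refine-pw {W} (there {S , m} r) g = +-monoʳ-≤ (m ⊓ v W g S) (refine-pw r g)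

  module Local (H : Sg) where
    near : G → G → Set
    near r s = s - r ∈ set H

    near? : ∀ r s → Dec (near r s)
    near? r s = dec (set H) (s - r)

    _∩ᶜ_ _∖ᶜ_ : Seq → G → Seq
    S ∩ᶜ r = filter (near? r) S
    S ∖ᶜ r = filter (¬? ∘ near? r) S

    -- Each coset is removed once it has been treated, so r may run over all of G instead of a transversal.
    loc : List G → Seq → Seq → Sys
    loc []       S T = []
    loc (r ∷ rs) S T = (S ∩ᶜ r , length (T ∩ᶜ r)) ∷ loc rs (S ∖ᶜ r) (T ∖ᶜ r)

    Cover : List G → Seq → Set
    Cover rs T = ∀ {t} → t ∈ˡ T → t ∈ˡ rs

    cover-[] : ∀ {T} → Cover [] T → T ≡ []
    cover-[] {[]}    c = refl
    cover-[] {t ∷ T} c with c (here refl)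
    ... | ()

    cover-∖ : ∀ {r rs T} → Cover (r ∷ rs) T → Cover rs (T ∖ᶜ r)
    cover-∖ {r} {rs} {T} c p with ∈-filter⁻ (¬? ∘ near? r) {xs = T} p
    ... | q , ¬n with c q
    ...   | here refl = ⊥-elim (¬n (refl∈ H))
    ...   | there s   = s

    sp : ∀ r S → Split S (S ∩ᶜ r) (S ∖ᶜ r)
    sp r S = split-filter (near? r) S

    loc-feasible : ∀ rs {S T} → T ⊑ S → Feasible (loc rs S T)
    loc-feasible []       p = []
    loc-feasible (r ∷ rs) p = ⊑.length-mono-≤ (filter⁺ (near? r) p) ∷ loc-feasible rs (filter⁺ (¬? ∘ near? r) p)

    loc-tot : ∀ rs S T → Cover rs T → tot (loc rs S T) ≡ length T
    loc-tot []       S T c rewrite cover-[] c = refl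
    loc-tot (r ∷ rs) S T c = trans (cong (length (T ∩ᶜ r) +_) (loc-tot rs (S ∖ᶜ r) (T ∖ᶜ r) (cover-∖ c)))
      (sym (split-length (sp r T)))

    loc-in : ∀ rs {S T} → T ⊑ S → Cover rs T → σ T ∈ X (loc rs S T)
    loc-in []       p c rewrite cover-[] c = refl
    loc-in (r ∷ rs) {S} {T} p c = ⊕-in (Σs (length (T ∩ᶜ r)) (S ∩ᶜ r)) (X (loc rs (S ∖ᶜ r) (T ∖ᶜ r)))
      (T ∩ᶜ r , filter⁺ (near? r) p , refl , refl)
      (loc-in rs (filter⁺ (¬? ∘ near? r) p) (cover-∖ c)) (sym (split-σ (sp r T)))

    loc-sub : ∀ rs S T → Cover rs T → X (loc rs S T) ⊆ Σs (length T) S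
    loc-sub []       S T c refl rewrite cover-[] c = [] , minimum S , refl , refl
    loc-sub (r ∷ rs) S T c {x} p = subst (λ n → SubSum n S x) (sym (split-length (sp r T)))
      (split-Σs (sp r S) (length (T ∩ᶜ r)) (length (T ∖ᶜ r))
        (⊕-mono (Σs (length (T ∩ᶜ r)) (S ∩ᶜ r)) (X (loc rs (S ∖ᶜ r) (T ∖ᶜ r)))
                (Σs (length (T ∩ᶜ r)) (S ∩ᶜ r)) (Σs (length (T ∖ᶜ r)) (S ∖ᶜ r))
                (λ z → z) (loc-sub rs (S ∖ᶜ r) (T ∖ᶜ r) (cover-∖ c)) p))

    same-coset : ∀ r T U → (∀ {t} → t ∈ˡ T → near r t) → (∀ {t} → t ∈ˡ U → near r t) → length T ≡ length U → σ T - σ U ∈ set H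
    same-coset r []      []      f g eq = refl∈ H
    same-coset r (t ∷ T) (u ∷ U) f g eq = add∈ H (trans∈ H (f (here refl)) (flip∈ H (g (here refl))))
      (same-coset r T U (f ∘ there) (g ∘ there) (suc-injective eq))

    loc-coset : ∀ rs S T → Cover rs T → ∀ {y} → y ∈ X (loc rs S T) → y - σ T ∈ set H
    loc-coset []       S T c refl rewrite cover-[] c = refl∈ H
    loc-coset (r ∷ rs) S T c p with ⊕-out (Σs (length (T ∩ᶜ r)) (S ∩ᶜ r)) (X (loc rs (S ∖ᶜ r) (T ∖ᶜ r))) p
    ... | _ , z , (U , U⊑ , len , refl) , q , refl = resp (set H) (cong (λ t → (σ U ∙ z) - t) (sym (split-σ (sp r T))))
      (add∈ H (same-coset r U (T ∩ᶜ r) (λ u∈ → proj₂ (∈-filter⁻ (near? r) {xs = S} (lookup U⊑ u∈)))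
          (λ t∈ → proj₂ (∈-filter⁻ (near? r) {xs = T} t∈)) len)
        (loc-coset rs (S ∖ᶜ r) (T ∖ᶜ r) (cover-∖ c) q))

    -- Only the first r of the list in the coset of g matters: at that moment all terms of `S` and
    -- `T` near g are still present, and the component asks for all those of `T`.
    loc-pw : ∀ J → set J ⊆ set H → ∀ g rs S T → g ∈ˡ rs → v H g T ⊓ v J g S ≤ pw J g (loc rs S T)
    loc-pw J J⊆H g (r ∷ rs) S T g∈ with near? r g
    ... | yes q = ≤-trans (⊓-mono-≤
            (≤-trans (v-keep H g (near? r) (λ s s~g → trans∈ H s~g q) T) (v≤length H g (T ∩ᶜ r)))
            (v-keep J g (near? r) (λ s s~g → trans∈ H (J⊆H s~g) q) S)) (m≤m+n _ _)
    ... | no ¬q = ≤-trans (⊓-mono-≤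
            (v-keep H g (¬? ∘ near? r) (λ s s~g s~r → ¬q (trans∈ H (flip∈ H s~g) s~r)) T)
            (v-keep J g (¬? ∘ near? r) (λ s s~g s~r → ¬q (trans∈ H (flip∈ H (J⊆H s~g)) s~r)) S))
            (≤-trans (loc-pw J J⊆H g rs (S ∖ᶜ r) (T ∖ᶜ r) (later g∈)) (m≤n+m _ _))
      where
      later : g ∈ˡ (r ∷ rs) → g ∈ˡ rs
      later (here refl) = ⊥-elim (¬q (refl∈ H))
      later (there p)   = p

    SameCoset : Seq → Set
    SameCoset S = ∀ {s t} → s ∈ˡ S → t ∈ˡ S → s - t ∈ set H

    -- Cutting along cosets lowers `μ` unless all terms lie in one coset. That exception is returned
    -- as data and is excluded later by producing sums in different cosets.
    loc-μ : ∀ rs S T → Cover rs S → μ (loc rs S T) < length S ∸ 1 ⊎ (μ (loc rs S T) ≤ length S ∸ 1 × SameCoset S)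
    loc-μ []       S T c rewrite cover-[] c = inj₂ (z≤n , λ ())
    loc-μ (r ∷ rs) S T c with loc-μ rs (S ∖ᶜ r) (T ∖ᶜ r) (cover-∖ c)
    ... | inj₁ lt = inj₁ (<-≤-trans (+-monoʳ-< (length (S ∩ᶜ r) ∸ 1) lt)
                      (≤-trans (∸1-weak (length (S ∩ᶜ r)) (length (S ∖ᶜ r))) (≤-reflexive (cong (_∸ 1) (sym (split-length (sp r S)))))))
    ... | inj₂ (le , same) = cases (S ∩ᶜ r) (S ∖ᶜ r) (sp r S) le same (λ p → proj₂ (∈-filter⁻ (near? r) {xs = S} p))
      where
      cases : ∀ A B → Split S A B → μ (loc rs (S ∖ᶜ r) (T ∖ᶜ r)) ≤ length B ∸ 1 → SameCoset B → (∀ {t} → t ∈ˡ A → near r t) →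
        (length A ∸ 1) + μ (loc rs (S ∖ᶜ r) (T ∖ᶜ r)) < length S ∸ 1 ⊎
        ((length A ∸ 1) + μ (loc rs (S ∖ᶜ r) (T ∖ᶜ r)) ≤ length S ∸ 1 × SameCoset S)
      cases [] B spl le same f with split-[] spl
      ... | refl = inj₂ (le , same)
      cases (a ∷ A) [] spl le same f = inj₂ (≤-trans (+-monoʳ-≤ (length A) le)
          (≤-reflexive (trans (sym (+-identityʳ _)) (trans (+-assoc (length A) 0 0) (cong (_∸ 1) (sym (split-length spl)))))) , same′)
        where
        in-left : ∀ {S A} → Split S A [] → ∀ {t} → t ∈ˡ S → t ∈ˡ A
        in-left (left p) (here refl) = here refl
        in-left (left p) (there q)   = there (in-left p q)
        same′ : SameCoset S
        same′ p q = trans∈ H (f (in-left spl p)) (flip∈ H (f (in-left spl q)))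
      cases (a ∷ A) (b ∷ B) spl le same f = inj₁ (≤-<-trans (+-monoʳ-≤ (length A) le)
          (<-≤-trans (∸1-strict (suc (length A)) (suc (length B)) (s≤s z≤n) (s≤s z≤n)) (≤-reflexive (cong (_∸ 1) (sym (split-length spl))))))

    Σs-coset : ∀ S m → SameCoset S → ∀ {x y} → x ∈ Σs m S → y ∈ Σs m S → x - y ∈ set H
    Σs-coset [] m same (.[] , [] , _ , refl) (.[] , [] , _ , refl) = refl∈ H
    Σs-coset (s ∷ S) m same (T , T⊑ , lT , refl) (U , U⊑ , lU , refl) =
      same-coset s T U (λ p → same (lookup T⊑ p) (here refl)) (λ p → same (lookup U⊑ p) (here refl)) (trans lT (sym lU))

  data Sel : Sys → Set where
    []  : Sel []
    _∷_ : ∀ {S m Φ} → (∃ λ T → (T ⊑ S) × length T ≡ m) → Sel Φ → Sel ((S , m) ∷ Φ)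

  val : ∀ {Φ} → Sel Φ → G
  val []                 = ε
  val ((T , _) ∷ sel)    = σ T ∙ val sel

  select : ∀ Φ {x} → x ∈ X Φ → ∃ λ (sel : Sel Φ) → val sel ≡ x
  select []            refl = [] , refl
  select ((S , m) ∷ Φ) p with ⊕-out (Σs m S) (X Φ) p
  ... | _ , y , (T , T⊑ , len , refl) , q , refl with select Φ q
  ... | sel , refl = ((T , T⊑ , len) ∷ sel) , refl

  τ : Sg → G → ∀ {Φ} → Sel Φ → ℕ
  τ H g []              = 0
  τ H g ((T , _) ∷ sel) = v H g T + τ H g sel

  sum-τ : ∀ H {Φ} (sel : Sel Φ) → sum (λ g → τ H g sel) ≡ tot Φ * ∣ set H ∣
  sum-τ H [] = trans (sum-const N 0) (*-zeroʳ N)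
  sum-τ H {(S , m) ∷ Φ} ((T , _ , refl) ∷ sel) = begin
    sum (λ g → v H g T + τ H g sel)                 ≡⟨ ∑-distrib-+ (λ g → v H g T) (λ g → τ H g sel) ⟩
    sum (λ g → v H g T) + sum (λ g → τ H g sel)     ≡⟨ cong₂ _+_ (trans (sum-v H T) (*-comm ∣ set H ∣ (length T))) (sum-τ H sel) ⟩
    length T * ∣ set H ∣ + tot Φ * ∣ set H ∣        ≡⟨ sym (*-distribʳ-+ ∣ set H ∣ (length T) (tot Φ)) ⟩
    (length T + tot Φ) * ∣ set H ∣                  ∎
    where open ≡-Reasoning

  -- The larger of u and w is absorbed by `m ⊓ V`. In use, V counts the terms of a coset of `H`, u
  -- the chosen ones among them, and w those in a smaller coset.
  min-lemma : ∀ m u V w → u ≤ m → u ≤ V → w ≤ V → m ⊓ w + u ≤ m ⊓ V + u ⊓ w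
  min-lemma m u V w u≤m u≤V w≤V with ≤-total w u
  ... | inj₁ w≤u rewrite m≥n⇒m⊓n≡n w≤u = ≤-trans (+-mono-≤ (m⊓n≤n m w) (⊓-glb u≤m u≤V)) (≤-reflexive (+-comm w (m ⊓ V)))
  ... | inj₂ u≤w rewrite m≤n⇒m⊓n≡m u≤w = +-monoˡ-≤ u (⊓-monoʳ-≤ m w≤V)

  min-split : ∀ k a r → 1 ⊓ a + k ⊓ r ≤ suc k ⊓ (a + r)
  min-split k zero    r = ⊓-monoˡ-≤ r (n≤1+n k)
  min-split k (suc a) r = s≤s (⊓-monoʳ-≤ k (m≤n+m r a))

  -- The loss δ is 1 only if `A` misses the coset and all k + 1 chosen terms lie in it, where the
  -- refined system offers just k. The factor in `suc k * δ ≤ u` lets the total loss be bounded by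
  -- summation.
  min-refined : ∀ k u aH rH aJ rJ → u ≤ suc k → u ≤ aH + rH → aJ ≤ aH → rJ ≤ rH →
    (1 ≤ aH → suc k ⊓ (aH + rH) ≤ 1 + k ⊓ rH) →
    ∃ λ δ → suc k * δ ≤ u × 1 ⊓ aJ + k ⊓ rJ + u ≤ 1 ⊓ aH + k ⊓ rH + u ⊓ (aJ + rJ) + δ
  min-refined k u (suc aH) rH aJ rJ u≤m u≤V a≤ r≤ up = 0 , ≤-trans (≤-reflexive (*-zeroʳ k)) z≤n , (begin
    1 ⊓ aJ + k ⊓ rJ + u                            ≤⟨ +-monoˡ-≤ u (min-split k aJ rJ) ⟩
    suc k ⊓ (aJ + rJ) + u                          ≤⟨ min-lemma (suc k) u (suc aH + rH) (aJ + rJ) u≤m u≤V (+-mono-≤ a≤ r≤) ⟩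
    suc k ⊓ (suc aH + rH) + u ⊓ (aJ + rJ)          ≤⟨ +-monoˡ-≤ (u ⊓ (aJ + rJ)) (up (s≤s z≤n)) ⟩
    1 + k ⊓ rH + u ⊓ (aJ + rJ)                     ≡⟨ sym (+-identityʳ _) ⟩
    1 + k ⊓ rH + u ⊓ (aJ + rJ) + 0                 ∎)
    where open ≤-Reasoning
  min-refined k u zero rH zero rJ u≤m u≤V z≤n r≤ up with u ≤? k
  ... | yes u≤k = 0 , ≤-trans (≤-reflexive (*-zeroʳ k)) z≤n ,
          ≤-trans (min-lemma k u rH rJ u≤k u≤V r≤) (≤-reflexive (sym (+-identityʳ _)))
  ... | no u≰k with ≤-antisym u≤m (≰⇒> u≰k)
  ...   | refl = 1 , ≤-reflexive (*-identityʳ (suc k)) , (begin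
    k ⊓ rJ + suc k                   ≡⟨ +-comm (k ⊓ rJ) (suc k) ⟩
    suc k + k ⊓ rJ                   ≤⟨ s≤s (+-mono-≤ (≤-reflexive (sym (m≤n⇒m⊓n≡m (≤-trans (n≤1+n k) u≤V)))) (⊓-monoˡ-≤ rJ (n≤1+n k))) ⟩
    suc (k ⊓ rH + suc k ⊓ rJ)        ≡⟨ +-comm 1 _ ⟩
    k ⊓ rH + suc k ⊓ rJ + 1          ∎)
    where open ≤-Reasoning

  module Descent (H : Sg) where
    open Local H

    all-G : List G
    all-G = allFin N

    covered : ∀ T → Cover all-G T
    covered T {t} _ = ∈-allFin t

    -- Fixes, in each component, the number of chosen terms per coset of `H`; all sums of the new
    -- system thus stay in the `H`-coset of `val sel`.
    locs : ∀ {Φ} → Sel Φ → Sys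
    locs [] = []
    locs (_∷_ {S = S} (T , _) sel) = loc all-G S T ++ locs sel

    X-++ : ∀ Φ Ψ → X (Φ ++ Ψ) ⊆ X Φ ⊕ X Ψ
    X-++ []            Ψ {x} p = ⊕-in (sg ε) (X Ψ) refl p (identityˡ x)
    X-++ ((S , m) ∷ Φ) Ψ p = ⊕-assoc⁻ (Σs m S) (X Φ) (X Ψ)
      (⊕-mono (Σs m S) (X (Φ ++ Ψ)) (Σs m S) (X Φ ⊕ X Ψ) (λ z → z) (X-++ Φ Ψ) p)

    X-++⁻ : ∀ Φ Ψ → X Φ ⊕ X Ψ ⊆ X (Φ ++ Ψ)
    X-++⁻ []            Ψ p with ⊕-out (sg ε) (X Ψ) p
    ... | _ , y , refl , q , refl = resp (X Ψ) (sym (identityˡ y)) q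
    X-++⁻ ((S , m) ∷ Φ) Ψ p = ⊕-mono (Σs m S) (X Φ ⊕ X Ψ) (Σs m S) (X (Φ ++ Ψ)) (λ z → z) (X-++⁻ Φ Ψ)
      (⊕-assoc (Σs m S) (X Φ) (X Ψ) p)

    tot-++ : ∀ Φ Ψ → tot (Φ ++ Ψ) ≡ tot Φ + tot Ψ
    tot-++ []            Ψ = refl
    tot-++ ((S , m) ∷ Φ) Ψ = trans (cong (m +_) (tot-++ Φ Ψ)) (sym (+-assoc m _ _))

    μ-++ : ∀ Φ Ψ → μ (Φ ++ Ψ) ≡ μ Φ + μ Ψ
    μ-++ []            Ψ = refl
    μ-++ ((S , m) ∷ Φ) Ψ = trans (cong (length S ∸ 1 +_) (μ-++ Φ Ψ)) (sym (+-assoc (length S ∸ 1) _ _))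

    pw-++ : ∀ J g Φ Ψ → pw J g (Φ ++ Ψ) ≡ pw J g Φ + pw J g Ψ
    pw-++ J g []            Ψ = refl
    pw-++ J g ((S , m) ∷ Φ) Ψ = trans (cong (m ⊓ v J g S +_) (pw-++ J g Φ Ψ)) (sym (+-assoc (m ⊓ v J g S) _ _))

    locs-feasible : ∀ {Φ} (sel : Sel Φ) → Feasible (locs sel)
    locs-feasible []                     = []
    locs-feasible ((T , T⊑ , _) ∷ sel) = ++⁺ (loc-feasible all-G T⊑) (locs-feasible sel)

    locs-tot : ∀ {Φ} (sel : Sel Φ) → tot (locs sel) ≡ tot Φ
    locs-tot [] = refl
    locs-tot (_∷_ {S = S} (T , _ , refl) sel) = trans (tot-++ (loc all-G S T) (locs sel))
      (cong₂ _+_ (loc-tot all-G S T (covered T)) (locs-tot sel))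

    locs-in : ∀ {Φ} (sel : Sel Φ) → val sel ∈ X (locs sel)
    locs-in [] = refl
    locs-in (_∷_ {S = S} (T , T⊑ , _) sel) = X-++⁻ (loc all-G S T) (locs sel)
      (⊕-in (X (loc all-G S T)) (X (locs sel)) (loc-in all-G T⊑ (covered T)) (locs-in sel) refl)

    locs-sub : ∀ {Φ} (sel : Sel Φ) → X (locs sel) ⊆ X Φ
    locs-sub [] p = p
    locs-sub (_∷_ {S = S} {Φ = Φ} (T , T⊑ , refl) sel) p =
      ⊕-mono (X (loc all-G S T)) (X (locs sel)) (Σs (length T) S) (X Φ)
        (loc-sub all-G S T (covered T)) (locs-sub sel) (X-++ (loc all-G S T) (locs sel) p)

    locs-coset : ∀ {Φ} (sel : Sel Φ) {y} → y ∈ X (locs sel) → y - val sel ∈ set H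
    locs-coset [] refl = refl∈ H
    locs-coset (_∷_ {S = S} (T , T⊑ , _) sel) p
      with ⊕-out (X (loc all-G S T)) (X (locs sel)) (X-++ (loc all-G S T) (locs sel) p)
    ... | a , b , q , r , refl = add∈ H (loc-coset all-G S T (covered T) q) (locs-coset sel r)

    locs-μ : ∀ {Φ} (sel : Sel Φ) → μ (locs sel) < μ Φ ⊎
      (μ (locs sel) ≤ μ Φ × (∀ {x y} → x ∈ X Φ → y ∈ X Φ → x - y ∈ set H))
    locs-μ [] = inj₂ (z≤n , λ { refl refl → refl∈ H })
    locs-μ (_∷_ {S = S} {m} {Φ} (T , T⊑ , _) sel) rewrite μ-++ (loc all-G S T) (locs sel)
      with loc-μ all-G S T (covered S) | locs-μ sel
    ... | inj₁ lt       | inj₁ lt′       = inj₁ (+-mono-< lt lt′)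
    ... | inj₁ lt       | inj₂ (le , _)  = inj₁ (+-mono-<-≤ lt le)
    ... | inj₂ (le , _) | inj₁ lt        = inj₁ (+-mono-≤-< le lt)
    ... | inj₂ (le , same) | inj₂ (le′ , same′) = inj₂ (+-mono-≤ le le′ , all)
      where
      all : ∀ {x y} → x ∈ Σs m S ⊕ X Φ → y ∈ Σs m S ⊕ X Φ → x - y ∈ set H
      all p q with ⊕-out (Σs m S) (X Φ) p | ⊕-out (Σs m S) (X Φ) q
      ... | a , b , a∈ , b∈ , refl | c , d , c∈ , d∈ , refl = add∈ H (Σs-coset S m same a∈ c∈) (same′ b∈ d∈)

    module _ (J : Sg) (J⊆H : set J ⊆ set H) where
      part-pw : ∀ g S T m → T ⊑ S → length T ≡ m →
        m ⊓ v J g S + v H g T ≤ m ⊓ v H g S + pw J g (loc all-G S T)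
      part-pw g S T m T⊑ refl = ≤-trans
        (min-lemma (length T) (v H g T) (v H g S) (v J g S) (v≤length H g T) (v-⊑ H g T⊑) (v-mono J H J⊆H (refl∈ H) S))
        (+-monoʳ-≤ (length T ⊓ v H g S) (loc-pw J J⊆H g all-G S T (∈-allFin g)))

      plain-pw : ∀ g {Φ} (sel : Sel Φ) → pw J g Φ + τ H g sel ≤ pw H g Φ + pw J g (locs sel)
      plain-pw g [] = z≤n
      plain-pw g (_∷_ {S = S} {m} {Φ} (T , T⊑ , len) sel) rewrite pw-++ J g (loc all-G S T) (locs sel) =
        lin≤ 0 (part-pw g S T m T⊑ len ⊕≤ plain-pw g sel)
          (eq (m ⊓ v J g S) (pw J g Φ) (v H g T) (τ H g sel) (m ⊓ v H g S) (pw H g Φ) (pw J g (loc all-G S T)) (pw J g (locs sel)))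
        where
        eq : ∀ a b c d a′ b′ c′ d′ → a + b + (c + d) + (a′ + c′ + (b′ + d′)) + 0 ≡ a′ + b′ + (c′ + d′) + (a + c + (b + d))
        eq = solve-∀

      -- The choice `sel` is made in the unrefined system while the weights belong to the refined
      -- one. Only the refined component costs δ; all others obey `part-pw`.
      refined-pw : ∀ {W Φ Ψ} → set W ⊆ set H → Refine W Φ Ψ → (sel : Sel Φ) →
        ∃ λ (δ : G → ℕ) → sum δ ≤ ∣ set H ∣ ×
          (∀ g → pw J g Ψ + τ H g sel ≤ pw H g Ψ + pw J g (locs sel) + δ g)
      refined-pw W⊆H (there {S , m} {Φ} {Ψ} r) ((T , T⊑ , len) ∷ sel) with refined-pw W⊆H r sel
      ... | δ , sδ , f = δ , sδ , λ g → ≤-trans (lin≤ 0 (part-pw g S T m T⊑ len ⊕≤ f g)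
              (eq (m ⊓ v J g S) (pw J g Ψ) (v H g T) (τ H g sel) (m ⊓ v H g S) (pw H g Ψ) (pw J g (loc all-G S T)) (pw J g (locs sel)) (δ g)))
            (≤-reflexive (cong (λ t → m ⊓ v H g S + pw H g Ψ + t + δ g) (sym (pw-++ J g (loc all-G S T) (locs sel)))))
        where
        eq : ∀ a b c d a′ b′ c′ d′ e → a + b + (c + d) + (a′ + c′ + (b′ + d′ + e)) + 0 ≡ a′ + b′ + (c′ + d′) + e + (a + c + (b + d))
        eq = solve-∀
      refined-pw {W} W⊆H (here {S} {k} {Φ} p) (_∷_ (T , T⊑ , len) sel) = δ , sδ , main
        where
        open Pick p
        core : ∀ g → ∃ λ δ → suc (suc k) * δ ≤ v H g T ×
          1 ⊓ v J g A + suc k ⊓ v J g R + v H g T ≤ 1 ⊓ v H g A + suc k ⊓ v H g R + v H g T ⊓ (v J g A + v J g R) + δ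
        core g = min-refined (suc k) (v H g T) (v H g A) (v H g R) (v J g A) (v J g R)
          (≤-trans (v≤length H g T) (≤-reflexive len)) (≤-trans (v-⊑ H g T⊑) (≤-reflexive (split-v H g split)))
          (v-mono J H J⊆H (refl∈ H) A) (v-mono J H J⊆H (refl∈ H) R) (upper H g W⊆H)
        δ : G → ℕ
        δ g = proj₁ (core g)
        -- The values (k + 2)δ are bounded by multiplicities of `T`, whose total is (k + 2)|H|; so
        -- the loss amounts to at most one coset.
        sδ : sum δ ≤ ∣ set H ∣
        sδ = *-cancelˡ-≤ (suc (suc k)) (begin
          suc (suc k) * sum δ                 ≡⟨ *-distribˡ-sum (suc (suc k)) δ ⟩
          sum (λ g → suc (suc k) * δ g)       ≤⟨ sum-mono (λ g → proj₁ (proj₂ (core g))) ⟩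
          sum (λ g → v H g T)                 ≡⟨ sum-v H T ⟩
          ∣ set H ∣ * length T                ≡⟨ trans (cong (∣ set H ∣ *_) len) (*-comm ∣ set H ∣ (suc (suc k))) ⟩
          suc (suc k) * ∣ set H ∣             ∎)
          where open ≤-Reasoning
        main : ∀ g → (1 ⊓ v J g A + (suc k ⊓ v J g R + pw J g Φ)) + (v H g T + τ H g sel) ≤
          (1 ⊓ v H g A + (suc k ⊓ v H g R + pw H g Φ)) + pw J g (locs ((T , T⊑ , len) ∷ sel)) + δ g
        main g = ≤-trans (lin≤ 0 (proj₂ (proj₂ (core g)) ⊕≤ plain-pw g sel ⊕≤ loc≤)
            (eq (1 ⊓ v J g A) (suc k ⊓ v J g R) (pw J g Φ) (v H g T) (τ H g sel) (1 ⊓ v H g A) (suc k ⊓ v H g R) (pw H g Φ)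
                (v H g T ⊓ (v J g A + v J g R)) (pw J g (loc all-G S T)) (pw J g (locs sel)) (δ g)))
          (≤-reflexive (cong (λ t → (1 ⊓ v H g A + (suc k ⊓ v H g R + pw H g Φ)) + t + δ g) (sym (pw-++ J g (loc all-G S T) (locs sel)))))
          where
          loc≤ : v H g T ⊓ (v J g A + v J g R) ≤ pw J g (loc all-G S T)
          loc≤ = ≤-trans (≤-reflexive (cong (v H g T ⊓_) (sym (split-v J g split)))) (loc-pw J J⊆H g all-G S T (∈-allFin g))
          eq : ∀ a b c t u a′ b′ c′ x y z e →
            a + (b + c) + (t + u) + (a′ + b′ + x + e + (c′ + z) + y) + 0 ≡
            a′ + (b′ + c′) + (y + z) + e + (a + b + t + (c + u) + x)
          eq = solve-∀

      refined-wt : ∀ {W Φ Ψ} → set W ⊆ set H → Refine W Φ Ψ → (sel : Sel Φ) →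
        wt J Ψ + tot Φ * ∣ set H ∣ ≤ wt H Ψ + wt J (locs sel) + ∣ set H ∣
      refined-wt {W} {Φ} {Ψ} W⊆H r sel with refined-pw W⊆H r sel
      ... | δ , sδ , f = begin
        wt J Ψ + tot Φ * ∣ set H ∣                               ≡⟨ cong (wt J Ψ +_) (sym (sum-τ H sel)) ⟩
        wt J Ψ + sum (λ g → τ H g sel)                           ≡⟨ sym (∑-distrib-+ (λ g → pw J g Ψ) (λ g → τ H g sel)) ⟩
        sum (λ g → pw J g Ψ + τ H g sel)                         ≤⟨ sum-mono f ⟩
        sum (λ g → pw H g Ψ + pw J g (locs sel) + δ g)           ≡⟨ ∑-distrib-+ (λ g → pw H g Ψ + pw J g (locs sel)) δ ⟩
        sum (λ g → pw H g Ψ + pw J g (locs sel)) + sum δ         ≡⟨ cong (_+ sum δ) (∑-distrib-+ (λ g → pw H g Ψ) (λ g → pw J g (locs sel))) ⟩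
        wt H Ψ + wt J (locs sel) + sum δ                         ≤⟨ +-monoʳ-≤ _ sδ ⟩
        wt H Ψ + wt J (locs sel) + ∣ set H ∣                     ∎
        where open ≤-Reasoning

-- The DeVos-Goddyn-Mohar theorem for systems.

module DeVosGoddynMohar {N : ℕ} (𝔾 : FinAb N) where
  open Sets 𝔾
  open Kneser 𝔾
  open SubsequenceSums 𝔾
  open Localisation 𝔾

  descent-arith : ∀ wHΨ wJΨ wJL h j c d cd n →
    wHΨ + h ≤ c + n * h → wJL + j ≤ d + n * j → wJΨ + n * h ≤ wHΨ + wJL + h → c + d ≤ cd →
    wJΨ + j ≤ cd + n * j
  descent-arith wHΨ wJΨ wJL h j c d cd n h₁ h₂ h₃ h₄ = lin≤ 0 (h₁ ⊕≤ h₂ ⊕≤ h₃ ⊕≤ h₄) (eq wHΨ wJΨ wJL h j c d cd (n * h) (n * j))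
    where
    eq : ∀ a b e h j c d cd nh nj →
      b + j + (c + nh + (d + nj) + (a + e + h) + cd) + 0 ≡ cd + nj + (a + h + (e + j) + (b + nh) + (c + d))
    eq = solve-∀

  mutual
    -- Replacing `W` by the exact stabiliser `H` does not change X Φ + W, which reduces the claim to
    -- W = H.
    dgm-acc : ∀ Φ W H → Feasible Φ → IsStab H (X Φ ⊕ set W) → Acc _<_ (μ Φ) → Bound Φ W H
    dgm-acc Φ W H fs s ac = ≤-trans (dgm-exact Φ H fs (isStab-cong H (X Φ ⊕ set W) (X Φ ⊕ set H) grow shrink s) ac)
      (+-monoˡ-≤ (tot Φ * ∣ set H ∣) (card-mono (X Φ ⊕ set H) (X Φ ⊕ set W) shrink))
      where
      W⊆H : set W ⊆ set H
      W⊆H {w} p = least s {w} (per-stab W (X Φ ⊕ set W) (per-⊕ W (X Φ)) {w} p)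
      grow : X Φ ⊕ set W ⊆ X Φ ⊕ set H
      grow = ⊕-mono (X Φ) (set W) (X Φ) (set H) (λ p → p) (λ {w} → W⊆H {w})
      shrink : X Φ ⊕ set H ⊆ X Φ ⊕ set W
      shrink p with ⊕-out (X Φ) (set H) p
      ... | a , h , a∈ , h∈ , refl = per s (⊆-⊕ W (X Φ) a∈) h∈

    -- Induction bounds the refined system at a possibly larger stabiliser, and `descend` lowers it
    -- to `W`. Its invariant is a set `C` of sums with periods `H` on which the bound at `H` holds.
    -- While `H` is not a group of periods of X Φ + W, some coset of `H` is met but not filled;
    -- localising there yields a piece disjoint from `C` with a smaller stabiliser `J`, and the
    -- union obeys the bound at `J`.
    dgm-exact : ∀ Φ W → Feasible Φ → IsStab W (X Φ ⊕ set W) → Acc _<_ (μ Φ) → Bound Φ W W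
    dgm-exact Φ W fs s (acc rec) with refine W Φ fs
    ... | inj₁ flat    = flat-bound Φ W W fs flat s
    ... | inj₂ (Ψ , r) = ≤-trans (+-monoˡ-≤ ∣ set W ∣ (sum-mono (refine-pw r)))
        (descend K (X Ψ ⊕ set W) W⊆K (⊕-mono (X Ψ) (set W) (X Φ) (set W) (refine-X r) (λ p → p)) (stab-per (X Ψ ⊕ set W))
          (⨁-inhabited-⊕ , start) (<-wellFounded _))
      where
      fsΨ : Feasible Ψ
      fsΨ = refine-feasible r fs
      K : Sg
      K = stab (X Ψ ⊕ set W)
      W⊆K : set W ⊆ set K
      W⊆K {w} = per-stab W (X Ψ ⊕ set W) (per-⊕ W (X Ψ)) {w}
      ⨁-inhabited-⊕ : Inhabited (X Ψ ⊕ set W)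
      ⨁-inhabited-⊕ with ⨁-inhabited (sets Ψ) (sets-inhabited Ψ fsΨ)
      ... | y , y∈ = y , ⊆-⊕ W (X Ψ) y∈
      start : wt K Ψ + ∣ set K ∣ ≤ ∣ X Ψ ⊕ set W ∣ + tot Φ * ∣ set K ∣
      start = subst (λ n → wt K Ψ + ∣ set K ∣ ≤ ∣ X Ψ ⊕ set W ∣ + n * ∣ set K ∣) (refine-tot r)
        (dgm-acc Ψ W K fsΨ (stab-isStab (X Ψ ⊕ set W)) (rec (refine-μ r)))

      descend : ∀ H C → set W ⊆ set H → C ⊆ X Φ ⊕ set W → Per H C →
        Inhabited C × (wt H Ψ + ∣ set H ∣ ≤ ∣ C ∣ + tot Φ * ∣ set H ∣) → Acc _<_ ∣ set H ∣ →
        wt W Ψ + ∣ set W ∣ ≤ ∣ X Φ ⊕ set W ∣ + tot Φ * ∣ set W ∣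
      descend H C W⊆H C⊆ pC ((c , c∈) , bd) (acc recH) with ⊆-dec (set H) (set (stab (X Φ ⊕ set W)))
      -- Here `H` and `W` coincide, as `W` is the full stabiliser.
      ... | yes f = ≤-trans (+-mono-≤ (wt-mono W H W⊆H Ψ) (card-mono (set W) (set H) W⊆H))
              (≤-trans bd (+-mono-≤ (card-mono C (X Φ ⊕ set W) C⊆)
                (*-monoʳ-≤ (tot Φ) (card-mono (set H) (set W) (λ {h} p → least s {h} (f h p))))))
      ... | no ¬f with not-per H (X Φ ⊕ set W) (λ f → ¬f (λ h → f {h}))
      ...   | x , h , x∈ , h∈ , xh∉ with ⊕-out (X Φ) (set W) x∈
      ...     | x′ , w , x′∈ , w∈ , refl with select Φ x′∈
      ...       | sel , refl = descend J (C ∪ D) W⊆J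
                    (λ { (inj₁ p) → C⊆ p ; (inj₂ p) → D⊆ p })
                    (per-∪ J C D (per-weaken J H C (λ {j} → J⊆H {j}) pC) (stab-per D))
                    ((c , inj₁ c∈) ,
                      descent-arith (wt H Ψ) (wt J Ψ) (wt J L) (∣ set H ∣) (∣ set J ∣) (∣ C ∣) (∣ D ∣) (∣ C ∪ D ∣) (tot Φ)
                        bd
                        (subst (λ n → wt J L + ∣ set J ∣ ≤ ∣ D ∣ + n * ∣ set J ∣) (locs-tot sel)
                          (dgm-acc L W J (locs-feasible sel) (stab-isStab D) (rec μL)))
                        (refined-wt J (λ {j} → J⊆H {j}) W⊆H r sel)
                        (card-disjoint C D (C ∪ D) dis inj₁ inj₂))
                    (recH J<H)
        where
        open Descent H
        L : _
        L = locs sel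
        D : Sub
        D = X L ⊕ set W
        J : Sg
        J = stab D
        D⊆ : D ⊆ X Φ ⊕ set W
        D⊆ = ⊕-mono (X L) (set W) (X Φ) (set W) (locs-sub sel) (λ p → p)
        x∈D : val sel ∙ w ∈ D
        x∈D = ⊕-in (X L) (set W) (locs-in sel) w∈ refl
        D~ : ∀ {d} → d ∈ D → d - val sel ∙ w ∈ set H
        D~ p with ⊕-out (X L) (set W) p
        ... | y , u , y∈ , u∈ , refl = add∈ H (locs-coset sel y∈) (-∈ H (W⊆H u∈) (W⊆H w∈))
        W⊆J : set W ⊆ set J
        W⊆J {u} = per-stab W D (per-⊕ W (X L)) {u}
        J⊆H : set J ⊆ set H
        J⊆H {j} p = resp (set H) (lem (val sel ∙ w) j) (D~ (p _ x∈D))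
          where
          lem : ∀ x j → x ∙ j - x ≡ j
          lem = group 2 (λ x j → x ⊞ j ⊟ x ⊜ j) refl
        J<H : ∣ set J ∣ < ∣ set H ∣
        J<H = card-strict (set J) (set H) {h} (λ {j} → J⊆H {j}) h∈ (λ q → xh∉ (D⊆ (q _ x∈D)))
        -- `C` is `H`-periodic inside X Φ + W, so it has no point in a coset that X Φ + W does not
        -- fill.
        x∉C : val sel ∙ w ∉ C
        x∉C p = xh∉ (C⊆ (pC p h∈))
        dis : Disjoint C D
        dis p q = x∉C (per-~ H C pC p (flip∈ H (D~ q)))
        -- If `μ` did not drop, all sums would share one `H`-coset with the nonempty `C`, and the
        -- chosen point would lie in `C`.
        μL : μ L < μ Φ
        μL with locs-μ sel
        ... | inj₁ lt = lt
        ... | inj₂ (_ , same) with ⊕-out (X Φ) (set W) (C⊆ c∈)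
        ...   | y , u , y∈ , u∈ , refl = ⊥-elim (x∉C (per-~ H C pC c∈
                  (add∈ H (same x′∈ y∈) (-∈ H (W⊆H w∈) (W⊆H u∈)))))

  dgm : ∀ Φ W H → Feasible Φ → IsStab H (X Φ ⊕ set W) → Bound Φ W H
  dgm Φ W H fs s = dgm-acc Φ W H fs s (<-wellFounded (μ Φ))

-- Critical sets and 2-atoms modulo a subgroup `M`.

module CriticalSets {N : ℕ} (𝔾 : FinAb N) where
  open Sets 𝔾
  open Kneser 𝔾

  ∣⊹⊕∣ : ∀ U B g → ∣ (U ⊹ g) ⊕ B ∣ ≡ ∣ U ⊕ B ∣
  ∣⊹⊕∣ U B g = trans (card-cong ((U ⊹ g) ⊕ B) ((U ⊕ B) ⊹ g) to from) (card-⊹ (U ⊕ B) g)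
    where
    to : (U ⊹ g) ⊕ B ⊆ (U ⊕ B) ⊹ g
    to p with ⊕-out (U ⊹ g) B p
    ... | a , b , q , r , refl = ⊕-in U B q r (lem a b g)
      where
      lem : ∀ a b g → (a - g) ∙ b ≡ a ∙ b - g
      lem = group 3 (λ a b g → (a ⊟ g) ⊞ b ⊜ a ⊞ b ⊟ g) refl
    from : (U ⊕ B) ⊹ g ⊆ (U ⊹ g) ⊕ B
    from {x} p with ⊕-out U B p
    ... | a , b , q , r , eq = ⊕-in (U ⊹ g) B (⊹-in U g q) r (trans (lem a b g) (trans (∙ʳ eq) (x-g∙g x g)))
      where
      lem : ∀ a b g → a ∙ g ∙ b ≡ a ∙ b ∙ g
      lem = group 3 (λ a b g → a ⊞ g ⊞ b ⊜ a ⊞ b ⊞ g) refl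

  ∣⊕∣-comm : ∀ A B → ∣ A ⊕ B ∣ ≡ ∣ B ⊕ A ∣
  ∣⊕∣-comm A B = card-cong (A ⊕ B) (B ⊕ A) (⊕-comm A B) (⊕-comm B A)

  module Critical (M : Sg) where
    w : ℕ
    w = ∣ set M ∣

    atMostOne : ∀ A → Per M A → ∣ A ∣ < w + w → ∣ A ∣ ≤ w
    atMostOne A pA lt with lagrange M A pA
    ... | zero        , eq = ≤-trans (≤-reflexive eq) z≤n
    ... | suc zero    , eq = ≤-reflexive (trans eq (+-identityʳ w))
    ... | suc (suc k) , eq = ⊥-elim (n≮n _ (≤-trans (s≤s (≤-trans (m≤m+n (w + w) (k * w))
                                (≤-reflexive (trans (+-assoc w w (k * w)) (sym eq))))) lt))

    atMostTwo : ∀ A → Per M A → ∣ A ∣ < w + w + w → ∣ A ∣ ≤ w + w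
    atMostTwo A pA lt with lagrange M A pA
    ... | zero              , eq = ≤-trans (≤-reflexive eq) z≤n
    ... | suc zero          , eq = ≤-trans (≤-reflexive (trans eq (+-identityʳ w))) (m≤m+n w w)
    ... | suc (suc zero)    , eq = ≤-reflexive (trans eq (cong (w +_) (+-identityʳ w)))
    ... | suc (suc (suc k)) , eq = ⊥-elim (n≮n _ (≤-trans (s≤s (≤-trans (m≤m+n (w + w + w) (k * w))
                                (≤-reflexive (trans (lem w (k * w)) (sym eq))))) lt))
      where
      lem : ∀ w k → w + w + w + k ≡ w + (w + (w + k))
      lem = solve-∀

    another : ∀ A {x} → Per M A → w < ∣ A ∣ → ∃ λ y → y ∈ A × y - x ∉ set M
    another A {x} pA lt = ⊈-witness A (cos M x) (λ f → n≮n _ (≤-trans lt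
      (≤-trans (card-mono A (cos M x) f) (≤-reflexive (card-⊹ (set M) x)))))

    -- In the `K`-cosets that it meets, B has more than |K| - |M| holes. Excluded are the sets that
    -- modulo M are `K`-periodic up to fewer than |K/M| holes.
    NonDeg : Sg → Sub → Set₁
    NonDeg L B = ∀ K → set M ⊆ set K → ¬ (set K ⊆ set M) → set K ⊆ set L → ¬ (set L ⊆ set K) →
      ∣ set K ∣ + ∣ B ∣ < ∣ B ⊕ set K ∣ + w

    -- A Sidon condition modulo M: for M-periodic U, distinct translates share at most one coset of
    -- M. It is the intersection property of 2-atoms and stands in for their minimality.
    Sid : Sg → Sub → Set
    Sid L U = ∀ {g} → g ∈ set L → g ∉ set M → ∣ U ∩ (U ⊹ g) ∣ < w + w

    -- Modulo M this says |U + B| ≤ |U| + |B| - 1, with at least two elements in U and at least two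
    -- of L missing from U + B: the situation of Vosper's theorem.
    record Crit (L : Sg) (B U : Sub) : Set where
      field
        perM  : Per M U
        inL   : U ⊆ set L
        big   : w + w ≤ ∣ U ∣
        small : ∣ U ⊕ B ∣ + w ≤ ∣ U ∣ + ∣ B ∣
        room  : ∣ U ⊕ B ∣ + (w + w) ≤ ∣ set L ∣

      inhabited : Inhabited U
      inhabited = card-inhabited U (≤-trans (≤-trans (Sg>0 M) (m≤m+n w w)) big)
    open Crit

    -- For d in K outside M, both U and U + d lie in U + K and overlap in less than 2w, so 2|U| < |U
    -- + K| + 2w; degeneracy at K would then force |U + K| < 2|K|.
    sidon-nondeg : ∀ L U K → Sid L U → ¬ (set K ⊆ set M) → set K ⊆ set L →
      ∣ set K ∣ + ∣ set K ∣ ≤ ∣ U ⊕ set K ∣ → ∣ set K ∣ + ∣ U ∣ < ∣ U ⊕ set K ∣ + w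
    sidon-nondeg L U K sid K⊈M K⊆L two with ∣ set K ∣ + ∣ U ∣ <? ∣ U ⊕ set K ∣ + w
    ... | yes p = p
    ... | no ¬p with ⊈-witness (set K) (set M) K⊈M
    ...   | d , d∈K , d∉M = ⊥-elim (ar (∣ U ∣) (∣ U ⊕ set K ∣) (∣ set K ∣) (∣ U ∩ (U ⊹ d) ∣) w cover (sid (K⊆L d∈K) d∉M) (≮⇒≥ ¬p) two)
      where
      cover : ∣ U ∣ + ∣ U ∣ ≤ ∣ U ⊕ set K ∣ + ∣ U ∩ (U ⊹ d) ∣
      cover = ≤-trans (≤-reflexive (trans (cong (∣ U ∣ +_) (sym (card-⊹ U d))) (sym (card-∪∩ U (U ⊹ d)))))
        (+-monoˡ-≤ _ (card-mono (U ∪ (U ⊹ d)) (U ⊕ set K)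
          (λ { (inj₁ p) → ⊆-⊕ K U p ; (inj₂ p) → ⊕-in U (set K) p d∈K (x-g∙g _ d) })))
      ar : ∀ u c k i w → u + u ≤ c + i → i < w + w → c + w ≤ k + u → k + k ≤ c → ⊥
      ar u c k i w h₁ h₂ h₃ h₄ = lin⊥ 0 (h₁ ⊕≤ h₂ ⊕≤ (h₃ ⊕≤ h₃) ⊕≤ h₄) (eq u c k i w)
        where
        eq : ∀ u c k i w → c + i + (w + w) + (k + u + (k + u)) + c + 1 ≡ u + u + suc i + (c + w + (c + w)) + (k + k)
        eq = solve-∀

    module InL (L : Sg) where
      sum-in-L : ∀ U B → U ⊆ set L → B ⊆ set L → U ⊕ B ⊆ set L
      sum-in-L U B f g p with ⊕-out U B p
      ... | a , b , q , r , refl = ∙∈ L (f q) (g r)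

      stab-in-L : ∀ Z → Inhabited Z → Z ⊆ set L → set (stab Z) ⊆ set L
      stab-in-L Z (z , z∈) f {h} p = resp (set L) (lem z h) (-∈ L (f (p z z∈)) (f z∈))
        where
        lem : ∀ z h → z ∙ h - z ≡ h
        lem = group 2 (λ z h → z ⊞ h ⊟ z ⊜ h) refl

      stab-proper : ∀ Z → Inhabited Z → Z ⊆ set L → ¬ (set L ⊆ Z) → ¬ (set L ⊆ set (stab Z))
      stab-proper Z (z , z∈) f ¬full full = ¬full (λ {y} y∈ →
        per-~ (stab Z) Z (stab-per Z) z∈ (full (-∈ L y∈ (f z∈))))

      not-full : ∀ Z → ∣ Z ∣ < ∣ set L ∣ → ¬ (set L ⊆ Z)
      not-full Z lt f = n≮n _ (≤-trans lt (card-mono (set L) Z f))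

      module _ (B : Sub) (B⊆L : B ⊆ set L) (ihB : Inhabited B) (nd : NonDeg L B) where

        -- If the stabiliser of U + B exceeds M, non-degeneracy of `B` at it turns Kneser's bound
        -- into a strict one. Otherwise the stabiliser has at most w elements.
        kn-both : ∀ U → U ⊆ set L → Per M U → Inhabited U → ¬ (set L ⊆ U ⊕ B) →
          (∣ U ∣ + ∣ B ∣ ≤ ∣ U ⊕ B ∣ + w) × (∀ {k} → k ∈ set (stab (U ⊕ B)) → k ∉ set M → ∣ U ∣ + ∣ B ∣ < ∣ U ⊕ B ∣ + w)
        kn-both U U⊆L pU (u , u∈) ¬full = by-cases (⊆-dec (set K) (set M))
          where
          Z = U ⊕ B
          K = stab Z
          ihZ : Inhabited Z
          ihZ = u ∙ proj₁ ihB , ⊕-in U B u∈ (proj₂ ihB) refl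
          Z⊆L : Z ⊆ set L
          Z⊆L = sum-in-L U B U⊆L B⊆L
          kns : ∣ U ⊕ set K ∣ + ∣ B ⊕ set K ∣ ≤ ∣ Z ∣ + ∣ set K ∣
          kns = kneser U B K u∈ (proj₂ ihB) (stab-isStab Z)
          strict : ¬ (set K ⊆ set M) → ∣ U ∣ + ∣ B ∣ < ∣ Z ∣ + w
          strict K⊈M = ar (∣ U ∣) (∣ B ∣) (∣ U ⊕ set K ∣) (∣ B ⊕ set K ∣) (∣ Z ∣) (∣ set K ∣) w
            kns (nd K (λ {x} → per-stab M Z (per-sumˡ M U B pU) {x}) K⊈M (λ {x} → stab-in-L Z ihZ Z⊆L {x}) (stab-proper Z ihZ Z⊆L ¬full)) (card-⊆-⊕ K U)
            where
            ar : ∀ u b uk bk z k w → uk + bk ≤ z + k → k + b < bk + w → u ≤ uk → u + b < z + w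
            ar u b uk bk z k w h₁ h₂ h₃ = lin≤ 0 (h₁ ⊕≤ h₂ ⊕≤ h₃) (eq u b uk bk z k w)
              where
              eq : ∀ u b uk bk z k w → suc (u + b) + (z + k + (bk + w) + uk) + 0 ≡ z + w + (uk + bk + suc (k + b) + u)
              eq = solve-∀
          by-cases : Dec (∀ x → x ∈ set K → x ∈ set M) → (∣ U ∣ + ∣ B ∣ ≤ ∣ Z ∣ + w) × (∀ {k} → k ∈ set K → k ∉ set M → ∣ U ∣ + ∣ B ∣ < ∣ Z ∣ + w)
          by-cases (yes f) = ≤-trans (+-mono-≤ (card-⊆-⊕ K U) (card-⊆-⊕ K B))
              (≤-trans kns (+-monoʳ-≤ ∣ Z ∣ (card-mono (set K) (set M) (λ {x} → f x)))) ,
            λ {k} k∈ k∉ → ⊥-elim (k∉ (f k k∈))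
          by-cases (no ¬f) = <⇒≤ (strict (λ f → ¬f (λ x → f {x}))) , λ _ _ → strict (λ f → ¬f (λ x → f {x}))

        kn : ∀ U → U ⊆ set L → Per M U → Inhabited U → ¬ (set L ⊆ U ⊕ B) → ∣ U ∣ + ∣ B ∣ ≤ ∣ U ⊕ B ∣ + w
        kn U f p i n = proj₁ (kn-both U f p i n)

        -- Instead of taking a critical set of minimal size, shrink: a critical set with a large
        -- self-intersection, or larger than its dual, yields a smaller critical set.
        atom-acc : ∀ U → Crit L B U → Acc _<_ ∣ U ∣ → Σ Sub λ V → Crit L B V × Sid L V
        atom-acc U c (acc rec) = step (∣ D ∣ <? ∣ U ∣)
          (any? (λ g → dec (set L) g ×-dec (¬? (dec (set M) g) ×-dec (w + w ≤? ∣ U ∩ (U ⊹ g) ∣))))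
          where
          Z D : Sub
          Z = U ⊕ B
          D = set L ∖ Z
          Z⊆L : Z ⊆ set L
          Z⊆L = sum-in-L U B (inL c) B⊆L
          D+Z : ∣ D ∣ + ∣ Z ∣ ≡ ∣ set L ∣
          D+Z = trans (cong (∣ D ∣ +_) (card-cong Z (set L ∩ Z) (λ p → Z⊆L p , p) proj₂)) (card-∖∩ (set L) Z)
          perZ : Per M Z
          perZ = per-sumˡ M U B (perM c)
          Z<L : ∣ Z ∣ < ∣ set L ∣
          Z<L = ≤-trans (≤-trans (≤-reflexive (+-comm 1 ∣ Z ∣)) (+-monoʳ-≤ ∣ Z ∣ (≤-trans (Sg>0 M) (m≤m+n w w)))) (room c)
          -- The sum of `B` and the negated complement of U + B avoids -U; this gives `small`, and
          -- |U| ≥ 2w gives `room`.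
          dual : Crit L B (⊖ D)
          dual = record
            { perM  = per-⊖ M D (per-∖ M (set L) Z (per-self M L M⊆L) perZ)
            ; inL   = λ p → resp (set L) (⁻¹-involutive _) (⁻¹∈ L (proj₁ p))
            ; big   = ≤-trans (+-cancelˡ-≤ ∣ Z ∣ _ _ (≤-trans (room c) (≤-reflexive (trans (sym D+Z) (+-comm ∣ D ∣ ∣ Z ∣)))))
                        (≤-reflexive (sym (card-⊖ D)))
            ; small = ≤-trans (ar (∣ (⊖ D) ⊕ B ∣) (∣ Z ∣) (∣ U ∣) (∣ D ∣) (∣ B ∣) (∣ set L ∣) w D′ (≤-reflexive (sym D+Z)) (small c))
                        (≤-reflexive (cong (_+ ∣ B ∣) (sym (card-⊖ D))))
            ; room  = ≤-trans (+-monoʳ-≤ ∣ (⊖ D) ⊕ B ∣ (big c)) D′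
            }
            where
            M⊆L : set M ⊆ set L
            M⊆L {x} p = stab-in-L U (inhabited c) (inL c) {x} (per-stab M U (perM c) {x} p)
            D′ : ∣ (⊖ D) ⊕ B ∣ + ∣ U ∣ ≤ ∣ set L ∣
            D′ = ≤-trans (≤-reflexive (cong (∣ (⊖ D) ⊕ B ∣ +_) (sym (card-⊖ U))))
              (card-disjoint ((⊖ D) ⊕ B) (⊖ U) (set L) dis
                (sum-in-L (⊖ D) B (λ p → resp (set L) (⁻¹-involutive _) (⁻¹∈ L (proj₁ p))) B⊆L)
                (λ p → resp (set L) (⁻¹-involutive _) (⁻¹∈ L (inL c p))))
              where
              dis : Disjoint ((⊖ D) ⊕ B) (⊖ U)
              dis p q with ⊕-out (⊖ D) B p
              ... | a , b , (_ , a∉) , b∈ , refl = a∉ (⊕-in U B q b∈ (lem a b))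
                where
                lem : ∀ a b → (a ∙ b) ⁻¹ ∙ b ≡ a ⁻¹
                lem = group 2 (λ a b → inv (a ⊞ b) ⊞ b ⊜ inv a) refl
            ar : ∀ x z u d b l w → x + u ≤ l → l ≤ d + z → z + w ≤ u + b → x + w ≤ d + b
            ar x z u d b l w h₁ h₂ h₃ = lin≤ 0 (h₁ ⊕≤ h₂ ⊕≤ h₃) (eq x z u d b l w)
              where
              eq : ∀ x z u d b l w → x + w + (l + (d + z) + (u + b)) + 0 ≡ d + b + (x + u + l + (z + w))
              eq = solve-∀
          step : Dec (∣ D ∣ < ∣ U ∣) → Dec (∃ λ g → g ∈ set L × g ∉ set M × w + w ≤ ∣ U ∩ (U ⊹ g) ∣) →
            Σ Sub λ V → Crit L B V × Sid L V
          step (yes lt) _ = atom-acc (⊖ D) dual (rec (≤-trans (s≤s (≤-reflexive (card-⊖ D))) lt))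
          step (no _)  (no ¬e) = U , c , λ g∈ g∉ → ≰⇒> (λ le → ¬e (_ , g∈ , g∉ , le))
          step (no nlt) (yes (g , g∈ , g∉ , le)) = atom-acc I critI (rec I<U)
            where
            I V Zg : Sub
            I  = U ∩ (U ⊹ g)
            V  = U ∪ (U ⊹ g)
            Zg = Z ⊹ g
            U+Z : ∣ U ∣ + ∣ Z ∣ ≤ ∣ set L ∣
            U+Z = ≤-trans (+-monoˡ-≤ ∣ Z ∣ (≮⇒≥ nlt)) (≤-reflexive D+Z)
            ihI : Inhabited I
            ihI = card-inhabited I (≤-trans (≤-trans (Sg>0 M) (m≤m+n w w)) le)
            shift⊆ : (U ⊹ g) ⊕ B ⊆ Zg
            shift⊆ p with ⊕-out (U ⊹ g) B p
            ... | a , b , q , r , refl = ⊕-in U B q r (lem a b g)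
              where
              lem : ∀ a b g → (a - g) ∙ b ≡ a ∙ b - g
              lem = group 3 (λ a b g → (a ⊟ g) ⊞ b ⊜ a ⊞ b ⊟ g) refl
            -- Submodularity of the size of · + B. Combined with Kneser's bound for the union `V`,
            -- it makes the intersection `I` critical.
            submod : ∣ V ⊕ B ∣ + ∣ I ⊕ B ∣ ≤ ∣ Z ∣ + ∣ Z ∣
            submod = ≤-trans (+-mono-≤ (card-mono (V ⊕ B) (Z ∪ Zg) toV) (card-mono (I ⊕ B) (Z ∩ Zg) toI))
              (≤-reflexive (trans (card-∪∩ Z Zg) (cong (∣ Z ∣ +_) (card-⊹ Z g))))
              where
              toV : V ⊕ B ⊆ Z ∪ Zg
              toV (a , inj₁ p , q) = inj₁ (a , p , q)
              toV (a , inj₂ p , q) = inj₂ (shift⊆ (a , p , q))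
              toI : I ⊕ B ⊆ Z ∩ Zg
              toI (a , (p , p′) , q) = (a , p , q) , shift⊆ (a , p′ , q)
            I⊕B≤Z : ∣ I ⊕ B ∣ ≤ ∣ Z ∣
            I⊕B≤Z = card-mono (I ⊕ B) Z (⊕-mono I B U B proj₁ (λ p → p))
            knI : ∣ I ∣ + ∣ B ∣ ≤ ∣ I ⊕ B ∣ + w
            knI = kn I (λ p → inL c (proj₁ p)) (per-∩ M U (U ⊹ g) (perM c) (per-⊹ M U g (perM c))) ihI
              (not-full (I ⊕ B) (≤-<-trans I⊕B≤Z Z<L))
            -- The dual is not smaller than U, so U and U + B together fit into `L`; with Kneser's
            -- bound for `I` this leaves V + B short of `L`, as the bound for `V` requires.
            V<L : ∣ V ⊕ B ∣ < ∣ set L ∣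
            V<L = ar (∣ V ⊕ B ∣) (∣ I ⊕ B ∣) (∣ Z ∣) (∣ I ∣) (∣ B ∣) (∣ U ∣) (∣ set L ∣) w submod knI (small c) U+Z
                    (≤-trans (≤-trans (Sg>0 M) (m≤m+n w w)) le)
              where
              ar : ∀ vb ib z i b u l w → vb + ib ≤ z + z → i + b ≤ ib + w → z + w ≤ u + b → u + z ≤ l → 1 ≤ i → vb < l
              ar vb ib z i b u l w h₁ h₂ h₃ h₄ h₅ = lin≤ 0 (h₁ ⊕≤ h₂ ⊕≤ h₃ ⊕≤ h₄ ⊕≤ h₅) (eq vb ib z i b u l w)
                where
                eq : ∀ vb ib z i b u l w → suc vb + (z + z + (ib + w) + (u + b) + l + i) + 0 ≡ l + (vb + ib + (i + b) + (z + w) + (u + z) + 1)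
                eq = solve-∀
            knV : ∣ V ∣ + ∣ B ∣ ≤ ∣ V ⊕ B ∣ + w
            knV = kn V V⊆L (per-∪ M U (U ⊹ g) (perM c) (per-⊹ M U g (perM c))) (proj₁ (inhabited c) , inj₁ (proj₂ (inhabited c)))
              (not-full (V ⊕ B) V<L)
              where
              V⊆L : V ⊆ set L
              V⊆L (inj₁ p) = inL c p
              V⊆L (inj₂ p) = resp (set L) (x-g∙g _ g) (∙∈ L (inL c p) g∈)
            V+I : ∣ V ∣ + ∣ I ∣ ≡ ∣ U ∣ + ∣ U ∣
            V+I = trans (card-∪∩ U (U ⊹ g)) (cong (∣ U ∣ +_) (card-⊹ U g))
            critI : Crit L B I
            critI = record
              { perM  = per-∩ M U (U ⊹ g) (perM c) (per-⊹ M U g (perM c))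
              ; inL   = λ p → inL c (proj₁ p)
              ; big   = le
              ; small = ar (∣ V ⊕ B ∣) (∣ I ⊕ B ∣) (∣ Z ∣) (∣ I ∣) (∣ V ∣) (∣ B ∣) (∣ U ∣) w submod knV (≤-reflexive (sym V+I)) (small c)
              ; room  = ≤-trans (+-monoˡ-≤ (w + w) I⊕B≤Z) (room c)
              }
              where
              ar : ∀ vb ib z i v b u w → vb + ib ≤ z + z → v + b ≤ vb + w → u + u ≤ v + i → z + w ≤ u + b → ib + w ≤ i + b
              ar vb ib z i v b u w h₁ h₂ h₃ h₄ = lin≤ 0 (h₁ ⊕≤ h₂ ⊕≤ h₃ ⊕≤ (h₄ ⊕≤ h₄)) (eq vb ib z i v b u w)
                where
                eq : ∀ vb ib z i v b u w → ib + w + (z + z + (vb + w) + (v + i) + (u + b + (u + b))) + 0 ≡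
                  i + b + (vb + ib + (v + b) + (u + u) + (z + w + (z + w)))
                eq = solve-∀
            -- If `I` were all of U, then g would be a period of U and of U + B outside M, and the
            -- strict bound of `kn-both` would contradict criticality.
            I<U : ∣ I ∣ < ∣ U ∣
            I<U with ∣ I ∣ <? ∣ U ∣
            ... | yes lt = lt
            ... | no ¬lt = ⊥-elim (n≮n _ (≤-trans (proj₂ (kn-both U (inL c) (perM c) (inhabited c) (not-full Z Z<L)) {g} gZ g∉) (small c)))
              where
              U⊆ : U ⊆ U ⊹ g
              U⊆ p = proj₂ (card-⊇ I U proj₁ (≮⇒≥ ¬lt) p)
              gU : ∀ {x} → x ∈ U → x ∙ g ∈ U
              gU {x} p = card-⊇ U (U ⊹ g) U⊆ (≤-reflexive (card-⊹ U g)) (⊹-in U g p)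
              gZ : g ∈ set (stab Z)
              gZ x p with ⊕-out U B p
              ... | a , b , q , r , refl = ⊕-in U B (gU q) r (lem a b g)
                where
                lem : ∀ a b g → a ∙ g ∙ b ≡ a ∙ b ∙ g
                lem = group 3 (λ a b g → a ⊞ g ⊞ b ⊜ a ⊞ b ⊞ g) refl

        atom : ∀ U → Crit L B U → Σ Sub λ V → Crit L B V × Sid L V
        atom U c = atom-acc U c (<-wellFounded _)

-- Vosper's theorem modulo `M`.

module VosperTheorem {N : ℕ} (𝔾 : FinAb N) where
  open Sets 𝔾
  open Kneser 𝔾
  open CriticalSets 𝔾

  module Vosper (M : Sg) where
    open Critical M
    open Crit

    ∩-shift : ∀ U g h → ∣ (U ⊹ g) ∩ (U ⊹ h) ∣ ≡ ∣ U ∩ (U ⊹ (h - g)) ∣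
    ∩-shift U g h = trans (card-cong ((U ⊹ g) ∩ (U ⊹ h)) ((U ∩ (U ⊹ (h - g))) ⊹ g)
        (λ {x} → λ { (p , q) → p , resp U (lem x g h) q }) (λ {x} → λ { (p , q) → p , resp U (sym (lem x g h)) q }))
      (card-⊹ (U ∩ (U ⊹ (h - g))) g)
      where
      lem : ∀ x g h → x - h ≡ (x - g) - (h - g)
      lem = group 3 (λ x g h → x ⊟ h ⊜ (x ⊟ g) ⊟ (h ⊟ g)) refl

    crit-shift : ∀ L B U {g} → g ∈ set L → Crit L B U → Crit L B (U ⊹ g)
    crit-shift L B U {g} g∈ c = record
      { perM  = per-⊹ M U g (perM c)
      ; inL   = λ p → resp (set L) (x-g∙g _ g) (∙∈ L (inL c p) g∈)
      ; big   = ≤-trans (big c) (≤-reflexive (sym (card-⊹ U g)))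
      ; small = subst₂ (λ a b → a + w ≤ b + ∣ B ∣) (sym (∣⊹⊕∣ U B g)) (sym (card-⊹ U g)) (small c)
      ; room  = subst (λ a → a + (w + w) ≤ ∣ set L ∣) (sym (∣⊹⊕∣ U B g)) (room c)
      }

    sid-shift : ∀ L U {g} → Sid L U → Sid L (U ⊹ g)
    sid-shift L U {g} s {h} h∈ h∉ = ≤-<-trans (≤-reflexive (trans
        (card-cong ((U ⊹ g) ∩ ((U ⊹ g) ⊹ h)) ((U ⊹ g) ∩ (U ⊹ (h ∙ g)))
          (λ {x} → λ { (p , q) → p , resp U (lem x g h) q }) (λ {x} → λ { (p , q) → p , resp U (sym (lem x g h)) q }))
        (trans (∩-shift U g (h ∙ g)) (cong (λ t → ∣ U ∩ (U ⊹ t) ∣) (x∙g-g h g))))) (s h∈ h∉)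
      where
      lem : ∀ x g h → (x - h) - g ≡ x - h ∙ g
      lem = group 3 (λ x g h → (x ⊟ h) ⊟ g ⊜ x ⊟ (h ⊞ g)) refl

    sid-≤ : ∀ L U {g h} → Sid L U → Per M U → h - g ∈ set L → h - g ∉ set M → ∣ (U ⊹ g) ∩ (U ⊹ h) ∣ ≤ w
    sid-≤ L U {g} {h} s pU p q = ≤-trans (≤-reflexive (∩-shift U g h))
      (atMostOne (U ∩ (U ⊹ (h - g))) (per-∩ M U (U ⊹ (h - g)) pU (per-⊹ M U (h - g) pU)) (s p q))

    shift-⊆ : ∀ A B {b} → b ∈ B → A ⊹ b ⊆ A ⊕ B
    shift-⊆ A B {b} b∈ {x} p = ⊕-in A B p b∈ (x-g∙g x b)

    two-translates : ∀ L A B → Sid L A → Per M A → B ⊆ set L → Per M B → w + w ≤ ∣ B ∣ → ∣ A ∣ + ∣ A ∣ ≤ ∣ A ⊕ B ∣ + w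
    two-translates L A B s pA B⊆L pB bigB with card-inhabited B (≤-trans (≤-trans (Sg>0 M) (m≤m+n w w)) bigB)
    ... | x , x∈ with another B {x} pB (≤-trans (≤-trans (≤-reflexive (+-comm 1 w)) (+-monoʳ-≤ w (Sg>0 M))) bigB)
    ... | y , y∈ , y≁x = ≤-trans
      (≤-reflexive (trans (cong₂ _+_ (sym (card-⊹ A x)) (sym (card-⊹ A y))) (sym (card-∪∩ (A ⊹ x) (A ⊹ y)))))
      (+-mono-≤ (card-mono ((A ⊹ x) ∪ (A ⊹ y)) (A ⊕ B) (λ { (inj₁ p) → shift-⊆ A B x∈ p ; (inj₂ p) → shift-⊆ A B y∈ p }))
        (sid-≤ L A s pA (-∈ L (B⊆L y∈) (B⊆L x∈)) y≁x))

    -- Take three points of `B` in different cosets of M. Their translates of A overlap pairwise in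
    -- at most w elements, which costs 3w.
    three-translates : ∀ L A B → Sid L A → Per M A → B ⊆ set L → Per M B → w + w + w ≤ ∣ B ∣ →
      ∣ A ∣ + ∣ A ∣ + ∣ A ∣ ≤ ∣ A ⊕ B ∣ + (w + w + w)
    three-translates L A B s pA B⊆L pB bigB with card-inhabited B (≤-trans (Sg>0 M) (≤-trans (m≤n+m w (w + w)) bigB))
    ... | x , x∈ with card-inhabited (B ∖ cos M x) (≤-trans (Sg>0 M) (≤-trans (m≤m+n w w) rest₁))
      where
      rest₁ : w + w ≤ ∣ B ∖ cos M x ∣
      rest₁ = +-cancelʳ-≤ w (w + w) _ (≤-trans bigB (≤-trans (card-∪≤ (B ∖ cos M x) (cos M x) B split) (+-monoʳ-≤ _ (≤-reflexive (card-⊹ (set M) x)))))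
        where
        split : ∀ {z} → z ∈ B → z ∈ B ∖ cos M x ⊎ z ∈ cos M x
        split {z} p with dec (cos M x) z
        ... | yes q = inj₂ q
        ... | no ¬q = inj₁ (p , ¬q)
    ... | y , y∈ , y≁x with ⊈-witness B (cos M x ∪ cos M y) (λ f → n≮n _ (≤-trans
            (≤-trans (≤-trans (≤-reflexive (+-comm 1 (w + w))) (+-monoʳ-≤ (w + w) (Sg>0 M))) bigB)
            (≤-trans (card-∪≤ (cos M x) (cos M y) B f) (≤-reflexive (cong₂ _+_ (card-⊹ (set M) x) (card-⊹ (set M) y))))))
    ... | z , z∈ , z≁ = ar (∣ A ∣) (∣ Ax ∪ Ay ∣) (∣ Ax ∩ Ay ∣) (∣ (Ax ∪ Ay) ∪ Az ∣) (∣ (Ax ∪ Ay) ∩ Az ∣) (∣ A ⊕ B ∣) w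
        (≤-reflexive (trans (cong₂ _+_ (sym (card-⊹ A x)) (sym (card-⊹ A y))) (sym (card-∪∩ Ax Ay))))
        (sid-≤ L A s pA (-∈ L (B⊆L y∈) (B⊆L x∈)) y≁x)
        (≤-reflexive (trans (cong (∣ Ax ∪ Ay ∣ +_) (sym (card-⊹ A z))) (sym (card-∪∩ (Ax ∪ Ay) Az))))
        (≤-trans (card-∪≤ (Ax ∩ Az) (Ay ∩ Az) ((Ax ∪ Ay) ∩ Az) (λ { (inj₁ p , q) → inj₁ (p , q) ; (inj₂ p , q) → inj₂ (p , q) }))
          (+-mono-≤ (sid-≤ L A s pA (-∈ L (B⊆L z∈) (B⊆L x∈)) (λ p → z≁ (inj₁ p))) (sid-≤ L A s pA (-∈ L (B⊆L z∈) (B⊆L y∈)) (λ p → z≁ (inj₂ p)))))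
        (card-mono ((Ax ∪ Ay) ∪ Az) (A ⊕ B)
          (λ { (inj₁ (inj₁ p)) → shift-⊆ A B x∈ p ; (inj₁ (inj₂ p)) → shift-⊆ A B y∈ p ; (inj₂ p) → shift-⊆ A B z∈ p }))
      where
      Ax = A ⊹ x
      Ay = A ⊹ y
      Az = A ⊹ z
      ar : ∀ a c i d j e w → a + a ≤ c + i → i ≤ w → c + a ≤ d + j → j ≤ w + w → d ≤ e → a + a + a ≤ e + (w + w + w)
      ar a c i d j e w h₁ h₂ h₃ h₄ h₅ = lin≤ 0 (h₁ ⊕≤ h₂ ⊕≤ h₃ ⊕≤ h₄ ⊕≤ h₅) (eq a c i d j e w)
        where
        eq : ∀ a c i d j e w → a + a + a + (c + i + w + (d + j) + (w + w) + e) + 0 ≡ e + (w + w + w) + (a + a + i + (c + a) + j + d)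
        eq = solve-∀

    -- Suppose |U| ≥ 3w. If `Y` has two cosets of M, two translates of U are already too large for
    -- the sum; if it has three or more, three translates of the larger set by points of the smaller
    -- one are.
    sidon-pair : ∀ L U Y → Sid L U → Sid L Y → Per M U → Per M Y → U ⊆ set L → Y ⊆ set L → w + w ≤ ∣ Y ∣ →
      ∣ Y ⊕ U ∣ + w ≤ ∣ Y ∣ + ∣ U ∣ → ∣ U ∣ < w + w + w
    sidon-pair L U Y sU sY pU pY U⊆L Y⊆L bigY sm with ∣ U ∣ <? w + w + w
    ... | yes p = p
    ... | no ¬p with ∣ Y ∣ <? w + w + w
    ...   | yes q = ⊥-elim (ar (∣ U ∣) (∣ Y ∣) (∣ Y ⊕ U ∣) w
              (≤-trans (two-translates L U Y sU pU Y⊆L pY bigY) (+-monoˡ-≤ w (≤-reflexive (∣⊕∣-comm U Y))))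
              sm (atMostTwo Y pY q) (≮⇒≥ ¬p) (Sg>0 M))
      where
      ar : ∀ u y s w → u + u ≤ s + w → s + w ≤ y + u → y ≤ w + w → w + w + w ≤ u → 1 ≤ w → ⊥
      ar u y s w h₁ h₂ h₃ h₄ h₅ = lin⊥ 0 (h₁ ⊕≤ h₂ ⊕≤ h₃ ⊕≤ h₄ ⊕≤ h₅) (eq u y s w)
        where
        eq : ∀ u y s w → s + w + (y + u) + (w + w) + u + w + 1 ≡ u + u + (s + w) + y + (w + w + w) + 1
        eq = solve-∀
    ...   | no ¬q with ≤-total (∣ Y ∣) (∣ U ∣)
    ...     | inj₁ y≤u = ⊥-elim (ar (∣ U ∣) (∣ Y ∣) (∣ Y ⊕ U ∣) w
              (≤-trans (three-translates L U Y sU pU Y⊆L pY (≮⇒≥ ¬q)) (+-monoˡ-≤ (w + w + w) (≤-reflexive (∣⊕∣-comm U Y))))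
              sm y≤u (≮⇒≥ ¬p) (Sg>0 M))
      where
      ar : ∀ u y s w → u + u + u ≤ s + (w + w + w) → s + w ≤ y + u → y ≤ u → w + w + w ≤ u → 1 ≤ w → ⊥
      ar u y s w h₁ h₂ h₃ h₄ h₅ = lin⊥ 0 (h₁ ⊕≤ h₂ ⊕≤ h₃ ⊕≤ h₄ ⊕≤ h₅) (eq u y s w)
        where
        eq : ∀ u y s w → s + (w + w + w) + (y + u) + u + u + w + 1 ≡ u + u + u + (s + w) + y + (w + w + w) + 1
        eq = solve-∀
    ...     | inj₂ u≤y = ⊥-elim (ar (∣ Y ∣) (∣ U ∣) (∣ Y ⊕ U ∣) w
              (three-translates L Y U sY pY U⊆L pU (≮⇒≥ ¬p)) sm u≤y (≮⇒≥ ¬q) (Sg>0 M))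
      where
      ar : ∀ u y s w → u + u + u ≤ s + (w + w + w) → s + w ≤ u + y → y ≤ u → w + w + w ≤ u → 1 ≤ w → ⊥
      ar u y s w h₁ h₂ h₃ h₄ h₅ = lin⊥ 0 (h₁ ⊕≤ h₂ ⊕≤ h₃ ⊕≤ h₄ ⊕≤ h₅) (eq u y s w)
        where
        eq : ∀ u y s w → s + (w + w + w) + (u + y) + u + u + w + 1 ≡ u + u + u + (s + w) + y + (w + w + w) + 1
        eq = solve-∀

    adjoin : G → Sub
    adjoin d = set M ∪ sg d

    ⟨M,_⟩ : G → Sg
    ⟨M, d ⟩ = gen (adjoin d) (inj₁ (ε∈ M))

    -- Walking in steps of d one leaves B only at the points of E, and these form at most one coset of M.
    step-degenerate : ∀ B d → Per M B → ∣ B ∪ (B ⊹ d) ∣ ≤ ∣ B ∣ + w → ∣ B ⊕ set ⟨M, d ⟩ ∣ + w ≤ ∣ set ⟨M, d ⟩ ∣ + ∣ B ∣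
    step-degenerate B d pB le = by-cases (any? (dec E))
      where
      K = ⟨M, d ⟩
      M⊆K : set M ⊆ set K
      M⊆K p = gen-⊇ (adjoin d) (inj₁ (ε∈ M)) (inj₁ p)
      next E : Sub
      next = sub (λ y → y ∙ d ∈ B) (λ y → dec B (y ∙ d))
      E = B ∖ next
      per-next : Per M next
      per-next {y} {h} p q = resp B (lem y h d) (pB p q)
        where
        lem : ∀ y h d → y ∙ d ∙ h ≡ y ∙ h ∙ d
        lem = group 3 (λ y h d → y ⊞ d ⊞ h ⊜ y ⊞ h ⊞ d) refl
      perE : Per M E
      perE = per-∖ M B next pB per-next
      E≤w : ∣ E ∣ ≤ w
      E≤w = +-cancelˡ-≤ ∣ B ∣ _ _ (≤-trans (≤-trans (≤-reflexive (cong (∣ B ∣ +_) (sym (card-⊹ E d))))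
        (card-disjoint B (E ⊹ d) (B ∪ (B ⊹ d)) (λ {x} p q → proj₂ q (resp B (sym (x-g∙g x d)) p)) inj₁ (λ p → inj₂ (proj₁ p)))) le)
      walk : ∀ {y} → y ∈ B → (∀ {k} → k ∈ set K → y ∙ k ∉ E) → ∀ {k} → k ∈ set K → y ∙ k ∈ B
      walk {y} y∈ avoid p = proj₁ (gen-ind (adjoin d) (inj₁ (ε∈ M)) (λ k → y ∙ k ∈ B × k ∈ set K)
        (resp B (sym (identityʳ y)) y∈ , ε∈ K) go p)
        where
        lem : ∀ y b k → y ∙ k ∙ b ≡ y ∙ (b ∙ k)
        lem = group 3 (λ y b k → y ⊞ k ⊞ b ⊜ y ⊞ (b ⊞ k)) refl
        go : ∀ {b k} → b ∈ adjoin d → y ∙ k ∈ B × k ∈ set K → y ∙ (b ∙ k) ∈ B × b ∙ k ∈ set K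
        go {b} {k} (inj₁ b∈) (q , k∈) = resp B (lem y b k) (pB q b∈) , ∙∈ K (M⊆K b∈) k∈
        go {b} {k} (inj₂ refl) (q , k∈) = resp B (lem y b k) (decidable-stable (dec B _) (λ r → avoid k∈ (q , r))) ,
          ∙∈ K (gen-⊇ (adjoin d) (inj₁ (ε∈ M)) (inj₂ refl)) k∈
      by-cases : Dec (∃ λ e → e ∈ E) → ∣ B ⊕ set K ∣ + w ≤ ∣ set K ∣ + ∣ B ∣
      by-cases (no ¬e) = ≤-trans (+-mono-≤ (card-mono (B ⊕ set K) B (per-⊕-⊆ K B (λ p q → walk p (λ _ r → ¬e (_ , r)) q))) (card-mono (set M) (set K) M⊆K))
        (≤-reflexive (+-comm ∣ B ∣ _))
      by-cases (yes (e , e∈)) = ≤-trans (+-monoˡ-≤ w (≤-trans (card-∪≤ (cos K e) (B ∖ cos K e) (B ⊕ set K) cover)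
          (+-monoˡ-≤ _ (≤-reflexive (card-⊹ (set K) e)))))
        (≤-trans (≤-reflexive (+-assoc ∣ set K ∣ _ w)) (+-monoʳ-≤ ∣ set K ∣ rest))
        where
        E⊆ : E ⊆ cos M e
        E⊆ = card-⊇ (cos M e) E (cos-⊆ M E perE e∈) (≤-trans E≤w (≤-reflexive (sym (card-⊹ (set M) e))))
        rest : ∣ B ∖ cos K e ∣ + w ≤ ∣ B ∣
        rest = ≤-trans (+-monoʳ-≤ _ (≤-reflexive (sym (card-⊹ (set M) e))))
          (card-disjoint (B ∖ cos K e) (cos M e) B (λ p q → proj₂ p (M⊆K q)) proj₁ (λ p → cos-⊆ M B pB (proj₁ e∈) p))
        cover : ∀ {x} → x ∈ B ⊕ set K → x ∈ cos K e ⊎ x ∈ B ∖ cos K e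
        cover {x} p with dec (cos K e) x
        ... | yes q = inj₁ q
        ... | no ¬q with ⊕-out B (set K) p
        ...   | b , k , b∈ , k∈ , refl = inj₂ (walk b∈ (λ {l} l∈ r → ¬q (resp (set K) (lem b k l e) (∙∈ K (M⊆K (E⊆ r)) (-∈ K k∈ l∈)))) k∈ , ¬q)
          where
          lem : ∀ b k l e → (b ∙ l - e) ∙ (k - l) ≡ b ∙ k - e
          lem = group 4 (λ b k l e → (b ⊞ l ⊟ e) ⊞ (k ⊟ l) ⊜ b ⊞ k ⊟ e) refl

    module _ (L : Sg) (B : Sub) (B⊆L : B ⊆ set L) (pB : Per M B) (nd : NonDeg L B) (bigB : w + w ≤ ∣ B ∣) where
      open InL

      ihB : Inhabited B
      ihB = card-inhabited B (≤-trans (≤-trans (Sg>0 M) (m≤m+n w w)) bigB)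

      -- The atom U is normalised to contain `ε` and generates `Lu`. A proper subgroup `Lu` of `L`
      -- would make `B` degenerate; so `Lu` is `L`, and then U is itself non-degenerate and can
      -- exchange roles with `B`.
      module Atom (U : Sub) (cU : Crit L B U) (sU : Sid L U) (ε∈U : ε ∈ U) where
        Lu = gen U ε∈U
        U⊆Lu : U ⊆ set Lu
        U⊆Lu = gen-⊇ U ε∈U
        Lu⊆L : set Lu ⊆ set L
        Lu⊆L {x} = gen-least U ε∈U L (inL cU) {x}
        M⊆U : set M ⊆ U
        M⊆U {x} p = resp U (identityˡ x) (perM cU ε∈U p)
        M⊆Lu : set M ⊆ set Lu
        M⊆Lu p = U⊆Lu (M⊆U p)

        U-nondeg : ∀ L′ → set L′ ⊆ set L → set L′ ⊆ set Lu → NonDeg L′ U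
        U-nondeg L′ L′⊆L L′⊆Lu K M⊆K K⊈M K⊆L′ L′⊈K
          with ⊈-witness U (set K) (λ f → L′⊈K (λ {x} p → gen-least U ε∈U K f {x} (L′⊆Lu {x} p)))
        ... | x , x∈ , x∉ = sidon-nondeg L U K sU K⊈M (λ p → L′⊆L (K⊆L′ p))
                (card-two K (U ⊕ set K) (per-⊕ K U) (⊆-⊕ K U x∈) (⊆-⊕ K U ε∈U) (λ q → x∉ (resp (set K) (lem x) q)))
          where
          lem : ∀ x → x - ε ≡ x
          lem = group 1 (λ x → x ⊟ nul ⊜ x) refl

        swap-small : ∣ B ⊕ U ∣ + w ≤ ∣ B ∣ + ∣ U ∣
        swap-small = subst₂ (λ a b → a + w ≤ b) (∣⊕∣-comm U B) (+-comm ∣ U ∣ ∣ B ∣) (small cU)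

        -- `B` is critical for U by the exchange of roles, which yields an atom `Y` for U. Both
        -- atoms are Sidon, so `sidon-pair` applies.
        U-small : set L ⊆ set Lu → ∣ U ∣ < w + w + w
        U-small L⊆Lu with atom L U (inL cU) (ε , ε∈U) (U-nondeg L (λ p → p) L⊆Lu) B
                            (record { perM = pB ; inL = B⊆L ; big = bigB ; small = swap-small
                                    ; room = subst (λ a → a + (w + w) ≤ ∣ set L ∣) (∣⊕∣-comm U B) (room cU) })
        ... | Y , cY , sY = sidon-pair L U Y sU sY (perM cU) (perM cY) (inL cU) (inL cY) (big cY) (small cY)

        -- If U + B is all of B + Lu, criticality and |U| ≤ |Lu| suffice. Otherwise take a missed
        -- point y. Kneser's bound in the coset of y uses up the slack of criticality, so the part
        -- `B₂` of `B` outside this coset has |B₂ + U| ≤ |B₂| and is `Lu`-periodic: all holes lie in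
        -- one coset of `Lu`.
        degenerate : ¬ (set L ⊆ set Lu) → ∣ B ⊕ set Lu ∣ + w ≤ ∣ set Lu ∣ + ∣ B ∣
        degenerate L⊈Lu with ⊆-dec (B ⊕ set Lu) (U ⊕ B)
        ... | yes f = ≤-trans (+-monoˡ-≤ w (card-mono (B ⊕ set Lu) (U ⊕ B) (λ {x} → f x)))
                (≤-trans (small cU) (+-monoˡ-≤ ∣ B ∣ (card-mono U (set Lu) U⊆Lu)))
        ... | no ¬f with ⊈-witness (B ⊕ set Lu) (U ⊕ B) (λ f → ¬f (λ x → f))
        ...   | y , y∈ , y∉ = ar (∣ B ⊕ set Lu ∣) (∣ B₂ ∣) (∣ set Lu ∣) (∣ B₁ ∣) (∣ B ∣) w
                  (card-∪≤ B₂ (cos Lu y) (B ⊕ set Lu) cover) (≤-reflexive (card-⊹ (set Lu) y)) (≤-reflexive B₁+B₂) B₁≥w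
          where
          B₁ B₂ B₁′ : Sub
          B₁  = B ∩ cos Lu y
          B₂  = B ∖ cos Lu y
          B₁′ = B₁ ⊹ (y ⁻¹)
          B₁+B₂ : ∣ B₂ ∣ + ∣ B₁ ∣ ≡ ∣ B ∣
          B₁+B₂ = card-∖∩ B (cos Lu y)
          per₁ : Per M B₁
          per₁ = per-∩ M B (cos Lu y) pB (per-weaken M Lu (cos Lu y) M⊆Lu (per-cos Lu y))
          ih₁ : Inhabited B₁
          ih₁ with ⊕-out B (set Lu) y∈
          ... | b , l , b∈ , l∈ , eq = b , b∈ , resp (set Lu) (trans (lem b l) (cong (b -_) eq)) (⁻¹∈ Lu l∈)
            where
            lem : ∀ b l → l ⁻¹ ≡ b - b ∙ l
            lem = group 2 (λ b l → inv l ⊜ b ⊟ (b ⊞ l)) refl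
          B₁≥w : w ≤ ∣ B₁ ∣
          B₁≥w = card-per M B₁ per₁ (proj₂ ih₁)
          not-all : ¬ (set Lu ⊆ B₁′ ⊕ U)
          not-all f with ⊕-out B₁′ U (f (ε∈ Lu))
          ... | a , u , (a∈ , _) , u∈ , eq = y∉ (⊕-in U B u∈ a∈ (trans (lem u a y) (trans (∙ʳ eq) (identityˡ y))))
            where
            lem : ∀ u a y → u ∙ (a - y ⁻¹) ≡ a ∙ u ∙ y
            lem = group 3 (λ u a y → u ⊞ (a ⊟ inv y) ⊜ a ⊞ u ⊞ y) refl
          in-Lu : B₁′ ⊆ set Lu
          in-Lu {x} (_ , p) = resp (set Lu) (lem x y) p
            where
            lem : ∀ x y → (x - y ⁻¹) - y ≡ x
            lem = group 2 (λ x y → (x ⊟ inv y) ⊟ y ⊜ x) refl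
          kn₁ : ∣ B₁ ∣ + ∣ U ∣ ≤ ∣ B₁ ⊕ U ∣ + w
          kn₁ = subst₂ (λ a b → a + ∣ U ∣ ≤ b + w) (card-⊹ B₁ (y ⁻¹)) (∣⊹⊕∣ B₁ U (y ⁻¹))
            (kn Lu U U⊆Lu (ε , ε∈U) (U-nondeg Lu (λ {x} → Lu⊆L {x}) (λ p → p)) B₁′ in-Lu (per-⊹ M B₁ (y ⁻¹) per₁)
              (proj₁ ih₁ ∙ y ⁻¹ , ⊹-in B₁ (y ⁻¹) (proj₂ ih₁)) not-all)
          disj : ∣ B₁ ⊕ U ∣ + ∣ B₂ ⊕ U ∣ ≤ ∣ U ⊕ B ∣
          disj = card-disjoint (B₁ ⊕ U) (B₂ ⊕ U) (U ⊕ B) dis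
            (λ p → ⊕-comm B U (⊕-mono B₁ U B U proj₁ (λ z → z) p)) (λ p → ⊕-comm B U (⊕-mono B₂ U B U proj₁ (λ z → z) p))
            where
            dis : Disjoint (B₁ ⊕ U) (B₂ ⊕ U)
            dis {x} (a , (_ , a~) , ua) (b , (_ , b≁) , ub) = b≁ (resp (set Lu) (lem a b x y) (∙∈ Lu a~ (-∈ Lu (U⊆Lu ua) (U⊆Lu ub))))
              where
              lem : ∀ a b x y → (a - y) ∙ ((x - a) - (x - b)) ≡ b - y
              lem = group 4 (λ a b x y → (a ⊟ y) ⊞ ((x ⊟ a) ⊟ (x ⊟ b)) ⊜ b ⊟ y) refl
          B₂-closed : ∣ B₂ ⊕ U ∣ ≤ ∣ B₂ ∣
          B₂-closed = ar₂ (∣ B₁ ∣) (∣ U ∣) (∣ B₁ ⊕ U ∣) (∣ B₂ ⊕ U ∣) (∣ B₂ ∣) (∣ U ⊕ B ∣) (∣ B ∣) w kn₁ disj (small cU) (≤-reflexive (sym B₁+B₂))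
            where
            ar₂ : ∀ b₁ u s₁ s₂ b₂ s b w → b₁ + u ≤ s₁ + w → s₁ + s₂ ≤ s → s + w ≤ u + b → b ≤ b₂ + b₁ → s₂ ≤ b₂
            ar₂ b₁ u s₁ s₂ b₂ s b w h₁ h₂ h₃ h₄ = lin≤ 0 (h₁ ⊕≤ h₂ ⊕≤ h₃ ⊕≤ h₄) (eq b₁ u s₁ s₂ b₂ s b w)
              where
              eq : ∀ b₁ u s₁ s₂ b₂ s b w → s₂ + (s₁ + w + s + (u + b) + (b₂ + b₁)) + 0 ≡ b₂ + (b₁ + u + (s₁ + s₂) + (s + w) + b)
              eq = solve-∀
          B₂-per : Per Lu B₂
          B₂-per {x} {h} x∈ h∈ = gen-least U ε∈U (stab B₂)
            (λ {u} u∈ z z∈ → card-⊇ B₂ (B₂ ⊕ U) (λ {t} p → ⊕-in B₂ U p ε∈U (identityʳ t)) B₂-closed (⊕-in B₂ U z∈ u∈ refl)) {h} h∈ x x∈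
          cover : ∀ {x} → x ∈ B ⊕ set Lu → x ∈ B₂ ⊎ x ∈ cos Lu y
          cover {x} p with dec (cos Lu y) x
          ... | yes q = inj₂ q
          ... | no ¬q with ⊕-out B (set Lu) p
          ...   | b , l , b∈ , l∈ , refl = inj₁ (B₂-per (b∈ , λ r → ¬q (resp (set Lu) (lem b l y) (∙∈ Lu r l∈))) l∈)
            where
            lem : ∀ b l y → (b - y) ∙ l ≡ b ∙ l - y
            lem = group 3 (λ b l y → (b ⊟ y) ⊞ l ⊜ b ⊞ l ⊟ y) refl
          ar : ∀ s b₂ l b₁ b w {c} → s ≤ b₂ + c → c ≤ l → b₂ + b₁ ≤ b → w ≤ b₁ → s + w ≤ l + b
          ar s b₂ l b₁ b w {c} h₁ h₂ h₃ h₄ = lin≤ 0 (h₁ ⊕≤ h₂ ⊕≤ h₃ ⊕≤ h₄) (eq s b₂ l b₁ b w c)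
            where
            eq : ∀ s b₂ l b₁ b w c → s + w + (b₂ + c + l + b + b₁) + 0 ≡ l + b + (s + c + (b₂ + b₁) + w)
            eq = solve-∀

        Lu⊈M : ¬ (set Lu ⊆ set M)
        Lu⊈M f = n≮n _ (≤-trans (≤-trans (≤-reflexive (+-comm 1 w)) (+-monoʳ-≤ w (Sg>0 M)))
          (≤-trans (big cU) (card-mono U (set M) (λ p → f (U⊆Lu p)))))

        L⊆Lu : set L ⊆ set Lu
        L⊆Lu {x} p = decidable-stable (dec (set Lu) x) (λ x∉ → n≮n _
          (≤-trans (nd Lu M⊆Lu Lu⊈M (λ {z} → Lu⊆L {z}) (λ f → x∉ (f p))) (degenerate (λ f → x∉ (f p)))))

        -- U consists of M and M + d. Hence B + d adds at most w to `B`, and `step-degenerate`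
        -- contradicts non-degeneracy unless M and d generate `L`.
        conclude : ∃ λ d → d ∈ set L × d ∉ set M × set L ⊆ set ⟨M, d ⟩
        conclude with another U {ε} (perM cU) (≤-trans (≤-trans (≤-reflexive (+-comm 1 w)) (+-monoʳ-≤ w (Sg>0 M))) (big cU))
        ... | d , d∈ , d≁ = d , inL cU d∈ , d∉M , λ {x} p → decidable-stable (dec (set K) x) (λ x∉ → n≮n _
                (≤-trans (nd K M⊆K K⊈M (λ {z} → K⊆L {z}) (λ f → x∉ (f p))) (step-degenerate B d pB growth)))
          where
          K = ⟨M, d ⟩
          M⊆K : set M ⊆ set K
          M⊆K p = gen-⊇ (adjoin d) (inj₁ (ε∈ M)) (inj₁ p)
          d∉M : d ∉ set M
          d∉M p = d≁ (resp (set M) (lem d) p)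
            where
            lem : ∀ d → d ≡ d - ε
            lem = group 1 (λ d → d ⊜ d ⊟ nul) refl
          K⊈M : ¬ (set K ⊆ set M)
          K⊈M f = d∉M (f (gen-⊇ (adjoin d) (inj₁ (ε∈ M)) (inj₂ refl)))
          K⊆L : set K ⊆ set L
          K⊆L {z} = gen-least (adjoin d) (inj₁ (ε∈ M)) L (λ { (inj₁ q) → Lu⊆L (M⊆Lu q) ; (inj₂ refl) → inL cU d∈ }) {z}
          growth : ∣ B ∪ (B ⊹ d) ∣ ≤ ∣ B ∣ + w
          growth = ar (∣ B ∪ (B ⊹ d) ∣) (∣ U ⊕ B ∣) (∣ U ∣) (∣ B ∣) w
            (card-mono (B ∪ (B ⊹ d)) (U ⊕ B) (λ { (inj₁ q) → ⊕-in U B ε∈U q (identityˡ _) ; (inj₂ q) → ⊕-comm B U (shift-⊆ B U d∈ q) }))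
            (small cU) (atMostTwo U (perM cU) (U-small (λ {z} → L⊆Lu {z})))
            where
            ar : ∀ g s u b w → g ≤ s → s + w ≤ u + b → u ≤ w + w → g ≤ b + w
            ar g s u b w h₁ h₂ h₃ = lin≤ 0 (h₁ ⊕≤ h₂ ⊕≤ h₃) (eq g s u b w)
              where
              eq : ∀ g s u b w → g + (s + (u + b) + (w + w)) + 0 ≡ b + w + (g + (s + w) + u)
              eq = solve-∀

      vosper : ∀ W → Crit L B W → ∃ λ d → d ∈ set L × d ∉ set M × set L ⊆ set ⟨M, d ⟩
      vosper W cW with atom L B B⊆L ihB nd W cW
      ... | U , cU , sU with inhabited cU
      ...   | u , u∈ = Atom.conclude (U ⊹ (u ⁻¹)) (crit-shift L B U (⁻¹∈ L (inL cU u∈)) cU) (sid-shift L U sU) (resp U (lem u) u∈)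
        where
        lem : ∀ u → u ≡ ε - u ⁻¹
        lem = group 1 (λ u → u ⊜ nul ⊟ inv u) refl

-- Iterated sumsets of an almost periodic set.

module DegenerateCase {N : ℕ} (𝔾 : FinAb N) where
  open Sets 𝔾
  open Kneser 𝔾
  open CriticalSets 𝔾
  open VosperTheorem 𝔾

  iter-+ : ∀ B i j {x y} → x ∈ iter i B → y ∈ iter j B → x ∙ y ∈ iter (i + j) B
  iter-+ B zero    j {y = y} refl q = resp (iter j B) (sym (identityˡ y)) q
  iter-+ B (suc i) j {y = y} p q with ⊕-out B (iter i B) p
  ... | b , z , r , s , refl = ⊕-in B (iter (i + j) B) r (iter-+ B i j s q) (sym (assoc b z y))

  iter-· : ∀ B j {b} → b ∈ B → j · b ∈ iter j B
  iter-· B zero    b∈ = refl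
  iter-· B (suc j) b∈ = ⊕-in B (iter j B) b∈ (iter-· B j b∈) refl

  iter-mono : ∀ B C → B ⊆ C → ∀ j → iter j B ⊆ iter j C
  iter-mono B C f zero    p = p
  iter-mono B C f (suc j) p = ⊕-mono B (iter j B) C (iter j C) f (iter-mono B C f j) p

  iter-up : ∀ B → ε ∈ B → ∀ {i j} → i ≤ j → iter i B ⊆ iter j B
  iter-up B ε∈B {i} {j} i≤j {x} p = subst (λ n → x ∈ iter n B) (m+[n∸m]≡n i≤j)
    (resp (iter (i + (j ∸ i)) B) (identityʳ x) (iter-+ B i (j ∸ i) p (iter-ε B ε∈B (j ∸ i))))

  kneser-iter : ∀ B W H j → Inhabited B → IsStab H (iter j B ⊕ set W) →
    j * ∣ B ⊕ set H ∣ + ∣ set H ∣ ≤ ∣ iter j B ⊕ set W ∣ + j * ∣ set H ∣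
  kneser-iter B W H j ih s = subst₂ (λ a b → a + ∣ set H ∣ ≤ ∣ iter j B ⊕ set W ∣ + b * ∣ set H ∣)
      (total j) (length-replicate j) (kneser-⨁ (replicate j B) W H (rep j) s)
    where
    rep : ∀ j → All Inhabited (replicate j B)
    rep zero    = []
    rep (suc j) = ih ∷ rep j
    total : ∀ j → sumL (map (λ A → ∣ A ⊕ set H ∣) (replicate j B)) ≡ j * ∣ B ⊕ set H ∣
    total zero    = refl
    total (suc j) = cong (∣ B ⊕ set H ∣ +_) (total j)

  multiples : Sg → G → ℕ → Sub
  multiples M d zero    = sub (λ _ → ⊥) (λ _ → no λ ())
  multiples M d (suc e) = multiples M d e ∪ cos M (e · d)

  ∈-multiples : ∀ M d e {x} j → j < e → x - j · d ∈ set M → x ∈ multiples M d e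
  ∈-multiples M d (suc e) j (s≤s j≤e) p with m≤n⇒m<n∨m≡n j≤e
  ... | inj₁ lt   = inj₁ (∈-multiples M d e j lt p)
  ... | inj₂ refl = inj₂ p

  multiples-∈ : ∀ M d e {x} → x ∈ multiples M d e → ∃ λ j → j < e × x - j · d ∈ set M
  multiples-∈ M d (suc e) (inj₁ p) with multiples-∈ M d e p
  ... | j , lt , q = j , m≤n⇒m≤1+n lt , q
  multiples-∈ M d (suc e) (inj₂ p) = e , ≤-refl , p

  card-multiples : ∀ M d e → ∣ multiples M d e ∣ ≤ e * ∣ set M ∣
  card-multiples M d zero    = ≤-reflexive (trans (sum-const N 0) (*-zeroʳ N))
  card-multiples M d (suc e) = ≤-trans (card-∪≤ (multiples M d e) (cos M (e · d)) (multiples M d (suc e)) (λ p → p))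
    (≤-trans (+-mono-≤ (card-multiples M d e) (≤-reflexive (card-⊹ (set M) (e · d)))) (≤-reflexive (+-comm (e * ∣ set M ∣) ∣ set M ∣)))

  ·-+ : ∀ x i j → (i + j) · x ≡ i · x ∙ j · x
  ·-+ = ×-homo-+

  -- Closure under addition rests on e·d ∈ M alone, so e may be any positive multiple of the order
  -- of d modulo M.
  extend : ∀ M d e → 1 ≤ e → e · d ∈ set M → Sg
  extend M d e 1≤e p = mkSg (multiples M d e)
    (∈-multiples M d e 0 1≤e (refl∈ M))
    (λ {x} {y} p q → closed x y (multiples-∈ M d e p) (multiples-∈ M d e q))
    where
    closed : ∀ x y → (∃ λ j → j < e × x - j · d ∈ set M) → (∃ λ j → j < e × y - j · d ∈ set M) → x ∙ y ∈ multiples M d e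
    closed x y (i , i<e , q) (j , j<e , r) with i + j <? e
    ... | yes lt = ∈-multiples M d e (i + j) lt (resp (set M) (cong (λ t → (x ∙ y) - t) (sym (·-+ d i j))) (add∈ M q r))
    ... | no ¬lt with m≤n⇒∃[o]m+o≡n (≮⇒≥ ¬lt)
    ...   | k , eq = ∈-multiples M d e k k<e (resp (set M) (lem (x ∙ y) (e · d) (k · d))
              (∙∈ M (resp (set M) (cong (λ t → (x ∙ y) - t) (trans (sym (·-+ d i j)) (trans (cong (_· d) (sym eq)) (·-+ d e k)))) (add∈ M q r)) p))
      where
      k<e : k < e
      k<e = +-cancelˡ-< e k e (≤-<-trans (≤-reflexive eq) (<-trans (+-monoˡ-< j i<e) (+-monoʳ-< e j<e)))
      lem : ∀ z f k → (z - f ∙ k) ∙ f ≡ z - k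
      lem = group 3 (λ z f k → (z ⊟ (f ⊞ k)) ⊞ f ⊜ z ⊟ k) refl

  -- `size` is Kneser's bound for m copies of B at `Q` with |L| in place of the size of the sumset;
  -- `order` says that γ has order greater than m modulo M.
  record Outcome (L M : Sg) (B : Sub) (m : ℕ) : Set₁ where
    field
      Q     : Sg
      Q⊆L   : set Q ⊆ set L
      L⊈Q   : ¬ (set L ⊆ set Q)
      size  : m * ∣ B ⊕ set Q ∣ + ∣ set Q ∣ ≤ ∣ set L ∣ + m * ∣ set Q ∣
      γ     : G
      order : ∀ i → 1 ≤ i → i ≤ m → i · γ ∉ set M

  -- `A` and z - A′ lie in one coset of K and are together too large to be disjoint.
  coset-sum : ∀ K A A′ {a a′} → A ⊆ cos K a → A′ ⊆ cos K a′ → ∣ set K ∣ < ∣ A ∣ + ∣ A′ ∣ →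
    ∀ {z} → z - a ∙ a′ ∈ set K → z ∈ A ⊕ A′
  coset-sum K A A′ {a} {a′} f f′ lt {z} p
    with pigeonhole A C (cos K a) f (λ {x} q → resp (set K) (lem z x a a′) (-∈ K p (f′ q)))
           (≤-trans (s≤s (≤-reflexive (card-⊹ (set K) a))) (≤-trans lt (+-monoʳ-≤ ∣ A ∣ (≤-reflexive (sym (sum-flip (χ A′) z))))))
    where
    C : Sub
    C = sub (λ x → z - x ∈ A′) (λ x → dec A′ (z - x))
    lem : ∀ z x a a′ → (z - a ∙ a′) - ((z - x) - a′) ≡ x - a
    lem = group 4 (λ z x a a′ → (z ⊟ (a ⊞ a′)) ⊟ ((z ⊟ x) ⊟ a′) ⊜ x ⊟ a) refl
  ... | x , q , r = x , q , r

  module Degenerate (L M K : Sg) (B : Sub) (ε∈B : ε ∈ B) (B⊆L : B ⊆ set L)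
    (generates : ∀ H → B ⊆ set H → set L ⊆ set H) (m : ℕ) (stabM : IsStab M (iter (suc (suc m)) B))
    (K⊈M : ¬ (set K ⊆ set M)) (M⊆K : set M ⊆ set K) (K⊆L : set K ⊆ set L) (L⊈K : ¬ (set L ⊆ set K))
    (few-holes : ∣ B ⊕ set K ∣ + ∣ set M ∣ ≤ ∣ set K ∣ + ∣ B ∣) where

    n : ℕ
    n = suc (suc m)

    part : G → Sub
    part b = B ∩ cos K b

    -- There are fewer than |K| holes altogether, so two cosets keep more than 2|K| - |K| elements.
    two-parts : ∀ {b b′} → b ∈ B → b′ ∈ B → b - b′ ∉ set K → ∣ set K ∣ < ∣ part b ∣ + ∣ part b′ ∣
    two-parts {b} {b′} b∈ b′∈ b≁b′ = ar (∣ set K ∣) (∣ part b ∣) (∣ part b′ ∣) (∣ rest ∣) (∣ B ∣) (∣ B ⊕ set K ∣) (∣ cs ∣) (∣ pt ∣) (∣ set M ∣)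
        few-holes (Sg>0 M)
        (card-disjoint rest cs (B ⊕ set K) (λ p q → proj₂ p q) (λ p → ⊆-⊕ K B (proj₁ p))
          (λ { (inj₁ p) → cos-⊆ K (B ⊕ set K) (per-⊕ K B) (⊆-⊕ K B b∈) p ; (inj₂ p) → cos-⊆ K (B ⊕ set K) (per-⊕ K B) (⊆-⊕ K B b′∈) p }))
        (card-disjoint (cos K b) (cos K b′) cs (cos-disjoint K b≁b′) inj₁ inj₂)
        (card-⊹ (set K) b) (card-⊹ (set K) b′)
        (card-∪≤ rest pt B cover)
        (card-∪≤ (part b) (part b′) pt (λ { (p , inj₁ q) → inj₁ (p , q) ; (p , inj₂ q) → inj₂ (p , q) }))
      where
      cs pt rest : Sub
      cs   = cos K b ∪ cos K b′
      pt   = B ∩ cs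
      rest = B ∖ cs
      cover : ∀ {x} → x ∈ B → x ∈ rest ⊎ x ∈ pt
      cover {x} p with dec cs x
      ... | yes q = inj₂ (p , q)
      ... | no ¬q = inj₁ (p , ¬q)
      ar : ∀ k p p′ r b bk c t w {k₁ k₂} → bk + w ≤ k + b → 1 ≤ w → r + c ≤ bk → k₁ + k₂ ≤ c → k₁ ≡ k → k₂ ≡ k → b ≤ r + t → t ≤ p + p′ → k < p + p′
      ar k p p′ r b bk c t w h₁ h₂ h₃ h₄ refl refl h₅ h₆ = lin≤ 0 (h₁ ⊕≤ h₂ ⊕≤ h₃ ⊕≤ h₄ ⊕≤ h₅ ⊕≤ h₆) (eq k (p + p′) r b bk c t w)
        where
        eq : ∀ k p r b bk c t w → suc k + (k + b + w + bk + c + (r + t) + p) + 0 ≡ p + (bk + w + 1 + (r + c) + (k + k) + b + t)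
        eq = solve-∀

    Rich : G → Set
    Rich b = ∣ set K ∣ < ∣ part b ∣ + ∣ part b ∣

    pair-full : ∀ {b b′} → b ∈ B → b′ ∈ B → Rich b → ∀ {z} → z - b ∙ b′ ∈ set K → z ∈ B ⊕ B
    pair-full {b} {b′} b∈ b′∈ rich {z} p with dec (set K) (b - b′)
    ... | no b≁ = ⊕-mono (part b) (part b′) B B proj₁ proj₁
            (coset-sum K (part b) (part b′) proj₂ proj₂ (two-parts b∈ b′∈ b≁) p)
    ... | yes b~ = ⊕-mono (part b) (part b) B B proj₁ proj₁
            (coset-sum K (part b) (part b) proj₂ proj₂ rich (resp (set K) (lem z b b′) (-∈ K p b~)))
      where
      lem : ∀ z b b′ → (z - b ∙ b′) - (b - b′) ≡ z - b ∙ b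
      lem = group 3 (λ z b b′ → (z ⊟ (b ⊞ b′)) ⊟ (b ⊟ b′) ⊜ z ⊟ (b ⊞ b)) refl

    rich-full : ∀ {b x y} → b ∈ B → Rich b → x ∈ iter (suc m) B → y - b ∙ x ∈ set K → y ∈ iter n B
    rich-full {b} {x} {y} b∈ rich x∈ p with ⊕-out B (iter m B) x∈
    ... | b′ , t , b′∈ , t∈ , refl = ⊕-assoc B B (iter m B) (⊕-in (B ⊕ B) (iter m B)
            (pair-full b∈ b′∈ rich {y - t} (resp (set K) (lem y b b′ t) p)) t∈ (x-g∙g y t))
      where
      lem : ∀ y b b′ t → y - b ∙ (b′ ∙ t) ≡ (y - t) - b ∙ b′
      lem = group 4 (λ y b b′ t → y ⊟ (b ⊞ (b′ ⊞ t)) ⊜ (y ⊟ t) ⊟ (b ⊞ b′)) refl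

    not-periodic : ∃ λ x → ∃ λ k → x ∈ iter n B × k ∈ set K × x ∙ k ∉ iter n B
    not-periodic = not-per K (iter n B) (λ f → K⊈M (λ {h} p → least stabM {h} (f {h} p)))

    x∙k-x : ∀ x k → x ∙ k - x ≡ k
    x∙k-x = group 2 (λ x k → x ⊞ k ⊟ x ⊜ k) refl

    -- If all parts were rich, the n-fold sum would fill every coset of `K` that it meets, and `K`
    -- would lie in its stabiliser `M`.
    poor : ∃ λ b → b ∈ B × ¬ Rich b
    poor with any? (λ b → dec B b ×-dec ¬? (∣ set K ∣ <? ∣ part b ∣ + ∣ part b ∣))
    ... | yes w = w
    ... | no ¬w with not-periodic
    ...   | x , k , x∈ , k∈ , xk∉ with ⊕-out B (iter (suc m) B) x∈
    ...     | b , t , b∈ , t∈ , refl = ⊥-elim (xk∉ (rich-full b∈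
                (decidable-stable (∣ set K ∣ <? _) (λ r → ¬w (b , b∈ , r))) t∈ (resp (set K) (sym (x∙k-x (b ∙ t) k)) k∈)))

    module Poor (β₀ : G) (β₀∈ : β₀ ∈ B) (¬rich : ¬ Rich β₀) where
      B* : Sub
      B* = B ∖ cos K β₀

      B*-rich : ∀ {b} → b ∈ B* → Rich b
      B*-rich {b} (b∈ , b≁) with ∣ set K ∣ <? ∣ part b ∣ + ∣ part b ∣
      ... | yes r = r
      ... | no ¬r = ⊥-elim (ar (∣ set K ∣) (∣ part b ∣) (∣ part β₀ ∣) (≮⇒≥ ¬r) (≮⇒≥ ¬rich) (two-parts b∈ β₀∈ b≁))
        where
        ar : ∀ k p q → p + p ≤ k → q + q ≤ k → k < p + q → ⊥
        ar k p q h₁ h₂ h₃ = lin⊥ 1 (h₁ ⊕≤ h₂ ⊕≤ (h₃ ⊕≤ h₃)) (eq k p q)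
          where
          eq : ∀ k p q → k + k + (p + q + (p + q)) + 2 ≡ p + p + (q + q) + (suc k + suc k)
          eq = solve-∀

      decompose : ∀ j {x} → x ∈ iter (suc j) B → x ∈ B* ⊕ iter j B ⊎ x - suc j · β₀ ∈ set K
      decompose j {x} x∈ with ⊕-out B (iter j B) x∈
      ... | b , t , b∈ , t∈ , refl with dec (cos K β₀) b
      ...   | no b≁ = inj₁ (⊕-in B* (iter j B) (b∈ , b≁) t∈ refl)
      ...   | yes b~ = tail j t∈
        where
        tail : ∀ j → t ∈ iter j B → b ∙ t ∈ B* ⊕ iter j B ⊎ b ∙ t - suc j · β₀ ∈ set K
        tail zero    refl = inj₂ (add∈ K b~ (refl∈ K))
        tail (suc j) t∈ with decompose j t∈
        ... | inj₂ q = inj₂ (add∈ K b~ q)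
        ... | inj₁ q with ⊕-out B* (iter j B) q
        ...   | b* , s , b*∈ , s∈ , refl = inj₁ (⊕-in B* (iter (suc j) B) b*∈ (⊕-in B (iter j B) b∈ s∈ refl) (lem b b* s))
          where
          lem : ∀ b c s → c ∙ (b ∙ s) ≡ b ∙ (c ∙ s)
          lem = group 3 (λ b c s → c ⊞ (b ⊞ s) ⊜ b ⊞ (c ⊞ s)) refl

      -- A sum with a summand in `B*` fills its coset of `K`. If such a sum fell into the coset of
      -- n·β₀, every coset met would be full and `K` would consist of periods.
      unique : ∀ {z} → z ∈ B* ⊕ iter (suc m) B → z - n · β₀ ∉ set K
      unique {z} z∈ z~ with not-periodic
      ... | x , k , x∈ , k∈ , xk∉ with decompose (suc m) x∈
      ...   | inj₁ q with ⊕-out B* (iter (suc m) B) q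
      ...     | b , t , b∈ , t∈ , refl = xk∉ (rich-full (proj₁ b∈) (B*-rich b∈) t∈ (resp (set K) (sym (x∙k-x (b ∙ t) k)) k∈))
      unique {z} z∈ z~ | x , k , x∈ , k∈ , xk∉ | inj₂ q with ⊕-out B* (iter (suc m) B) z∈
      ... | b , t , b∈ , t∈ , refl = xk∉ (rich-full (proj₁ b∈) (B*-rich b∈) t∈
              (trans∈ K (resp (set K) (sym (x∙k-x x k)) k∈) (trans∈ K q (flip∈ K z~))))

      β*-exists : ∃ λ b → b ∈ B*
      β*-exists with ⊈-witness B (cos K β₀) (λ f → L⊈K (λ {x} → generates K (λ b∈ →
          resp (set K) (lem _ β₀) (-∈ K (f b∈) (f ε∈B))) {x}))
        where
        lem : ∀ b c → (b - c) - (ε - c) ≡ b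
        lem = group 2 (λ b c → (b ⊟ c) ⊟ (nul ⊟ c) ⊜ b) refl
      ... | b , b∈ , b≁ = b , b∈ , b≁

      Z : Sub
      Z = iter (suc m) B ⊕ set K

      module Star (β* : G) (β*∈ : β* ∈ B*) (Q : Sg) (isQ : IsStab Q Z) where
        -- If i·(β* - β₀) were in `K`, then i copies of `β*` and n - i copies of `β₀` would sum into
        -- the coset of n·β₀, against `unique`.
        order-large : ∀ i → 1 ≤ i → i ≤ n → i · (β* - β₀) ∉ set M
        order-large (suc i) _ (s≤s i≤) p with m≤n⇒∃[o]m+o≡n i≤
        ... | j , eq = unique (⊕-in B* (iter (suc m) B) β*∈
                (subst (λ t → i · β* ∙ j · β₀ ∈ iter t B) eq (iter-+ B i j (iter-· B i (proj₁ β*∈)) (iter-· B j β₀∈))) refl)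
                (resp (set K) calc (M⊆K p))
          where
          lem : ∀ b i j c i′ → (b ∙ (i ∙ j)) - (c ∙ (i′ ∙ j)) ≡ (b - c) ∙ (i - i′)
          lem = group 5 (λ b i j c i′ → (b ⊞ (i ⊞ j)) ⊟ (c ⊞ (i′ ⊞ j)) ⊜ (b ⊟ c) ⊞ (i ⊟ i′)) refl
          ·-inv : ∀ i x → i · (x ⁻¹) ≡ (i · x) ⁻¹
          ·-inv zero    x = sym ε⁻¹≈ε
          ·-inv (suc i) x = trans (∙ˡ (·-inv i x)) (⁻¹-∙-comm x (i · x))
          calc : suc i · (β* - β₀) ≡ (β* ∙ (i · β* ∙ j · β₀)) - n · β₀
          calc = begin
            (β* - β₀) ∙ i · (β* - β₀)                             ≡⟨ ∙ˡ (trans (×-distrib-+ β* (β₀ ⁻¹) i) (∙ˡ (·-inv i β₀))) ⟩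
            (β* - β₀) ∙ (i · β* - i · β₀)                         ≡⟨ sym (lem β* (i · β*) (j · β₀) β₀ (i · β₀)) ⟩
            (β* ∙ (i · β* ∙ j · β₀)) - β₀ ∙ (i · β₀ ∙ j · β₀)     ≡⟨ cong (λ t → (β* ∙ (i · β* ∙ j · β₀)) - β₀ ∙ t) (trans (sym (·-+ β₀ i j)) (cong (_· β₀) eq)) ⟩
            (β* ∙ (i · β* ∙ j · β₀)) - β₀ ∙ suc m · β₀            ∎
            where open ≡-Reasoning

        K⊆Q : set K ⊆ set Q
        K⊆Q {k} p = least isQ {k} (per-stab K Z (per-⊕ K (iter (suc m) B)) {k} p)

        Z⊆L : Z ⊆ set L
        Z⊆L p with ⊕-out (iter (suc m) B) (set K) p
        ... | a , k , a∈ , k∈ , refl = ∙∈ L (iter-⊆ L B B⊆L (suc m) a∈) (K⊆L k∈)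

        ε∈Z : ε ∈ Z
        ε∈Z = ⊆-⊕ K (iter (suc m) B) (iter-ε B ε∈B (suc m))

        Q⊆Z : set Q ⊆ Z
        Q⊆Z {q} p = resp Z (identityˡ q) (per isQ ε∈Z p)

        Q⊆L : set Q ⊆ set L
        Q⊆L {q} p = Z⊆L (Q⊆Z {q} p)

        -- The set B* + Q reflected through n·β₀. By `unique` it avoids `Z`, so |B* + Q| + |Z| ≤
        -- |L|; this lifts Kneser's bound from n - 1 summands to n.
        R : Sub
        R = sub (λ x → n · β₀ - x ∈ B* ⊕ set Q) (λ x → dec (B* ⊕ set Q) (n · β₀ - x))

        R-disjoint : Disjoint R Z
        R-disjoint {x} p q with ⊕-out B* (set Q) p
        ... | b , h , b∈ , h∈ , eq with ⊕-out (iter (suc m) B) (set K) (per isQ q h∈)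
        ...   | t , k , t∈ , k∈ , eq′ = unique (⊕-in B* (iter (suc m) B) b∈ t∈ refl) (resp (set K) calc (⁻¹∈ K k∈))
          where
          lem₁ : ∀ b t k → (b ∙ t) - b ∙ (t ∙ k) ≡ k ⁻¹
          lem₁ = group 3 (λ b t k → (b ⊞ t) ⊟ (b ⊞ (t ⊞ k)) ⊜ inv k) refl
          lem₂ : ∀ b h x → b ∙ (x ∙ h) ≡ (b ∙ h) ∙ x
          lem₂ = group 3 (λ b h x → b ⊞ (x ⊞ h) ⊜ (b ⊞ h) ⊞ x) refl
          calc : k ⁻¹ ≡ b ∙ t - n · β₀
          calc = trans (sym (lem₁ b t k)) (cong (λ u → (b ∙ t) - u)
            (trans (∙ˡ eq′) (trans (lem₂ b h x) (trans (∙ʳ eq) (x-g∙g (n · β₀) x)))))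

        R⊆L : R ⊆ set L
        R⊆L {x} p with ⊕-out B* (set Q) p
        ... | b , h , b∈ , h∈ , eq = resp (set L) (trans (cong (n · β₀ -_) eq) (lem (n · β₀) x))
                (-∈ L (·∈ L n (B⊆L β₀∈)) (∙∈ L (B⊆L (proj₁ b∈)) (Q⊆L {h} h∈)))
          where
          lem : ∀ c x → c - (c - x) ≡ x
          lem = group 2 (λ c x → c ⊟ (c ⊟ x) ⊜ x) refl

        outcome : Outcome L M B n
        outcome = record
          { Q = Q ; Q⊆L = λ {q} → Q⊆L {q} ; L⊈Q = proper
          ; size = ar (∣ B ⊕ set Q ∣) (∣ B* ⊕ set Q ∣) (∣ set Q ∣) (∣ Z ∣) (∣ set L ∣) (∣ R ∣) m
              (kneser-iter B K Q (suc m) (ε , ε∈B) isQ) spread (card-disjoint R Z (set L) R-disjoint R⊆L Z⊆L) (≤-reflexive (sym R-card))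
          ; γ = β* - β₀ ; order = order-large }
          where
          R-card : ∣ R ∣ ≡ ∣ B* ⊕ set Q ∣
          R-card = sum-flip (χ (B* ⊕ set Q)) (n · β₀)
          spread : ∣ B ⊕ set Q ∣ ≤ ∣ B* ⊕ set Q ∣ + ∣ set Q ∣
          spread = ≤-trans (card-∪≤ (B* ⊕ set Q) (cos Q β₀) (B ⊕ set Q) cover) (+-monoʳ-≤ _ (≤-reflexive (card-⊹ (set Q) β₀)))
            where
            cover : ∀ {x} → x ∈ B ⊕ set Q → x ∈ B* ⊕ set Q ⊎ x ∈ cos Q β₀
            cover p with ⊕-out B (set Q) p
            ... | b , h , b∈ , h∈ , refl with dec (cos K β₀) b
            ...   | no b≁  = inj₁ (⊕-in B* (set Q) (b∈ , b≁) h∈ refl)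
            ...   | yes b~ = inj₂ (per-cos Q β₀ {b} {h} (K⊆Q {b - β₀} b~) h∈)
          proper : ¬ (set L ⊆ set Q)
          proper f = R-disjoint x∈R (Q⊆Z (f (R⊆L x∈R)))
            where
            lem : ∀ c x → x ≡ c - (c - x)
            lem = group 2 (λ c x → x ⊜ c ⊟ (c ⊟ x)) refl
            x∈R : n · β₀ - β* ∈ R
            x∈R = resp (B* ⊕ set Q) (lem (n · β₀) β*) (⊆-⊕ Q B* β*∈)
          ar : ∀ b b* q z l r m → suc m * b + q ≤ z + suc m * q → b ≤ b* + q → r + z ≤ l → b* ≤ r → suc (suc m) * b + q ≤ l + suc (suc m) * q
          ar b b* q z l r m h₁ h₂ h₃ h₄ = lin≤ 0 (h₁ ⊕≤ h₂ ⊕≤ h₃ ⊕≤ h₄) (eq b b* q z l r (m * b) (m * q))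
            where
            eq : ∀ b b* q z l r mb mq → b + (b + mb) + q + (z + (q + mq) + (b* + q) + l + r) + 0 ≡ l + (q + (q + mq)) + (b + mb + q + b + (r + z) + b*)
            eq = solve-∀

    outcome : Outcome L M B n
    outcome with poor
    ... | β₀ , β₀∈ , ¬rich with Poor.β*-exists β₀ β₀∈ ¬rich
    ...   | β* , β*∈ = Poor.Star.outcome β₀ β₀∈ ¬rich β* β*∈ (stab (Poor.Z β₀ β₀∈ ¬rich)) (stab-isStab (Poor.Z β₀ β₀∈ ¬rich))

-- Iterated sumsets that do not fill their subgroup.

module IteratedSumsets {N : ℕ} (𝔾 : FinAb N) where
  open Sets 𝔾
  open Kneser 𝔾
  open CriticalSets 𝔾
  open VosperTheorem 𝔾
  open DegenerateCase 𝔾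

  iter-split : ∀ B i j → iter (i + j) B ⊆ iter i B ⊕ iter j B
  iter-split B zero    j {x} p = ⊕-in (sg ε) (iter j B) refl p (identityˡ x)
  iter-split B (suc i) j p with ⊕-out B (iter (i + j) B) p
  ... | b , t , b∈ , t∈ , refl = ⊕-assoc⁻ B (iter i B) (iter j B) (⊕-in B (iter i B ⊕ iter j B) b∈ (iter-split B i j t∈) refl)

  iter-thicken : ∀ B M j → iter j (B ⊕ set M) ⊆ iter j B ⊕ set M
  iter-thicken B M zero    {x} refl = ⊕-in (sg ε) (set M) refl (ε∈ M) (identityʳ ε)
  iter-thicken B M (suc j) p with ⊕-out (B ⊕ set M) (iter j (B ⊕ set M)) p
  ... | a , t , a∈ , t∈ , refl with ⊕-out B (set M) a∈ | ⊕-out (iter j B) (set M) (iter-thicken B M j t∈)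
  ... | b , h , b∈ , h∈ , refl | t′ , h′ , t′∈ , h′∈ , refl =
    ⊕-in (B ⊕ iter j B) (set M) (⊕-in B (iter j B) b∈ t′∈ refl) (∙∈ M h∈ h′∈) (lem b t′ h h′)
    where
    lem : ∀ b t h h′ → b ∙ t ∙ (h ∙ h′) ≡ b ∙ h ∙ (t ∙ h′)
    lem = group 4 (λ b t h h′ → b ⊞ t ⊞ (h ⊞ h′) ⊜ b ⊞ h ⊞ (t ⊞ h′)) refl

  multiple-gap : ∀ α β γ w → 1 ≤ w → α * w + β * w < γ * w + w → α * w + β * w ≤ γ * w
  multiple-gap α β γ w 1≤w lt = ≤-trans (≤-reflexive (sym (*-distribʳ-+ w α β))) (*-monoˡ-≤ w
    (≤-pred (*-cancelʳ-< w (α + β) (suc γ) (≤-<-trans (≤-reflexive (*-distribʳ-+ w α β)) (<-≤-trans lt (≤-reflexive (+-comm (γ * w) w)))))))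

  module Iterated (L : Sg) (B₀ : Sub) (ε∈B₀ : ε ∈ B₀) (B₀⊆L : B₀ ⊆ set L)
    (generates₀ : ∀ H → B₀ ⊆ set H → set L ⊆ set H) (m : ℕ)
    (large : ∣ set L ∣ < suc (suc m) * ∣ B₀ ∣) (not-full : ¬ (set L ⊆ iter (suc (suc m)) B₀))
    (M : Sg) (isM₀ : IsStab M (iter (suc (suc m)) B₀)) (none : ¬ Outcome L M B₀ (suc (suc m))) where

    open Critical M using (w; NonDeg; Crit)

    n : ℕ
    n = suc (suc m)

    B : Sub
    B = B₀ ⊕ set M

    B₀⊆B : B₀ ⊆ B
    B₀⊆B = ⊆-⊕ M B₀

    ε∈B : ε ∈ B
    ε∈B = B₀⊆B ε∈B₀

    thin : iter n B ⊆ iter n B₀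
    thin p = per-⊕-⊆ M (iter n B₀) (per isM₀) (iter-thicken B₀ M n p)

    isM : IsStab M (iter n B)
    isM = isStab-cong M (iter n B₀) (iter n B) (iter-mono B₀ B B₀⊆B n) thin isM₀

    M⊆L : set M ⊆ set L
    M⊆L {h} p = iter-⊆ L B₀ B₀⊆L n (resp (iter n B₀) (identityˡ h) (per isM₀ (iter-ε B₀ ε∈B₀ n) p))

    B⊆L : B ⊆ set L
    B⊆L p with ⊕-out B₀ (set M) p
    ... | b , h , b∈ , h∈ , refl = ∙∈ L (B₀⊆L b∈) (M⊆L h∈)

    generates : ∀ H → B ⊆ set H → set L ⊆ set H
    generates H f {x} = generates₀ H (λ p → f (B₀⊆B p)) {x}

    perB : Per M B
    perB = per-⊕ M B₀

    L⊈M : ¬ (set L ⊆ set M)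
    L⊈M f = not-full (λ {x} p → resp (iter n B₀) (identityˡ x) (per isM₀ (iter-ε B₀ ε∈B₀ n) (f p)))

    B-two : w + w ≤ ∣ B ∣
    B-two with ⊈-witness B (set M) (λ f → L⊈M (λ {x} → generates M f {x}))
    ... | b , b∈ , b∉ = card-two M B perB b∈ ε∈B (λ q → b∉ (resp (set M) (lem b) q))
      where
      lem : ∀ b → b - ε ≡ b
      lem = group 1 (λ b → b ⊟ nul ⊜ b) refl

    B₀≤B : ∀ H → ∣ B₀ ⊕ set H ∣ ≤ ∣ B ⊕ set H ∣
    B₀≤B H = card-mono (B₀ ⊕ set H) (B ⊕ set H) (⊕-mono B₀ (set H) B (set H) B₀⊆B (λ p → p))

    thin-outcome : Outcome L M B n → ⊥
    thin-outcome o = none (record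
      { Q = Outcome.Q o ; Q⊆L = Outcome.Q⊆L o ; L⊈Q = Outcome.L⊈Q o
      ; size = ≤-trans (+-monoˡ-≤ ∣ set (Outcome.Q o) ∣ (*-monoʳ-≤ n (B₀≤B (Outcome.Q o)))) (Outcome.size o)
      ; γ = Outcome.γ o ; order = Outcome.order o })

    -- Degeneracy at K would produce an `Outcome`; the inequality is decidable, so the assumption
    -- `none` is enough.
    nondeg : NonDeg L B
    nondeg K M⊆K K⊈M K⊆L L⊈K = decidable-stable (_ <? _) (λ ¬lt → thin-outcome
      (Degenerate.outcome L M K B ε∈B B⊆L generates m isM K⊈M M⊆K K⊆L L⊈K (≮⇒≥ ¬lt)))

    per-iter : ∀ j → Per M (iter (suc j) B)
    per-iter j = per-sumˡ M B (iter j B) perB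

    outside : ∃ λ z → z ∈ set L × z ∉ iter n B
    outside = ⊈-witness (set L) (iter n B) (λ f → not-full (λ p → thin (f p)))

    -- For z in `L` outside the n-fold sum, z - B avoids the (n - 1)-fold one.
    top : ∣ iter (suc m) B ∣ + ∣ B ∣ ≤ ∣ set L ∣
    top = ≤-trans (≤-reflexive (cong (∣ iter (suc m) B ∣ +_) (sym (sum-flip (χ B) z))))
        (card-disjoint (iter (suc m) B) C (set L) (λ {x} p q → z∉ (⊕-in B (iter (suc m) B) q p (x-g∙g z x)))
          (iter-⊆ L B B⊆L (suc m)) (λ {x} q → resp (set L) (lem z x) (-∈ L z∈ (B⊆L q))))
      where
      z = proj₁ outside
      z∈ = proj₁ (proj₂ outside)
      z∉ = proj₂ (proj₂ outside)
      C : Sub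
      C = sub (λ x → z - x ∈ B) (λ x → dec B (z - x))
      lem : ∀ c x → c - (c - x) ≡ x
      lem = group 2 (λ c x → c ⊟ (c ⊟ x) ⊜ x) refl

    -- The first step that gains less than |B| starts from a critical multiple. The range j ≤ m
    -- keeps the next multiple inside the (n - 1)-fold sum, so that `top` and |B| ≥ 2w supply
    -- `room`.
    search : ∀ j → j ≤ m → (∃ λ i → Crit L B (iter (suc i) B)) ⊎ suc j * ∣ B ∣ ≤ ∣ iter (suc j) B ∣
    search zero    _ = inj₂ (≤-trans (≤-reflexive (+-identityʳ ∣ B ∣)) (card-mono B (iter 1 B)
      (λ {x} p → ⊕-in B (sg ε) p refl (identityʳ x))))
    search (suc j) j<m with search j (<⇒≤ j<m)
    ... | inj₁ found = inj₁ found
    ... | inj₂ le with ∣ iter (suc (suc j)) B ∣ + w ≤? ∣ iter (suc j) B ∣ + ∣ B ∣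
    ...   | yes crit = inj₁ (j , record
              { perM  = per-iter j
              ; inL   = iter-⊆ L B B⊆L (suc j)
              ; big   = ≤-trans B-two (≤-trans (m≤m+n ∣ B ∣ (j * ∣ B ∣)) le)
              ; small = subst (λ a → a + w ≤ ∣ iter (suc j) B ∣ + ∣ B ∣) (∣⊕∣-comm B (iter (suc j) B)) crit
              ; room  = ≤-trans (+-mono-≤ (≤-trans (≤-reflexive (∣⊕∣-comm (iter (suc j) B) B))
                          (card-mono (iter (suc (suc j)) B) (iter (suc m) B) (iter-up B ε∈B (s≤s j<m)))) B-two) top
              })
    ...   | no ¬crit = inj₂ (≤-trans (≤-reflexive (+-comm ∣ B ∣ (suc j * ∣ B ∣))) (≤-trans (+-monoˡ-≤ ∣ B ∣ le)
              (gap (lagrange M (iter (suc j) B) (per-iter j)) (lagrange M B perB) (lagrange M (iter (suc (suc j)) B) (per-iter (suc j))) (≰⇒> ¬crit))))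
      where
      gap : ∀ {a b c} → (∃ λ k → a ≡ k * w) → (∃ λ k → b ≡ k * w) → (∃ λ k → c ≡ k * w) → a + b < c + w → a + b ≤ c
      gap (α , refl) (β , refl) (γ , refl) lt = multiple-gap α β γ w (Sg>0 M) lt

    -- Otherwise the (n - 1)-fold sum has at least (n - 1)|B| elements, and `top` gives n|B| ≤ |L|,
    -- against `large`.
    critical : ∃ λ i → Crit L B (iter (suc i) B)
    critical = [ (λ found → found) , (λ le → ⊥-elim (ar (∣ B₀ ∣) (∣ B ∣) (∣ iter (suc m) B ∣) (∣ set L ∣) m (card-mono B₀ B B₀⊆B) le top large)) ]′ (search m ≤-refl)
      where
      ar : ∀ b₀ b i l m → b₀ ≤ b → suc m * b ≤ i → i + b ≤ l → l < suc (suc m) * b₀ → ⊥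
      ar b₀ b i l m h₁ h₂ h₃ h₄ = lin⊥ 0 (h₂ ⊕≤ h₃ ⊕≤ ≤-trans h₄ (*-monoʳ-≤ (suc (suc m)) h₁)) (eq b i l (m * b))
        where
        eq : ∀ b i l mb → i + l + (b + (b + mb)) + 1 ≡ b + mb + (i + b) + suc l
        eq = solve-∀

    M-kneser : n * ∣ B ⊕ set M ∣ + w ≤ ∣ iter n B ∣ + n * w
    M-kneser = ≤-trans (kneser-iter B M M n (ε , ε∈B) (isStab-cong M (iter n B) (iter n B ⊕ set M) (⊆-⊕ M (iter n B)) shrink isM))
      (+-monoˡ-≤ (n * w) (card-mono (iter n B ⊕ set M) (iter n B) shrink))
      where
      shrink : iter n B ⊕ set M ⊆ iter n B
      shrink = per-⊕-⊆ M (iter n B) (per isM)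

    -- If i·d were in `M` for some i ≤ n, then |L| ≤ nw; but Kneser's bound with |B| ≥ 2w gives the
    -- n-fold sum at least (n + 1)w elements.
    contradiction-cyclic : (∃ λ d → d ∈ set L × d ∉ set M × set L ⊆ set (Vosper.⟨M,_⟩ M d)) → ⊥
    contradiction-cyclic (d , d∈ , d∉ , L⊆) = thin-outcome (record
      { Q = M ; Q⊆L = M⊆L ; L⊈Q = L⊈M
      ; size = ≤-trans M-kneser (+-monoˡ-≤ (n * w) (card-mono (iter n B) (set L) (iter-⊆ L B B⊆L n)))
      ; γ = d ; order = order })
      where
      iter<L : ∣ iter n B ∣ + w ≤ ∣ set L ∣
      iter<L = ≤-trans (+-monoʳ-≤ ∣ iter n B ∣ (≤-reflexive (sym (card-⊹ (set M) z))))
        (card-disjoint (iter n B) (cos M z) (set L) (λ p q → z∉ (per-~ M (iter n B) (per isM) p (flip∈ M q)))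
          (iter-⊆ L B B⊆L n) (cos-⊆ M (set L) (per-self M L M⊆L) z∈))
        where
        z = proj₁ outside
        z∈ = proj₁ (proj₂ outside)
        z∉ = proj₂ (proj₂ outside)
      order : ∀ i → 1 ≤ i → i ≤ n → i · d ∉ set M
      order i 1≤i i≤n p = ar (∣ iter n B ∣) (∣ set L ∣) w n (n * ∣ B ⊕ set M ∣) (Sg>0 M) (*-monoʳ-≤ n (≤-trans B-two (card-⊆-⊕ M B)))
          M-kneser iter<L (≤-trans (card-mono (set L) (multiples M d i) L⊆E) (≤-trans (card-multiples M d i) (*-monoˡ-≤ w i≤n)))
        where
        E : Sg
        E = extend M d i 1≤i p
        L⊆E : set L ⊆ multiples M d i
        L⊆E {x} x∈ = gen-least (set M ∪ sg d) (inj₁ (ε∈ M)) E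
          (λ { (inj₁ q) → ∈-multiples M d i 0 1≤i (resp (set M) (lem _) q) ; (inj₂ refl) → d∈E i 1≤i p }) {x} (L⊆ x∈)
          where
          lem : ∀ x → x ≡ x - ε
          lem = group 1 (λ x → x ⊜ x ⊟ nul) refl
          d∈E : ∀ i → 1 ≤ i → i · d ∈ set M → d ∈ multiples M d i
          d∈E (suc zero)    _ p = ⊥-elim (d∉ (resp (set M) (identityʳ d) p))
          d∈E (suc (suc i)) _ p = ∈-multiples M d (suc (suc i)) 1 (s≤s (s≤s z≤n)) (resp (set M) (sym (trans (cong (d -_) (identityʳ d)) (inverseʳ d))) (ε∈ M))
        ar : ∀ i l w n nb → 1 ≤ w → n * (w + w) ≤ nb → nb + w ≤ i + n * w → i + w ≤ l → l ≤ n * w → ⊥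
        ar i l w n nb h₁ h₂ h₃ h₄ h₅ = lin⊥ 0 ((≤-trans (≤-reflexive (sym (*-distribˡ-+ n w w))) h₂) ⊕≤ h₃ ⊕≤ h₄ ⊕≤ h₅ ⊕≤ (h₁ ⊕≤ z≤n {w})) (eq i l w (n * w) nb)
          where
          eq : ∀ i l w nw nb → nb + (i + nw) + l + nw + (w + w) + 1 ≡ nw + nw + (nb + w) + (i + w) + l + (1 + 0)
          eq = solve-∀

    contradiction : ⊥
    contradiction = contradiction-cyclic (Vosper.vosper M L B B⊆L perB nondeg B-two (iter (suc (proj₁ critical)) B) (proj₂ critical))

  -- An `Outcome` contains a subgroup and lives in `Set₁`, so it is not found by a bounded search.
  -- The double negation serves where the result is used to derive a contradiction.
  iterated : ∀ L B (ε∈B : ε ∈ B) → B ⊆ set L → (∀ H → B ⊆ set H → set L ⊆ set H) → ∀ m →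
    ∣ set L ∣ < suc (suc m) * ∣ B ∣ → ¬ (set L ⊆ iter (suc (suc m)) B) →
    ¬ ¬ Outcome L (stab (iter (suc (suc m)) B)) B (suc (suc m))
  iterated L B ε∈B B⊆L generates m large not-full none =
    Iterated.contradiction L B ε∈B B⊆L generates m large not-full (stab (iter (suc (suc m)) B)) (stab-isStab (iter (suc (suc m)) B)) none

-- Reaching every coset of `L` by exchanging terms.

module Coverings {N : ℕ} (𝔾 : FinAb N) where
  open Sets 𝔾
  open Kneser 𝔾
  open SubsequenceSums 𝔾
  open DeVosGoddynMohar 𝔾
  open DegenerateCase 𝔾
  open IteratedSumsets 𝔾

  triv : Sg
  triv = mkSg (sg ε) refl (λ { refl refl → identityˡ ε })

  outside : Sg → G → Seq → ℕ
  outside H α S = length (filter (λ s → ¬? (dec (set H) (s - α))) S)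

  extract : ∀ K b S → 1 ≤ v K b S → ∃ λ s → ∃ λ S′ → Split S (s ∷ []) S′ × s - b ∈ set K
  extract K b (s ∷ S) p with dec (set K) (s - b)
  ... | yes q = s , S , left (split-refl S) , q
  ... | no  _ with extract K b S p
  ...   | t , S′ , sp , q = t , s ∷ S′ , right sp , q

  -- Each summand is realised by a fresh term of its class: taking one term lowers every
  -- multiplicity by at most one, in step with m.
  iter-Σs : ∀ K B m S → (∀ {g} → g ∈ B → m ≤ v K g S) → iter m B ⊆ Σs m S ⊕ set K
  iter-Σs K B zero    S f refl = ⊕-in (Σs 0 S) (set K) ([] , minimum S , refl , refl) (ε∈ K) (identityʳ ε)
  iter-Σs K B (suc m) S f p with ⊕-out B (iter m B) p
  ... | b , y , b∈ , y∈ , refl with extract K b S (≤-trans (s≤s z≤n) (f b∈))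
  ... | s , S′ , sp , s~b with ⊕-out (Σs m S′) (set K) (iter-Σs K B m S′ more y∈)
    where
    more : ∀ {g} → g ∈ B → m ≤ v K g S′
    more {g} g∈ = ≤-pred (≤-trans (f g∈) (≤-trans (≤-reflexive (split-v K g sp)) (+-monoˡ-≤ (v K g S′) (v≤length K g (s ∷ [])))))
  ... | u , k , u∈ , k∈ , refl = ⊕-in (Σs (suc m) S) (set K)
          (split-Σs sp 1 m (⊕-in (Σs 1 (s ∷ [])) (Σs m S′) (s ∷ [] , refl ∷ [] , refl , identityʳ s) u∈ refl))
          (∙∈ K (flip∈ K s~b) k∈) (lem s u b k)
    where
    lem : ∀ s u b k → s ∙ u ∙ ((b - s) ∙ k) ≡ b ∙ (u ∙ k)
    lem = group 4 (λ s u b k → s ⊞ u ⊞ ((b ⊟ s) ⊞ k) ⊜ b ⊞ (u ⊞ k)) refl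

  module Covering (L : Sg) (β : G) where
    -- `ε` keeps a copy of `β`; s - β exchanges it for the term s.
    pair : G → Sub
    pair s = sg ε ∪ sg (s - β)

    reach : Sub → Seq → Sub
    reach Z []      = Z
    reach Z (s ∷ R) = reach (Z ∪ (Z ⊹ (s - β))) R

    reach-⊇ : ∀ R Z → ⨁ (map pair R) ⊕ Z ⊆ reach Z R
    reach-⊇ []      Z p with ⊕-out (sg ε) Z p
    ... | _ , z , refl , q , refl = resp Z (sym (identityˡ z)) q
    reach-⊇ (s ∷ R) Z p with ⊕-out (pair s ⊕ ⨁ (map pair R)) Z p
    ... | a , z , q , z∈ , refl with ⊕-out (pair s) (⨁ (map pair R)) q
    ...   | _ , t , inj₁ refl , t∈ , refl = reach-⊇ R (Z ∪ (Z ⊹ (s - β)))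
              (⊕-in (⨁ (map pair R)) (Z ∪ (Z ⊹ (s - β))) t∈ (inj₁ z∈) (∙ʳ (sym (identityˡ t))))
    ...   | _ , t , inj₂ refl , t∈ , refl = reach-⊇ R (Z ∪ (Z ⊹ (s - β)))
              (⊕-in (⨁ (map pair R)) (Z ∪ (Z ⊹ (s - β))) t∈ (inj₂ (⊹-in Z (s - β) z∈)) (lem t z (s - β)))
      where
      lem : ∀ t z d → t ∙ (z ∙ d) ≡ d ∙ t ∙ z
      lem = group 3 (λ t z d → t ⊞ (z ⊞ d) ⊜ d ⊞ t ⊞ z) refl

    -- A term that does not enlarge the current set of sums is never needed, and each term that does enlarges it by at least |L|.
    reach-out : ∀ R Z → Per L Z → ∀ {y} → y ∈ reach Z R →
      ∃ λ T → (T ⊑ R) × ∃ λ z → z ∈ Z × (length T * ∣ set L ∣ + ∣ Z ∣ ≤ N) × y ≡ z ∙ (σ T - length T · β)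
    reach-out []      Z pZ {y} p = [] , [] , y , p , card≤N Z , lem y
      where
      lem : ∀ y → y ≡ y ∙ (ε - ε)
      lem = group 1 (λ y → y ⊜ y ⊞ (nul ⊟ nul)) refl
    reach-out (s ∷ R) Z pZ {y} p = by-cases (⊆-dec (Z ⊹ d) Z) (reach-out R Z′ pZ′ p)
      where
      d = s - β
      Z′ = Z ∪ (Z ⊹ d)
      pZ′ : Per L Z′
      pZ′ = per-∪ L Z (Z ⊹ d) pZ (per-⊹ L Z d pZ)
      Goal = ∃ λ T → (T ⊑ s ∷ R) × ∃ λ z → z ∈ Z × (length T * ∣ set L ∣ + ∣ Z ∣ ≤ N) × y ≡ z ∙ (σ T - length T · β)
      by-cases : Dec (∀ x → x ∈ Z ⊹ d → x ∈ Z) →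
        (∃ λ T → (T ⊑ R) × ∃ λ z → z ∈ Z′ × (length T * ∣ set L ∣ + ∣ Z′ ∣ ≤ N) × y ≡ z ∙ (σ T - length T · β)) → Goal
      by-cases _ (T , T⊑ , z , inj₁ z∈ , le , eq) = T , s ∷ʳ T⊑ , z , z∈ ,
        ≤-trans (+-monoʳ-≤ (length T * ∣ set L ∣) (card-mono Z Z′ inj₁)) le , eq
      by-cases (yes f) (T , T⊑ , z , inj₂ z∈ , le , eq) = T , s ∷ʳ T⊑ , z , f z z∈ ,
        ≤-trans (+-monoʳ-≤ (length T * ∣ set L ∣) (card-mono Z Z′ inj₁)) le , eq
      by-cases (no ¬f) (T , T⊑ , z , inj₂ z∈ , le , eq) = s ∷ T , refl ∷ T⊑ , z - d , z∈ , bound , trans eq (lem z s β (σ T) (length T · β))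
        where
        lem : ∀ z s β t u → z ∙ (t - u) ≡ (z - (s - β)) ∙ (s ∙ t - β ∙ u)
        lem = group 5 (λ z s β t u → z ⊞ (t ⊟ u) ⊜ (z ⊟ (s ⊟ β)) ⊞ (s ⊞ t ⊟ β ⊞ u)) refl
        grown : ∣ Z ∣ + ∣ set L ∣ ≤ ∣ Z′ ∣
        grown = grow (⊈-witness (Z ⊹ d) Z (λ f → ¬f (λ x → f)))
          where
          grow : (∃ λ x → x ∈ Z ⊹ d × x ∉ Z) → ∣ Z ∣ + ∣ set L ∣ ≤ ∣ Z′ ∣
          grow (x , x∈ , x∉) = ≤-trans (+-monoʳ-≤ ∣ Z ∣ (≤-reflexive (sym (card-⊹ (set L) x))))
            (card-disjoint Z (cos L x) Z′ (λ q r → x∉ (per-~ L Z pZ q (flip∈ L r))) inj₁ (λ r → cos-⊆ L Z′ pZ′ (inj₂ x∈) r))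
        bound : suc (length T) * ∣ set L ∣ + ∣ Z ∣ ≤ N
        bound = ≤-trans (≤-trans (≤-reflexive (eq′ (∣ set L ∣) (length T * ∣ set L ∣) (∣ Z ∣))) (+-monoʳ-≤ (length T * ∣ set L ∣) grown)) le
          where
          eq′ : ∀ l tl z → l + tl + z ≡ tl + (z + l)
          eq′ = solve-∀

    pairs-bound : ∀ P R → length R * ∣ set P ∣ + outside P β R * ∣ set P ∣ ≤ sumL (map (λ A → ∣ A ⊕ set P ∣) (map pair R))
    pairs-bound P []      = z≤n
    pairs-bound P (s ∷ R) with dec (set P) (s - β)
    ... | yes _ = ≤-trans (≤-reflexive (+-assoc ∣ set P ∣ _ _)) (+-mono-≤
            (card-per P (pair s ⊕ set P) (per-⊕ P (pair s)) (⊆-⊕ P (pair s) {ε} (inj₁ refl))) (pairs-bound P R))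
    ... | no s≁ = ≤-trans (≤-reflexive (eq (∣ set P ∣) (length R * ∣ set P ∣) (outside P β R * ∣ set P ∣))) (+-mono-≤
            (card-two P (pair s ⊕ set P) {s - β} {ε} (per-⊕ P (pair s)) (⊆-⊕ P (pair s) (inj₂ refl)) (⊆-⊕ P (pair s) (inj₁ refl))
              (λ q → s≁ (resp (set P) (lem (s - β)) q))) (pairs-bound P R))
      where
      lem : ∀ x → x - ε ≡ x
      lem = group 1 (λ x → x ⊟ nul ⊜ x) refl
      eq : ∀ p l o → p + l + (p + o) ≡ p + p + (l + o)
      eq = solve-∀

    -- Kneser's bound at the stabiliser `H` of the sum of all pairs: every term outside β + H gains
    -- |H|, and by hypothesis these gains add up to `N`.
    covers : ∀ R → (∀ P → set L ⊆ set P → N ≤ ∣ set P ∣ + outside P β R * ∣ set P ∣) → ∀ y → y ∈ reach (set L) R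
    covers R hyp y = reach-⊇ R (set L) (card-⊇ Z full (λ _ → refl) (≤-trans (≤-reflexive card-full) N≤) {y} refl)
      where
      Z : Sub
      Z = ⨁ (map pair R) ⊕ set L
      H : Sg
      H = stab Z
      ihs : ∀ R → All Inhabited (map pair R)
      ihs []      = []
      ihs (s ∷ R) = (ε , inj₁ refl) ∷ ihs R
      N≤ : N ≤ ∣ Z ∣
      N≤ = ar (∣ set H ∣) (length R * ∣ set H ∣) (outside H β R * ∣ set H ∣) (sumL (map (λ A → ∣ A ⊕ set H ∣) (map pair R))) (∣ Z ∣)
        (hyp H (λ {x} → per-stab L Z (per-⊕ L (⨁ (map pair R))) {x}))
        (pairs-bound H R)
        (≤-trans (kneser-⨁ (map pair R) L H (ihs R) (stab-isStab Z)) (≤-reflexive (cong (λ t → ∣ Z ∣ + t * ∣ set H ∣) (length-map pair R))))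
        where
        ar : ∀ p l o s z → N ≤ p + o → l + o ≤ s → s + p ≤ z + l → N ≤ z
        ar p l o s z h₁ h₂ h₃ = lin≤ 0 (h₁ ⊕≤ h₂ ⊕≤ h₃) (eq N p l o s z)
          where
          eq : ∀ N p l o s z → N + (p + o + s + (z + l)) + 0 ≡ z + (N + (l + o) + (s + p))
          eq = solve-∀

-- What the stabiliser of the subsequence sums forces.

module StabiliserStructure {N : ℕ} (𝔾 : FinAb N) where
  open Sets 𝔾
  open Kneser 𝔾
  open SubsequenceSums 𝔾
  open DeVosGoddynMohar 𝔾
  open DegenerateCase 𝔾
  open IteratedSumsets 𝔾
  open Coverings 𝔾

  card-sg : ∀ g → ∣ sg g ∣ ≤ 1
  card-sg g = ≤-trans (≤-reflexive (sum-single (χ (sg g)) g (λ y → χ-out (sg g)))) (χ≤1 (sg g) g)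

  v-filter-out : ∀ H g A S → Per H A → g ∉ A → v H g (filter (dec A) S) ≡ 0
  v-filter-out H g A []      pA g∉ = refl
  v-filter-out H g A (s ∷ S) pA g∉ with dec A s
  ... | no  _  = v-filter-out H g A S pA g∉
  ... | yes s∈ = cong₂ _+_ (χ-out (set H) (λ q → g∉ (per-~ H A pA s∈ (flip∈ H q)))) (v-filter-out H g A S pA g∉)

  v-filter-in : ∀ H g A S → Per H A → g ∈ A → v H g (filter (¬? ∘ dec A) S) ≡ 0
  v-filter-in H g A []      pA g∈ = refl
  v-filter-in H g A (s ∷ S) pA g∈ with dec A s
  ... | yes _  = v-filter-in H g A S pA g∈
  ... | no s∉ = cong₂ _+_ (χ-out (set H) (λ q → s∉ (per-~ H A pA g∈ q))) (v-filter-in H g A S pA g∈)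

  outside-filter : ∀ H α A S → (∀ {s} → s ∈ A → s - α ∈ set H) → outside H α S ≤ outside H α (filter (¬? ∘ dec A) S)
  outside-filter H α A []      f = z≤n
  outside-filter H α A (s ∷ S) f with dec (set H) (s - α) in eq | dec A s
  ... | yes _  | yes _  = outside-filter H α A S f
  ... | no s≁  | yes s∈ = ⊥-elim (s≁ (f s∈))
  ... | yes _  | no  _ rewrite eq = outside-filter H α A S f
  ... | no  _  | no  _ rewrite eq = s≤s (outside-filter H α A S f)

  -- Here k′ = |K| - 1 and b = |B|. Adding the two bounds cancels nb and N and leaves k′(r + 2) <
  -- k′n, so k′ is positive and r + 2 < n.
  gap-arith : ∀ k′ n r b N → n * b + suc k′ * r + (suc k′ + suc k′) ≤ N + n * suc k′ → n + N ≤ n * b + r + 1 →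
    1 ≤ k′ × r + 2 < n × N < n * b
  gap-arith k′ n r b N h₁ h₂ = 1≤k′ , r+2<n , lin≤ 1 (h₂ ⊕≤ r+2<n) (eq₂ n N (n * b) r)
    where
    key : k′ * (r + 2) < k′ * n
    key = lin≤ 0 (h₁ ⊕≤ h₂) (eq k′ n r (n * b) N)
      where
      eq : ∀ k n r nb N → suc (k * (r + 2)) + (N + n * suc k + (nb + r + 1)) + 0 ≡ k * n + (nb + suc k * r + (suc k + suc k) + (n + N))
      eq = solve-∀
    r+2<n : r + 2 < n
    r+2<n = *-cancelˡ-< k′ (r + 2) n key
    1≤k′ : 1 ≤ k′
    1≤k′ = n≢0⇒n>0 (λ { refl → n≮n 0 key })
    eq₂ : ∀ n N nb r → suc N + (nb + r + 1 + n) + 1 ≡ nb + (n + N + suc (r + 2))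
    eq₂ = solve-∀

  -- Here m = s + 1, t = t′ + 1 and n = m + t.
  outcome-arith : ∀ s t′ π C Λ b N → N < (suc s + suc t′) * b → suc t′ * Λ + Λ ≤ N → b ≤ C →
    π + π ≤ C → C ≤ Λ → suc s * C + π ≤ Λ + suc s * π → ⊥
  outcome-arith s t′ π C Λ b N h₁ h₂ h₃ h₄ h₅ h₆ with m≤n⇒∃[o]m+o≡n h₅
  ... | D , refl = lin⊥ (t′ * D) (≤-trans h₁ (*-monoʳ-≤ (suc s + suc t′) h₃) ⊕≤ h₂ ⊕≤ (h₆ ⊕≤ h₆) ⊕≤ *-monoʳ-≤ s h₄) (eq s t′ π C D N)
    where
    eq : ∀ s t π C D N →
      (suc s + suc t) * C + N + (C + D + suc s * π + (C + D + suc s * π)) + s * C + suc (t * D) ≡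
      suc N + (suc t * (C + D) + (C + D)) + (suc s * C + π + (suc s * C + π)) + s * (π + π)
    eq = solve-∀

  module Core (n : ℕ) (S : Seq) (len : n + N ≤ length S + 1) (mult : ∀ g → v triv g S ≤ n)
    (out : ∀ H α → N ≤ ∣ set H ∣ + outside H α S * ∣ set H ∣) (z₀ : G) (z₀∉ : z₀ ∉ Σs n S)
    (K : Sg) (isK : IsStab K (Σs n S)) where

    B : Sub
    B = sub (λ g → n ≤ v K g S) (λ g → n ≤? v K g S)

    perB : Per K B
    perB {x} {h} p q = ≤-trans p (≤-reflexive (v-cong K (resp (set K) (lem x h) (⁻¹∈ K q)) S))
      where
      lem : ∀ x h → h ⁻¹ ≡ x - x ∙ h
      lem = group 2 (λ x h → inv h ⊜ x ⊟ (x ⊞ h)) refl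

    S-B R : Seq
    S-B = filter (dec B) S
    R   = filter (¬? ∘ dec B) S

    splitS : Split S S-B R
    splitS = split-filter (dec B) S

    r : ℕ
    r = length R

    k : ℕ
    k = ∣ set K ∣

    -- A class inside `B` reaches the cap n; any other class counts with all its terms, and these
    -- are the terms of `R`.
    weight : n * ∣ B ∣ + k * r ≤ sum (λ g → n ⊓ v K g S)
    weight = ≤-trans (≤-reflexive (trans (cong₂ _+_ (*-distribˡ-sum n (χ B)) (sym (sum-v K R))) (sym (∑-distrib-+ (λ g → n * χ B g) (λ g → v K g R)))))
      (sum-mono pt)
      where
      pt : ∀ g → n * χ B g + v K g R ≤ n ⊓ v K g S
      pt g = by-cases (dec B g)
        where
        by-cases : Dec (g ∈ B) → n * χ B g + v K g R ≤ n ⊓ v K g S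
        by-cases (yes g∈) = ≤-reflexive (trans (cong₂ _+_ (trans (cong (n *_) (χ-in B g∈)) (*-identityʳ n)) (v-filter-in K g B S perB g∈))
          (trans (+-identityʳ n) (sym (m≤n⇒m⊓n≡m g∈))))
        by-cases (no g∉) = ≤-trans (≤-reflexive (cong (_+ v K g R) (trans (cong (n *_) (χ-out B g∉)) (*-zeroʳ n))))
          (≤-trans (≤-trans (m≤n+m (v K g R) (v K g S-B)) (≤-reflexive (sym (split-v K g splitS)))) (≤-reflexive (sym (m≥n⇒m⊓n≡n (≰⇒≥ g∉)))))

    Φ : Sys
    Φ = (S , n) ∷ []

    XΦ⊆ : X Φ ⊕ set K ⊆ Σs n S
    XΦ⊆ p with ⊕-out (X Φ) (set K) p
    ... | a , h , a∈ , h∈ , refl with ⊕-out (Σs n S) (sg ε) a∈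
    ... | x , _ , x∈ , refl , refl = per isK (resp (Σs n S) (sym (identityʳ x)) x∈) h∈

    ⊆XΦ : Σs n S ⊆ X Φ ⊕ set K
    ⊆XΦ {x} p = ⊆-⊕ K (X Φ) (⊕-in (Σs n S) (sg ε) p refl (identityʳ x))

    n≤S : n ≤ length S
    n≤S = +-cancelʳ-≤ 1 n (length S) (≤-trans (+-monoʳ-≤ n (≤-trans (card>0 full {ε} refl) (≤-reflexive card-full))) len)

    X-small : ∣ Σs n S ∣ + k ≤ N
    X-small = ≤-trans (+-monoʳ-≤ ∣ Σs n S ∣ (≤-reflexive (sym (card-⊹ (set K) z₀))))
      (≤-trans (card-disjoint (Σs n S) (cos K z₀) full (λ p q → z₀∉ (per-~ K (Σs n S) (per isK) p (flip∈ K q))) (λ _ → refl) (λ _ → refl)) (≤-reflexive card-full))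

    -- The DeVos-Goddyn-Mohar bound for the single sequence `S`. The second k on the left comes from
    -- the whole coset of `z₀`, which Σ_n(S) misses.
    main-bound : n * ∣ B ∣ + k * r + (k + k) ≤ N + n * k
    main-bound = ar (sum (λ g → n ⊓ v K g S)) (n * ∣ B ∣ + k * r) k (∣ Σs n S ∣) N (n * k) weight
        (≤-trans (+-monoˡ-≤ k (≤-reflexive (sum-cong-≗ (λ g → sym (+-identityʳ _)))))
          (≤-trans (dgm Φ K K (n≤S ∷ []) (isStab-cong K (Σs n S) (X Φ ⊕ set K) ⊆XΦ XΦ⊆ isK))
            (+-mono-≤ (card-mono (X Φ ⊕ set K) (Σs n S) XΦ⊆) (≤-reflexive (cong (_* k) (+-identityʳ n)))))) X-small
      where
      ar : ∀ s b k x N nk → b ≤ s → s + k ≤ x + nk → x + k ≤ N → b + (k + k) ≤ N + nk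
      ar s b k x N nk h₁ h₂ h₃ = lin≤ 0 (h₁ ⊕≤ h₂ ⊕≤ h₃) (eq s b k x N nk)
        where
        eq : ∀ s b k x N nk → b + (k + k) + (s + (x + nk) + N) + 0 ≡ N + nk + (b + (s + k) + (x + k))
        eq = solve-∀

    -- The height condition enters here: no element of `B` occurs more than n times.
    heavy-count : length S-B ≤ n * ∣ B ∣
    heavy-count = begin
      length S-B                     ≡⟨ sym (trans (cong (_* length S-B) triv-card) (+-identityʳ (length S-B))) ⟩
      ∣ set triv ∣ * length S-B      ≡⟨ sym (sum-v triv S-B) ⟩
      sum (λ g → v triv g S-B)       ≤⟨ sum-mono (λ g → pt g (dec B g)) ⟩
      sum (λ g → n * χ B g)          ≡⟨ sym (*-distribˡ-sum n (χ B)) ⟩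
      n * ∣ B ∣                      ∎
      where
      open ≤-Reasoning
      triv-card : ∣ set triv ∣ ≡ 1
      triv-card = ≤-antisym (card-sg ε) (Sg>0 triv)
      pt : ∀ g → Dec (g ∈ B) → v triv g S-B ≤ n * χ B g
      pt g (yes g∈) = ≤-trans (≤-trans (m≤m+n (v triv g S-B) (v triv g R)) (≤-reflexive (sym (split-v triv g splitS))))
        (≤-trans (mult g) (≤-reflexive (sym (trans (cong (n *_) (χ-in B g∈)) (*-identityʳ n)))))
      pt g (no g∉) = ≤-trans (≤-reflexive (v-filter-out triv g B S (λ { p refl → resp B (sym (identityʳ _)) p }) g∉)) z≤n

    length-bound : n + N ≤ n * ∣ B ∣ + r + 1
    length-bound = ≤-trans len (+-monoˡ-≤ 1 (≤-trans (≤-reflexive (split-length splitS)) (+-monoˡ-≤ r heavy-count)))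

    facts : 2 ≤ k × r + 2 < n × N < n * ∣ B ∣
    facts = go k refl
      where
      go : ∀ j → j ≡ k → 2 ≤ k × r + 2 < n × N < n * ∣ B ∣
      go zero    eq = ⊥-elim (n≮n 0 (≤-trans (Sg>0 K) (≤-reflexive (sym eq))))
      go (suc j) eq = ≤-trans (s≤s (proj₁ gap)) (≤-reflexive eq) , proj₂ gap
        where
        gap = gap-arith j n r (∣ B ∣) N (subst (λ t → n * ∣ B ∣ + t * r + (t + t) ≤ N + n * t) (sym eq) main-bound) length-bound

    N<nB : N < n * ∣ B ∣
    N<nB = proj₂ (proj₂ facts)

    B-inhabited : Inhabited B
    B-inhabited = card-inhabited B (n≢0⇒n>0 (λ eq → n≮0 (≤-trans N<nB (≤-reflexive (trans (cong (n *_) eq) (*-zeroʳ n))))))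

    module WithBase (β : G) (β∈ : β ∈ B) where
      B₀ : Sub
      B₀ = sub (λ x → x ∙ β ∈ B) (λ x → dec B (x ∙ β))

      ε∈B₀ : ε ∈ B₀
      ε∈B₀ = resp B (sym (identityˡ β)) β∈

      card-B₀ : ∣ B₀ ∣ ≡ ∣ B ∣
      card-B₀ = sum-reindex (χ B) (_∙ β) (_- β) (λ x → x-g∙g x β) (λ x → x∙g-g x β)

      perB₀ : Per K B₀
      perB₀ {x} {h} p q = resp B (lem x h β) (perB p q)
        where
        lem : ∀ x h β → x ∙ β ∙ h ≡ x ∙ h ∙ β
        lem = group 3 (λ x h β → x ⊞ β ⊞ h ⊜ x ⊞ h ⊞ β) refl

      L : Sg
      L = gen B₀ ε∈B₀

      B₀⊆L : B₀ ⊆ set L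
      B₀⊆L = gen-⊇ B₀ ε∈B₀

      open Covering L β

      shifted : ∀ m {x} → x ∈ iter m B₀ → x ∙ m · β ∈ iter m B
      shifted zero    refl = identityˡ ε
      shifted (suc m) p with ⊕-out B₀ (iter m B₀) p
      ... | b , t , b∈ , t∈ , refl = ⊕-in B (iter m B) b∈ (shifted m t∈) (lem b t β (m · β))
        where
        lem : ∀ b t β c → b ∙ β ∙ (t ∙ c) ≡ b ∙ t ∙ (β ∙ c)
        lem = group 4 (λ b t β c → b ⊞ β ⊞ (t ⊞ c) ⊜ b ⊞ t ⊞ (β ⊞ c)) refl

      -- Follows from (t + 1)|L| ≤ N < n|B| ≤ n|L|, and leaves the two copies of `B₀` that
      -- `iterated` asks for.
      t<n : ∀ t → t * ∣ set L ∣ + ∣ set L ∣ ≤ N → suc t < n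
      t<n t le = *-cancelʳ-< ∣ set L ∣ (suc t) n (≤-<-trans (≤-trans (≤-reflexive (+-comm ∣ set L ∣ (t * ∣ set L ∣))) le)
        (<-≤-trans N<nB (*-monoʳ-≤ n (≤-trans (≤-reflexive (sym card-B₀)) (card-mono B₀ (set L) B₀⊆L)))))

      -- The point z₀ - n·β is reached from `L` by t exchanges. If n - t copies of `B₀` fill `L`,
      -- then `z₀` is a sum of n - t terms of `S-B` and t terms of `R`, up to a period in `K`.
      finish : (∀ t m → t * ∣ set L ∣ + ∣ set L ∣ ≤ N → t + suc (suc m) ≡ n → set L ⊆ iter (suc (suc m)) B₀) → ⊥
      finish all-full = z₀∉ (conclude (reach-out R (set L) (∙∈ L) (covers R hyp (z₀ - n · β))))
        where
        hyp : ∀ H → set L ⊆ set H → N ≤ ∣ set H ∣ + outside H β R * ∣ set H ∣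
        -- Elements of `B` lie in β + L, hence in β + H, so all terms outside β + H belong to `R`.
        hyp H L⊆H = ≤-trans (out H β) (+-monoʳ-≤ ∣ set H ∣ (*-monoˡ-≤ ∣ set H ∣
          (outside-filter H β B S (λ {s} s∈ → L⊆H (B₀⊆L (resp B (sym (x-g∙g s β)) s∈))))))
        conclude : (∃ λ T → (T ⊑ R) × ∃ λ z → z ∈ set L × (length T * ∣ set L ∣ + ∣ set L ∣ ≤ N) × z₀ - n · β ≡ z ∙ (σ T - length T · β)) → z₀ ∈ Σs n S
        conclude (T , T⊑ , z , z∈ , le , eq) = final (⊕-out (Σs (suc (suc m)) S-B) (set K) (iter-Σs K B (suc (suc m)) S-B enough
            (shifted (suc (suc m)) (all-full t m le (trans (lem t m) eqn) z∈))))
          where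
          t = length T
          m = proj₁ (m≤n⇒∃[o]m+o≡n (t<n t le))
          eqn : suc (suc t) + m ≡ n
          eqn = proj₂ (m≤n⇒∃[o]m+o≡n (t<n t le))
          lem : ∀ t m → t + suc (suc m) ≡ suc (suc t) + m
          lem = solve-∀
          lem′ : ∀ t m → suc (suc m) + t ≡ suc (suc t) + m
          lem′ = solve-∀
          enough : ∀ {g} → g ∈ B → suc (suc m) ≤ v K g S-B
          enough {g} g∈ = ≤-trans (≤-trans (m≤n+m (suc (suc m)) t) (≤-reflexive (trans (lem t m) eqn)))
            (≤-trans g∈ (≤-reflexive (trans (split-v K g splitS) (trans (cong (v K g S-B +_) (v-filter-in K g B S perB g∈)) (+-identityʳ _)))))
          lem₁ : ∀ x s h → x ∙ s ∙ h ≡ (x ∙ h) ∙ s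
          lem₁ = group 3 (λ x s h → x ⊞ s ⊞ h ⊜ (x ⊞ h) ⊞ s) refl
          lem₂ : ∀ z s a b → (z ∙ a) ∙ s ≡ (z ∙ (s - b)) ∙ (a ∙ b)
          lem₂ = group 4 (λ z s a b → (z ⊞ a) ⊞ s ⊜ (z ⊞ (s ⊟ b)) ⊞ (a ⊞ b)) refl
          calc : ∀ x h → x ∙ h ≡ z ∙ suc (suc m) · β → x ∙ σ T ∙ h ≡ z₀
          calc x h eqx = begin
            x ∙ σ T ∙ h                                             ≡⟨ lem₁ x (σ T) h ⟩
            (x ∙ h) ∙ σ T                                           ≡⟨ ∙ʳ eqx ⟩
            (z ∙ suc (suc m) · β) ∙ σ T                             ≡⟨ lem₂ z (σ T) (suc (suc m) · β) (t · β) ⟩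
            (z ∙ (σ T - t · β)) ∙ (suc (suc m) · β ∙ t · β)         ≡⟨ cong₂ _∙_ (sym eq) (trans (sym (·-+ β (suc (suc m)) t)) (cong (_· β) (trans (lem′ t m) eqn))) ⟩
            (z₀ - n · β) ∙ n · β                                    ≡⟨ x-g∙g z₀ (n · β) ⟩
            z₀                                                      ∎
            where open ≡-Reasoning
          final : (∃ λ x → ∃ λ h → x ∈ Σs (suc (suc m)) S-B × h ∈ set K × x ∙ h ≡ z ∙ suc (suc m) · β) → z₀ ∈ Σs n S
          final (x , h , x∈ , h∈ , eqx) = resp (Σs n S) (calc x h eqx) (per isK
            (subst (λ j → x ∙ σ T ∈ Σs j S) (trans (lem′ t m) eqn)
              (split-Σs splitS (suc (suc m)) t (⊕-in (Σs (suc (suc m)) S-B) (Σs t R) x∈ (T , T⊑ , refl , refl) refl))) h∈)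

      -- If `B` were a single coset of `K`, then `L` would lie in `K`, and every positive multiple
      -- of the `K`-periodic set `B₀` would contain `L`.
      B-two : k + k ≤ ∣ B ∣
      B-two = decidable-stable (k + k ≤? ∣ B ∣) (λ ¬two → finish (λ t m _ _ {x} x∈ →
        resp (iter (suc (suc m)) B₀) (identityˡ x) (per-sumˡ K B₀ (iter (suc m) B₀) perB₀ (iter-ε B₀ ε∈B₀ (suc (suc m)))
          (gen-least B₀ ε∈B₀ K (λ {b} b∈ → decidable-stable (dec (set K) b) (λ b∉ → ¬two (≤-trans
            (card-two K B₀ perB₀ b∈ ε∈B₀ (λ q → b∉ (resp (set K) (lem b) q))) (≤-reflexive card-B₀)))) {x} x∈))))
        where
        lem : ∀ b → b - ε ≡ b
        lem = group 1 (λ b → b ⊟ nul ⊜ b) refl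

      -- For t = 0 the order statement of the `Outcome` passes to `K`, because `K` lies in the
      -- stabiliser of the n-fold sum of `B₀`. For t > 0 `outcome-arith` applies, as `B₀` meets at
      -- least two cosets of the proper subgroup `Q`.
      core : (∀ γ → (∀ i → 1 ≤ i → i ≤ n → i · γ ∉ set K) → ⊥) → ⊥
      core no-order = finish (λ t m le eq {x} x∈ → decidable-stable (dec (iter (suc (suc m)) B₀) x) (λ x∉ →
          iterated L B₀ ε∈B₀ B₀⊆L (λ H f {y} → gen-least B₀ ε∈B₀ H f {y}) m (large t m le eq) (λ f → x∉ (f x∈)) (refute t m le eq)))
        where
        large : ∀ t m → t * ∣ set L ∣ + ∣ set L ∣ ≤ N → t + suc (suc m) ≡ n → ∣ set L ∣ < suc (suc m) * ∣ B₀ ∣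
        large t m le eq = ar (∣ set L ∣) (∣ B₀ ∣) t (suc (suc m)) le
            (<-≤-trans N<nB (≤-reflexive (cong₂ _*_ (sym eq) (sym card-B₀)))) (*-monoʳ-≤ t (card-mono B₀ (set L) B₀⊆L))
          where
          ar : ∀ l b t m → t * l + l ≤ N → N < (t + m) * b → t * b ≤ t * l → l < m * b
          ar l b t m h₁ h₂ h₃ = lin≤ 0 (h₁ ⊕≤ h₂ ⊕≤ h₃) (eq′ l (t * l) (t * b) (m * b) N (*-distribʳ-+ b t m))
            where
            eq″ : ∀ l tl tb mb N → suc l + (N + (tb + mb) + tl) + 0 ≡ mb + (tl + l + suc N + tb)
            eq″ = solve-∀
            eq′ : ∀ l tl tb mb N {x} → x ≡ tb + mb → suc l + (N + x + tl) + 0 ≡ mb + (tl + l + suc N + tb)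
            eq′ l tl tb mb N refl = eq″ l tl tb mb N
        refute : ∀ t m → t * ∣ set L ∣ + ∣ set L ∣ ≤ N → t + suc (suc m) ≡ n →
          Outcome L (stab (iter (suc (suc m)) B₀)) B₀ (suc (suc m)) → ⊥
        refute zero m le refl o = no-order (Outcome.γ o) (λ i 1≤i i≤n p → Outcome.order o i 1≤i i≤n
          (per-stab K (iter (suc (suc m)) B₀) (per-sumˡ K B₀ (iter (suc m) B₀) perB₀) {i · Outcome.γ o} p))
        refute (suc t) m le eq o = outcome-arith (suc m) t (∣ set Q ∣) (∣ B₀ ⊕ set Q ∣) (∣ set L ∣) (∣ B ∣) N
            (<-≤-trans N<nB (≤-reflexive (cong (_* ∣ B ∣) (trans (sym eq) (+-comm (suc t) (suc (suc m))))))) le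
            (≤-trans (≤-reflexive (sym card-B₀)) (card-⊆-⊕ Q B₀))
            (two (⊈-witness B₀ (set Q) (λ f → Outcome.L⊈Q o (λ {y} → gen-least B₀ ε∈B₀ Q f {y}))))
            (card-mono (B₀ ⊕ set Q) (set L) in-L)
            (Outcome.size o)
          where
          Q = Outcome.Q o
          in-L : B₀ ⊕ set Q ⊆ set L
          in-L p with ⊕-out B₀ (set Q) p
          ... | b , h , b∈ , h∈ , refl = ∙∈ L (B₀⊆L b∈) (Outcome.Q⊆L o h∈)
          two : (∃ λ b → b ∈ B₀ × b ∉ set Q) → ∣ set Q ∣ + ∣ set Q ∣ ≤ ∣ B₀ ⊕ set Q ∣
          two (b , b∈ , b∉) = card-two Q (B₀ ⊕ set Q) (per-⊕ Q B₀) (⊆-⊕ Q B₀ b∈) (⊆-⊕ Q B₀ ε∈B₀) (λ q → b∉ (resp (set Q) (lem b) q))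
            where
            lem : ∀ b → b - ε ≡ b
            lem = group 1 (λ b → b ⊟ nul ⊜ b) refl

-- The four conditions on n.

module Cases {N : ℕ} (𝔾 : FinAb N) where
  open Sets 𝔾
  open Kneser 𝔾
  open SubsequenceSums 𝔾
  open DegenerateCase 𝔾
  open Coverings 𝔾
  open StabiliserStructure 𝔾

  card-multiples-exact : ∀ M d e → (∀ i → 1 ≤ i → i < e → i · d ∉ set M) → ∣ multiples M d e ∣ ≡ e * ∣ set M ∣
  card-multiples-exact M d e free = ≤-antisym (card-multiples M d e) (go e free)
    where
    go : ∀ e → (∀ i → 1 ≤ i → i < e → i · d ∉ set M) → e * ∣ set M ∣ ≤ ∣ multiples M d e ∣
    go zero    free = z≤n
    go (suc e) free = ≤-trans (≤-reflexive (+-comm ∣ set M ∣ (e * ∣ set M ∣)))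
      (≤-trans (+-mono-≤ (go e (λ i p q → free i p (m≤n⇒m≤1+n q))) (≤-reflexive (sym (card-⊹ (set M) (e · d)))))
        (card-disjoint (multiples M d e) (cos M (e · d)) (multiples M d (suc e)) dis inj₁ inj₂))
      where
      dis : Disjoint (multiples M d e) (cos M (e · d))
      dis {x} p q with multiples-∈ M d e p
      ... | j , j<e , r with m≤n⇒∃[o]m+o≡n j<e
      ...   | o , eq = free (suc o) (s≤s z≤n) (s≤s (≤-trans (m≤n+m (suc o) j) (≤-reflexive (trans (+-suc j o) eq))))
                (resp (set M) calc (-∈ M r q))
        where
        lem : ∀ x a b → (x - a) - (x - a ∙ b) ≡ b
        lem = group 3 (λ x a b → (x ⊟ a) ⊟ (x ⊟ (a ⊞ b)) ⊜ b) refl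
        calc : (x - j · d) - (x - e · d) ≡ suc o · d
        calc = trans (cong (λ t → (x - j · d) - (x - t)) (trans (cong (_· d) (trans (sym eq) (sym (+-suc j o)))) (·-+ d j (suc o))))
          (lem x (j · d) (suc o · d))

  extend-whole : ∀ M d e → (∀ i → 1 ≤ i → i < e → i · d ∉ set M) → (∀ x → x ∈ multiples M d e) → N ≡ e * ∣ set M ∣
  extend-whole M d e free all = trans (trans (sym card-full) (card-cong full (multiples M d e) (λ {x} _ → all x) (λ _ → refl)))
    (card-multiples-exact M d e free)

  extend-divides : ∀ M d e → 1 ≤ e → (∀ i → 1 ≤ i → i < e → i · d ∉ set M) → e · d ∈ set M → ∃ λ j → N ≡ j * (e * ∣ set M ∣)
  extend-divides M d e 1≤e free p with lagrange (extend M d e 1≤e p) full (λ _ _ → refl)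
  ... | j , eq = j , trans (sym card-full) (trans eq (cong (j *_) (card-multiples-exact M d e free)))

  ·-ε : ∀ a → a · ε ≡ ε
  ·-ε zero    = refl
  ·-ε (suc a) = trans (identityˡ _) (·-ε a)

  -- By Bézout for i and the prime e, x is up to sign a multiple of i·x modulo multiples of e·x = 0.
  prime-free : ∀ H x e → Prime e → e · x ≡ ε → x ∉ set H → ∀ i → 1 ≤ i → i < e → i · x ∉ set H
  prime-free H x e pr ex x∉ (suc i) _ i<e p with coprime-Bézout (prime⇒coprime pr i<e)
  ... | Bézout.+- a b eq = x∉ (resp (set H) (sym calc) (⁻¹∈ H (·∈ H b p)))
    where
    calc : x ≡ (b · (suc i · x)) ⁻¹
    calc = trans (lem x (b · (suc i · x))) (trans (∙ʳ calc′) (identityˡ _))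
      where
      lem : ∀ x y → x ≡ (x ∙ y) ∙ y ⁻¹
      lem = group 2 (λ x y → x ⊜ (x ⊞ y) ⊞ inv y) refl
      calc′ : x ∙ b · (suc i · x) ≡ ε
      calc′ = begin
        x ∙ b · (suc i · x)        ≡⟨ ∙ˡ (×-assocˡ x b (suc i)) ⟩
        (1 + b * suc i) · x        ≡⟨ cong (_· x) eq ⟩
        (a * e) · x                ≡⟨ sym (×-assocˡ x a e) ⟩
        a · (e · x)                ≡⟨ trans (cong (a ·_) ex) (·-ε a) ⟩
        ε                          ∎
        where open ≡-Reasoning
  ... | Bézout.-+ a b eq = x∉ (resp (set H) (sym calc) (·∈ H b p))
    where
    calc : x ≡ b · (suc i · x)
    calc = begin
      x                          ≡⟨ sym (identityʳ x) ⟩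
      x ∙ ε                      ≡⟨ ∙ˡ (sym (trans (cong (a ·_) ex) (·-ε a))) ⟩
      x ∙ a · (e · x)            ≡⟨ ∙ˡ (×-assocˡ x a e) ⟩
      (1 + a * e) · x            ≡⟨ cong (_· x) eq ⟩
      (b * suc i) · x            ≡⟨ sym (×-assocˡ x b (suc i)) ⟩
      b · (suc i · x)            ∎
      where open ≡-Reasoning

  -- In an elementary abelian p-group, p = n + 1, indices of subgroups are powers of p, hence ≡ 1 modulo n.
  elementary-index : ∀ n K → Prime (suc n) → (∀ x → suc n · x ≡ ε) → ∃ λ t → N ≡ (1 + n * t) * ∣ set K ∣
  elementary-index n K pr ex = go K (0 , trans (sym (+-identityʳ k)) (cong (λ u → (1 + u) * k) (sym (*-zeroʳ n)))) (<-wellFounded _)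
    where
    k = ∣ set K ∣
    go : ∀ H → (∃ λ t → ∣ set H ∣ ≡ (1 + n * t) * k) → Acc _<_ (N ∸ ∣ set H ∣) → ∃ λ t → N ≡ (1 + n * t) * k
    go H (t , eq) (acc rec) = by-cases (⊆-dec full (set H))
      where
      by-cases : Dec (∀ x → x ∈ full → x ∈ set H) → ∃ λ t → N ≡ (1 + n * t) * k
      by-cases (yes f) = t , trans (trans (sym card-full) (card-cong full (set H) (λ {x} → f x) (λ _ → refl))) eq
      by-cases (no ¬f) = step (⊈-witness full (set H) (λ f → ¬f (λ x → f)))
        where
        step : (∃ λ x → x ∈ full × x ∉ set H) → ∃ λ t → N ≡ (1 + n * t) * k
        step (x , _ , x∉) = go H′ (t + (1 + n * t) , trans card′ (trans (cong (suc n *_) eq) (lem n t k)))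
            (rec (∸-monoʳ-< (card-strict (set H) (set H′) {x} H⊆ x∈ x∉) (card≤N (set H′))))
          where
          lem : ∀ n t k → suc n * ((1 + n * t) * k) ≡ (1 + n * (t + (1 + n * t))) * k
          lem = solve-∀
          x·∈ : suc n · x ∈ set H
          x·∈ = resp (set H) (sym (ex x)) (ε∈ H)
          H′ : Sg
          H′ = extend H x (suc n) (s≤s z≤n) x·∈
          card′ : ∣ set H′ ∣ ≡ suc n * ∣ set H ∣
          card′ = card-multiples-exact H x (suc n) (prime-free H x (suc n) pr (ex x) x∉)
          H⊆ : set H ⊆ set H′
          H⊆ {y} p = ∈-multiples H x (suc n) 0 (s≤s z≤n) (resp (set H) (lem′ y) p)
            where
            lem′ : ∀ y → y ≡ y - ε
            lem′ = group 1 (λ y → y ⊜ y ⊟ nul) refl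
          x∈ : x ∈ set H′
          x∈ = ∈-multiples H x (suc n) 1 (1<p n pr) (resp (set H) (sym (trans (cong (x -_) (identityʳ x)) (inverseʳ x))) (ε∈ H))
            where
            1<p : ∀ n → Prime (suc n) → 1 < suc n
            1<p zero    pr = ⊥-elim (¬prime[1] pr)
            1<p (suc n) pr = s≤s (s≤s z≤n)

  prime-divisor : ∀ k → 2 ≤ k → ∃ λ p → Prime p × p ∣ⁿ k
  prime-divisor k 2≤k = go (PrimeFactorisation.factors f) (PrimeFactorisation.isFactorisation f) (PrimeFactorisation.factorsPrime f)
    where
    f : PrimeFactorisation k
    f = factorise k {{>-nonZero (≤-trans (s≤s z≤n) 2≤k)}}
    go : ∀ fs → k ≡ product fs → All Prime fs → ∃ λ p → Prime p × p ∣ⁿ k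
    go []       eq _          = ⊥-elim (n≮n 1 (≤-trans 2≤k (≤-reflexive eq)))
    go (p ∷ fs) eq (pr ∷ _) = p , pr , subst (p ∣ⁿ_) (sym eq) (m∣m*n (product fs))

  -- In units of k, the group has 1 + nt cosets of K and `B` has b. The strict bound nb > 1 + nt
  -- gives b > t, while the other bound gives nb < n(t + 1).
  elementary-arith : ∀ n k t b r N → N ≡ (1 + n * t) * k → 1 ≤ k → N < n * (b * k) → n * (b * k) + k * r + (k + k) ≤ N + n * k → ⊥
  elementary-arith n k t b r .((1 + n * t) * k) refl 1≤k h₁ h₂ = n≮n (n * b) (≤-trans b≤ (*-monoʳ-≤ n t<b))
    where
    lem₁ : ∀ n b k → n * (b * k) ≡ (n * b) * k
    lem₁ = solve-∀
    t<b : suc t ≤ b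
    t<b = *-cancelˡ-< n t b (≤-<-trans (n≤1+n (n * t)) (*-cancelʳ-< k (1 + n * t) (n * b) (<-≤-trans h₁ (≤-reflexive (lem₁ n b k)))))
    b≤ : suc (n * b) ≤ n * suc t
    b≤ = *-cancelʳ-≤ (suc (n * b)) (n * suc t) k {{>-nonZero 1≤k}} (lin≤ (k * r) h₂ (eq n b k t r))
      where
      eq : ∀ n b k t r → suc (n * b) * k + ((1 + n * t) * k + n * k) + k * r ≡ n * suc t * k + (n * (b * k) + k * r + (k + k))
      eq = solve-∀

  module Conclusion (n : ℕ) (S : Seq) (len : n + N ≤ length S + 1) (mult : ∀ g → v triv g S ≤ n)
    (out : ∀ H α → N ≤ ∣ set H ∣ + outside H α S * ∣ set H ∣) (z₀ : G) (z₀∉ : z₀ ∉ Σs n S) where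

    K : Sg
    K = stab (Σs n S)

    open Core n S len mult out z₀ z₀∉ K (stab-isStab (Σs n S)) using (B; perB; r; k; main-bound; facts; B-inhabited; module WithBase)

    no-order : (∀ γ → (∀ i → 1 ≤ i → i ≤ n → i · γ ∉ set K) → ⊥) → ⊥
    no-order = WithBase.core (proj₁ B-inhabited) (proj₂ B-inhabited)

    3≤n : 3 ≤ n
    3≤n = ≤-trans (s≤s (m≤n+m 2 r)) (proj₁ (proj₂ facts))

    -- With |B| ≥ 2|K| in `main-bound`, half of 2n|K| cancels against n|K| on the right.
    n+2≤ : (n + 2) * k ≤ N
    n+2≤ = ar n (∣ B ∣) k r N (WithBase.B-two (proj₁ B-inhabited) (proj₂ B-inhabited)) main-bound
      where
      ar : ∀ n b k r N → k + k ≤ b → n * b + k * r + (k + k) ≤ N + n * k → (n + 2) * k ≤ N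
      ar n b k r N h₁ h₂ = lin≤ (k * r) (*-monoʳ-≤ n h₁ ⊕≤ h₂) (eq n b k r N)
        where
        eq : ∀ n b k r N → (n + 2) * k + (n * b + (N + n * k)) + k * r ≡ N + (n * (k + k) + (n * b + k * r + (k + k)))
        eq = solve-∀

    exponent-case : ∀ e → 1 ≤ e → (∀ x → e · x ≡ ε) → e ≤ n → ⊥
    exponent-case e 1≤e ex e≤n = no-order (λ γ free → free e 1≤e e≤n (resp (set K) (sym (ex γ)) (ε∈ K)))

    -- N ≥ (n + 2)|K| ≥ 5 · 2.
    small-case : N < 10 → ⊥
    small-case lt = n≮n N (≤-trans lt (≤-trans (*-mono-≤ (+-monoˡ-≤ 2 3≤n) (proj₁ facts)) n+2≤))

    k∣N : ∃ λ j → N ≡ j * k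
    k∣N with lagrange K full (λ _ _ → refl)
    ... | j , eq = j , trans (sym card-full) eq

    -- (n + 2)|K| ≤ N = qp ≤ (n + 1)p gives |K| < p, but a prime divisor of |K| also divides N and
    -- so is at least p.
    cyclic-case : ∀ p q → Prime p → (∀ p′ → Prime p′ → p′ ∣ⁿ N → p ≤ p′) → N ≡ q * p → q ≤ n + 1 → ⊥
    cyclic-case p q pr smallest N≡ q≤ = go (prime-divisor k (proj₁ facts))
      where
      k<p : k < p
      k<p = *-cancelˡ-< (n + 1) k p (<-≤-trans (<-≤-trans (*-monoˡ-< k {{>-nonZero (Sg>0 K)}} (+-monoʳ-< n (s≤s (s≤s z≤n)))) n+2≤)
        (≤-trans (≤-reflexive N≡) (*-monoˡ-≤ p q≤)))
      go : (∃ λ p′ → Prime p′ × p′ ∣ⁿ k) → ⊥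
      go (p′ , pr′ , p′∣k) = n≮n k (≤-trans k<p (≤-trans (smallest p′ pr′ (∣-trans p′∣k (divides (proj₁ k∣N) (proj₂ k∣N))))
        (∣⇒≤ {{>-nonZero (Sg>0 K)}} p′∣k)))

    prime-exponent-case : Prime (suc n) → (∀ x → suc n · x ≡ ε) → ⊥
    prime-exponent-case pr ex = go (elementary-index n K pr ex) (lagrange K B perB)
      where
      go : (∃ λ t → N ≡ (1 + n * t) * k) → (∃ λ b → ∣ B ∣ ≡ b * k) → ⊥
      go (t , eq) (b , eqB) = elementary-arith n k t b r N eq (Sg>0 K)
        (subst (λ u → N < n * u) eqB (proj₂ (proj₂ facts))) (subst (λ u → n * u + k * r + (k + k) ≤ N + n * k) eqB main-bound)

    -- An element of order above n modulo `K` has order exactly n + 1 there, so (n + 1)|K| divides N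
    -- = (n + 1)|F|. Hence |K| divides the prime |F|: |K| = 1 contradicts |K| ≥ 2, and |K| = |F|
    -- contradicts (n + 2)|K| ≤ N.
    prime-summand-case : ∀ (F : Sg) c → Prime ∣ set F ∣ → (∀ x → suc n · x ≡ ε) →
      (∀ i → 1 ≤ i → i < suc n → i · c ∉ set F) → (∀ x → x ∈ multiples F c (suc n)) → ⊥
    prime-summand-case F c pr ex free all = no-order (λ γ free′ → go (extend-divides K γ (suc n) (s≤s z≤n)
        (λ i p q → free′ i p (≤-pred q)) (resp (set K) (sym (ex γ)) (ε∈ K))))
      where
      N≡ : N ≡ suc n * ∣ set F ∣
      N≡ = extend-whole F c (suc n) free all
      go : (∃ λ j → N ≡ j * (suc n * k)) → ⊥
      go (j , eq) with prime⇒irreducible pr (divides {k} j (*-cancelˡ-≡ (∣ set F ∣) (j * k) (suc n) (trans (sym N≡) (trans eq (lem j n k)))))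
        where
        lem : ∀ j n k → j * (suc n * k) ≡ suc n * (j * k)
        lem = solve-∀
      ... | inj₁ k≡1 = n≮n 1 (≤-trans (proj₁ facts) (≤-reflexive k≡1))
      ... | inj₂ k≡F = n≮n N (≤-trans (≤-trans (s≤s (≤-reflexive (trans N≡ (cong (suc n *_) (sym k≡F)))))
              (≤-trans (*-monoˡ-< k {{>-nonZero (Sg>0 K)}} {suc n} {n + 2} (≤-reflexive (+-comm 2 n))) ≤-refl)) n+2≤)

-- Transport to `Fin N`, and the theorem.

module Transfer {c ℓ : Level} (G : FiniteAbelianGroup c ℓ) where
  private
    module A = FiniteAbelianGroup G
    module D = FAG G
    N = A.size

  -- The enumeration turns the setoid equality of the group into propositional equality on indices.
  idx : A.Carrier → Fin N
  idx g = proj₁ (A.enum-surj g)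

  enum-idx : ∀ g → A.enum (idx g) A.≈ g
  enum-idx g = proj₂ (A.enum-surj g)

  idx-cong : ∀ {g h} → g A.≈ h → idx g ≡ idx h
  idx-cong {g} {h} g≈h = A.enum-inj _ _ (A.trans (enum-idx g) (A.trans g≈h (A.sym (enum-idx h))))

  idx-enum : ∀ i → idx (A.enum i) ≡ i
  idx-enum i = A.enum-inj _ _ (enum-idx (A.enum i))

  idx-inj : ∀ {g h} → idx g ≡ idx h → g A.≈ h
  idx-inj {g} {h} eq = A.trans (A.sym (enum-idx g)) (A.trans (A.reflexive (cong A.enum eq)) (enum-idx h))

  op : Fin N → Fin N → Fin N
  op i j = idx (A.enum i A.∙ A.enum j)

  iv : Fin N → Fin N
  iv i = idx (A.enum i A.⁻¹)

  idx-∙ : ∀ g h → op (idx g) (idx h) ≡ idx (g A.∙ h)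
  idx-∙ g h = idx-cong (A.∙-cong (enum-idx g) (enum-idx h))

  idx-⁻¹ : ∀ g → iv (idx g) ≡ idx (g A.⁻¹)
  idx-⁻¹ g = idx-cong (A.⁻¹-cong (enum-idx g))

  isAbelianGroup : IsAbelianGroup _≡_ op (idx A.ε) iv
  isAbelianGroup = record
    { isGroup = record
      { isMonoid = record
        { isSemigroup = record
          { isMagma = record { isEquivalence = ≡.isEquivalence ; ∙-cong = cong₂ op }
          ; assoc = λ i j k → idx-cong (A.trans (A.∙-congʳ (enum-idx _)) (A.trans (A.assoc _ _ _) (A.∙-congˡ (A.sym (enum-idx _)))))
          }
        ; identity = (λ i → trans (idx-cong (A.trans (A.∙-congʳ (enum-idx _)) (A.identityˡ _))) (idx-enum i)) ,
                     (λ i → trans (idx-cong (A.trans (A.∙-congˡ (enum-idx _)) (A.identityʳ _))) (idx-enum i))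
        }
      ; inverse = (λ i → idx-cong (A.trans (A.∙-congʳ (enum-idx _)) (A.inverseˡ _))) ,
                  (λ i → idx-cong (A.trans (A.∙-congˡ (enum-idx _)) (A.inverseʳ _)))
      ; ⁻¹-cong = cong iv
      }
    ; comm = λ i j → idx-cong (A.comm _ _)
    }

  𝔾 : FinAb N
  𝔾 = record { _∙_ = op ; ε = idx A.ε ; _⁻¹ = iv ; isAbelianGroup = isAbelianGroup }

  open Sets 𝔾
  open SubsequenceSums 𝔾
  open DegenerateCase 𝔾
  open Coverings 𝔾
  open Cases 𝔾

  idx-- : ∀ g h → idx g - idx h ≡ idx (g A.∙ h A.⁻¹)
  idx-- g h = trans (cong (op (idx g)) (idx-⁻¹ h)) (idx-∙ g (h A.⁻¹))

  idx-· : ∀ m g → m · idx g ≡ idx (m D.· g)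
  idx-· zero    g = refl
  idx-· (suc m) g = trans (cong (op (idx g)) (idx-· m g)) (idx-∙ g (m D.· g))

  idx-σ : ∀ T → σ (map idx T) ≡ idx (D.σ T)
  idx-σ []      = refl
  idx-σ (t ∷ T) = trans (cong (op (idx t)) (idx-σ T)) (idx-∙ t (D.σ T))

  ⊑-map⁻ : ∀ {T} S → T ⊑ map idx S → ∃ λ T₀ → T₀ ⊑ S × map idx T₀ ≡ T
  ⊑-map⁻ []      []         = [] , [] , refl
  ⊑-map⁻ (s ∷ S) (_ ∷ʳ p)   with ⊑-map⁻ S p
  ... | T₀ , q , eq = T₀ , s ∷ʳ q , eq
  ⊑-map⁻ (s ∷ S) (refl ∷ p) with ⊑-map⁻ S p
  ... | T₀ , q , eq = s ∷ T₀ , refl ∷ q , cong (idx s ∷_) eq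

  Σs-transfer : ∀ n S g → idx g ∈ Σs n (map idx S) → g D.∈Σ[ n ] S
  Σs-transfer n S g (T , T⊑ , len , eq) with ⊑-map⁻ S T⊑
  ... | T₀ , q , refl = T₀ , q , trans (sym (length-map idx T₀)) len , idx-inj (trans (sym (idx-σ T₀)) eq)

  v-transfer : ∀ g S → v triv g (map idx S) ≤ D.v (A.enum g) S
  v-transfer g []      = z≤n
  v-transfer g (s ∷ S) = +-mono-≤ (head (s A.≟ A.enum g)) (v-transfer g S)
    where
    head : (d : Dec (s A.≈ A.enum g)) → χ (sg (idx A.ε)) (idx s - g) ≤ (if ⌊ d ⌋ then 1 else 0)
    head (yes _) = χ≤1 (sg (idx A.ε)) (idx s - g)
    head (no s≉) = ≤-reflexive (χ-out (sg (idx A.ε)) (λ eq → s≉ (A.trans (A.sym (enum-idx s)) (A.reflexive (cong A.enum (lem (idx s) g eq))))))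
      where
      lem : ∀ x y → x - y ≡ idx A.ε → x ≡ y
      lem x y eq = trans (sym (x-g∙g x y)) (trans (cong (λ t → op t y) eq) (identityˡ y))

  bit : Bool → ℕ
  bit b = if b then 1 else 0

  countL-tabulate : ∀ {a} {B : Set a} {M} (p : B → Bool) (f : Fin M → B) → countL p (tabulate f) ≡ foldr _+_ 0 (tabulate (λ i → bit (p (f i))))
  countL-tabulate {M = zero}  p f = refl
  countL-tabulate {M = suc M} p f = cong (bit (p (f zero)) +_) (countL-tabulate p (λ i → f (suc i)))

  countL-sum : (p : Fin N → Bool) → countL p (allFin N) ≡ sum (λ i → bit (p i))
  countL-sum p = trans (countL-tabulate p (λ i → i)) (sym (sum-tabulate (λ i → bit (p i))))

  toSubgroup : Sg → D.Subgroup
  toSubgroup H = record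
    { mem      = λ x → does (dec (set H) (idx x))
    ; mem-resp = λ x≈y → cong (λ i → does (dec (set H) i)) (idx-cong x≈y)
    ; mem-ε    = dec-true (dec (set H) (idx A.ε)) (ε∈ H)
    ; mem-∙    = λ {x} {y} p q → dec-true (dec (set H) _) (resp (set H) (idx-∙ x y) (∙∈ H (un x p) (un y q)))
    ; mem-⁻¹   = λ {x} p → dec-true (dec (set H) _) (resp (set H) (idx-⁻¹ x) (⁻¹∈ H (un x p)))
    }
    where
    un : ∀ x → does (dec (set H) (idx x)) ≡ true → idx x ∈ set H
    un x eq with dec (set H) (idx x)
    ... | yes p = p
    un x () | no _

  fromSubgroup : D.Subgroup → Sg
  fromSubgroup F = mkSg (sub (λ i → D.mem F (A.enum i) ≡ true) (λ i → D.mem F (A.enum i) Bool.≟ true))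
    (trans (D.mem-resp F (enum-idx A.ε)) (D.mem-ε F))
    (λ {i} {j} p q → trans (D.mem-resp F (enum-idx _)) (D.mem-∙ F p q))

  card-fromSubgroup : ∀ F → ∣ set (fromSubgroup F) ∣ ≡ D.card F
  card-fromSubgroup F = trans (sum-cong-≗ pt) (sym (countL-sum (λ i → D.mem F (A.enum i))))
    where
    pt : ∀ i → χ (set (fromSubgroup F)) i ≡ bit (D.mem F (A.enum i))
    pt i with D.mem F (A.enum i)
    ... | true  = refl
    ... | false = refl

  module _ (H : Sg) where
    private F = toSubgroup H

    near : ∀ x α → does (dec (set H) (idx (x A.∙ α A.⁻¹))) ≡ does (dec (set H) (idx x - idx α))
    near x α = cong (λ i → does (dec (set H) i)) (sym (idx-- x α))

    outside-transfer : ∀ a S → outside H a (map idx S) ≡ D.outside F (A.enum a) S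
    outside-transfer a []      = refl
    outside-transfer a (s ∷ S) with dec (set H) (idx s - a) | near′
      where
      near′ : D.mem F (s A.∙ A.enum a A.⁻¹) ≡ does (dec (set H) (idx s - a))
      near′ = trans (near s (A.enum a)) (cong (λ i → does (dec (set H) (idx s - i))) (idx-enum a))
    ... | yes _ | eq rewrite eq = outside-transfer a S
    ... | no  _ | eq rewrite eq = cong suc (outside-transfer a S)

    allL-false : ∀ {a} {B : Set a} (p : B → Bool) xs → allL p xs ≡ false → ∃ λ x → p x ≡ false
    allL-false p (x ∷ xs) eq with p x in eqx
    ... | true  = allL-false p xs eq
    ... | false = x , eqx

    -- An index that is not a first representative exposes an earlier one in the same coset, and
    -- indices cannot decrease forever.
    first-rep : ∀ i → Acc _<_ (toℕ i) → ∃ λ j → D.isFirstRep F j ≡ true × i - j ∈ set H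
    first-rep i (acc rec) with D.isFirstRep F i in eq
    ... | true  = i , eq , refl∈ H
    ... | false with allL-false _ (allFin N) eq
    ...   | j , eq′ = descend (toℕ j <ᵇ toℕ i) refl (dec (set H) (idx (A.enum j A.∙ A.enum i A.⁻¹))) eq′
      where
      descend : ∀ b → (toℕ j <ᵇ toℕ i) ≡ b → (d : Dec (idx (A.enum j A.∙ A.enum i A.⁻¹) ∈ set H)) →
        not b ∨ not (does d) ≡ false → ∃ λ j → D.isFirstRep F j ≡ true × i - j ∈ set H
      descend false _ _ ()
      descend true  _ (no _) ()
      descend true  lt (yes p) _ with first-rep j (rec (<ᵇ⇒< (toℕ j) (toℕ i) (subst IsTrue (sym lt) _)))
      ... | k , fk , q = k , fk , trans∈ H (flip∈ H (resp (set H) (trans (sym (idx-- (A.enum j) (A.enum i))) (cong₂ _-_ (idx-enum j) (idx-enum i))) p)) q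

    -- Double counting of pairs formed by an element and a first representative of its coset; each
    -- element occurs in at least one pair.
    index-bound : N ≤ D.index F * ∣ set H ∣
    index-bound = begin
      N                                                        ≡⟨ sym (trans (sum-const N 1) (*-identityʳ N)) ⟩
      sum {N} (λ _ → 1)                                        ≤⟨ sum-mono hit ⟩
      sum (λ g → sum (λ j → f j * χ (set H) (g - j)))          ≡⟨ ∑-comm (λ g j → f j * χ (set H) (g - j)) ⟩
      sum (λ j → sum (λ g → f j * χ (set H) (g - j)))          ≡⟨ sum-cong-≗ (λ j → trans (sym (*-distribˡ-sum (f j) (λ g → χ (set H) (g - j)))) (trans (cong (f j *_) (sum-shift (χ (set H)) j)) (*-comm (f j) ∣ set H ∣))) ⟩
      sum (λ j → ∣ set H ∣ * f j)                              ≡⟨ sym (*-distribˡ-sum ∣ set H ∣ f) ⟩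
      ∣ set H ∣ * sum f                                        ≡⟨ trans (*-comm ∣ set H ∣ (sum f)) (cong (_* ∣ set H ∣) (sym (countL-sum (D.isFirstRep F)))) ⟩
      D.index F * ∣ set H ∣                                    ∎
      where
      open ≤-Reasoning
      f : Fin N → ℕ
      f j = bit (D.isFirstRep F j)
      hit : ∀ g → 1 ≤ sum (λ j → f j * χ (set H) (g - j))
      hit g with first-rep g (<-wellFounded _)
      ... | j , fj , p = ≤-trans (≤-reflexive (sym (cong₂ _*_ (cong bit fj) (χ-in (set H) p)))) (sum-term (λ j → f j * χ (set H) (g - j)) j)

  -- The added |H| removes the truncated subtraction and covers H = G trivially, so the bound holds
  -- for all subgroups alike.
  out-transfer : ∀ S → (∀ (F : D.Subgroup) → D.Proper F → ∀ α → D.index F ∸ 1 ≤ D.outside F α S) →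
    ∀ H a → N ≤ ∣ set H ∣ + outside H a (map idx S) * ∣ set H ∣
  out-transfer S hyp H a = by-cases (⊆-dec full (set H))
    where
    F = toSubgroup H
    by-cases : Dec (∀ x → x ∈ full → x ∈ set H) → N ≤ ∣ set H ∣ + outside H a (map idx S) * ∣ set H ∣
    by-cases (yes f) = ≤-trans (≤-trans (≤-reflexive (sym card-full)) (card-mono full (set H) (λ {x} → f x))) (m≤m+n _ _)
    by-cases (no ¬f) = ≤-trans (index-bound H) (*-monoˡ-≤ ∣ set H ∣ (bound (⊈-witness full (set H) (λ f → ¬f (λ x → f)))))
      where
      bound : (∃ λ x → x ∈ full × x ∉ set H) → D.index F ≤ suc (outside H a (map idx S))
      bound (x , _ , x∉) = ≤-trans (m≤n+m∸n (D.index F) 1) (s≤s (≤-trans (hyp F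
        (A.enum x , trans (cong (λ i → does (dec (set H) i)) (idx-enum x)) (dec-false (dec (set H) x) x∉)) (A.enum a))
        (≤-reflexive (sym (outside-transfer H a S)))))

  module Main (n : ℕ) (1≤n : 1 ≤ n) (S : D.Seq) (len : n + N ∸ 1 ≤ length S) (h : D.h≤ S n)
    (hyp : ∀ (F : D.Subgroup) → D.Proper F → ∀ α → D.index F ∸ 1 ≤ D.outside F α S)
    (e : ℕ) (isExp : D.IsExponent e) where

    exp-idx : ∀ x → e · x ≡ idx A.ε
    exp-idx x = trans (cong (e ·_) (sym (idx-enum x))) (trans (idx-· e (A.enum x)) (idx-cong (proj₁ (proj₂ isExp) (A.enum x))))

    module Contra (z : Fin N) (z∉ : z ∉ Σs n (map idx S)) where
      open Conclusion n (map idx S)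
        (≤-trans (m≤n+m∸n (n + N) 1) (≤-trans (s≤s (≤-trans len (≤-reflexive (sym (length-map idx S))))) (≤-reflexive (+-comm 1 _))))
        (λ g → ≤-trans (v-transfer g S) (h (A.enum g))) (out-transfer S hyp) z z∉

      by-exponent : e ≤ n → ⊥
      by-exponent = exponent-case e (proj₁ isExp) exp-idx

      next-exponent : e ≡ suc n → (∃ λ F → D.DirectSumWithCyclic F e × (Prime (D.card F) ⊎ Prime e)) → ⊥
      next-exponent refl (F , _ , inj₂ pr) = prime-exponent-case pr exp-idx
      next-exponent refl (F , (c₀ , (_ , c-ord , c-min) , spans , indep) , inj₁ pr) =
        prime-summand-case (fromSubgroup F) (idx c₀) (subst Prime (sym (card-fromSubgroup F)) pr) exp-idx free all
        where
        mem-idx : ∀ x → D.mem F (A.enum (idx x)) ≡ D.mem F x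
        mem-idx x = D.mem-resp F (enum-idx x)
        free : ∀ i → 1 ≤ i → i < suc n → i · idx c₀ ∉ set (fromSubgroup F)
        free i 1≤i i<e p = n≮n i (≤-trans i<e (c-min i 1≤i (indep i
          (trans (sym (mem-idx (i D.· c₀))) (trans (cong (λ t → D.mem F (A.enum t)) (sym (idx-· i c₀))) p)))))
        M : Sg
        M = extend (fromSubgroup F) (idx c₀) (suc n) (s≤s z≤n) (resp (set (fromSubgroup F)) (sym (exp-idx (idx c₀))) (ε∈ (fromSubgroup F)))
        c∈ : idx c₀ ∈ set M
        c∈ = ∈-multiples (fromSubgroup F) (idx c₀) (suc n) 1 (s≤s 1≤n)
          (resp (set (fromSubgroup F)) (sym (trans (cong (idx c₀ -_) (identityʳ (idx c₀))) (inverseʳ (idx c₀)))) (ε∈ (fromSubgroup F)))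
        F⊆ : ∀ {y} → y ∈ set (fromSubgroup F) → y ∈ set M
        F⊆ {y} p = ∈-multiples (fromSubgroup F) (idx c₀) (suc n) 0 (s≤s z≤n)
          (resp (set (fromSubgroup F)) (sym (trans (cong (op y) ε⁻¹≈ε) (identityʳ y))) p)
        all : ∀ x → x ∈ multiples (fromSubgroup F) (idx c₀) (suc n)
        all x with spans (A.enum x)
        ... | k , m , k∈ , eq = resp (set M)
                (trans (cong (op (idx k)) (idx-· m c₀)) (trans (idx-∙ k (m D.· c₀)) (trans (idx-cong (A.sym eq)) (idx-enum x))))
                (∙∈ M (F⊆ (trans (mem-idx k) k∈)) (·∈ M m c∈))

      refute : D.Cond1 n e ⊎ D.Cond2 n e ⊎ D.Cond3 n e ⊎ D.Cond4 n e → ⊥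
      refute (inj₁ e≤n) = by-exponent e≤n
      -- An exponent e ≤ n falls under the first condition; the decomposition enters only for e = n
      -- + 1.
      refute (inj₂ (inj₁ (e≤n+1 , rest))) with m≤n⇒m<n∨m≡n (≤-trans e≤n+1 (≤-reflexive (+-comm n 1)))
      ... | inj₁ e<  = by-exponent (≤-pred e<)
      ... | inj₂ e≡  = next-exponent e≡ rest
      refute (inj₂ (inj₂ (inj₁ (_ , p , (pr , _ , smallest) , q , N≡ , q≤)))) = cyclic-case p q pr smallest N≡ q≤
      refute (inj₂ (inj₂ (inj₂ (_ , inj₁ e≤3)))) = by-exponent (≤-trans e≤3 3≤n)
      refute (inj₂ (inj₂ (inj₂ (_ , inj₂ lt))))  = small-case lt

    theorem : D.Cond1 n e ⊎ D.Cond2 n e ⊎ D.Cond3 n e ⊎ D.Cond4 n e → ∀ g → g D.∈Σ[ n ] S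
    theorem cond g = Σs-transfer n S g (decidable-stable (dec (Σs n (map idx S)) (idx g)) (λ z∉ → Contra.refute (idx g) z∉ cond))

theorem1p3 : ∀ {c ℓ : Level} (G : FiniteAbelianGroup c ℓ) →
    let open FAG G in
    (n : ℕ) → 1 ≤ n → (S : Seq) →
    n + FiniteAbelianGroup.size G ∸ 1 ≤ length S →
    h≤ S n →
    (∀ (H : Subgroup) → Proper H → ∀ α → index H ∸ 1 ≤ outside H α S) →
    (e : ℕ) → IsExponent e →
    (Cond1 n e ⊎ Cond2 n e ⊎ Cond3 n e ⊎ Cond4 n e) →
    ∀ g → g ∈Σ[ n ] S
theorem1p3 G n 1≤n S len h hyp e isExp = Transfer.Main.theorem G n 1≤n S len h hyp e isExp
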